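{- There is an absolute constant $c>0$ such that the following holds. Let $p$ be a prime and let $f_1, f_2:\mathbb F_p \to\mathbb C$. Define $F:\mathbb F_p\to\mathbb C$ by $$F(x) =\frac 1p \sum_{y\in\mathbb F_p} f_1 (x+y)\, f_2 (x+y^2).$$ Then $$\big\Vert F-\mathbb E[f_1]\cdot \mathbb E[f_2]\big\Vert_2 \leq c\,p^{ -\frac 1{10}} \Vert f_1\Vert_2 \cdot \Vert f_2\Vert_2 .$$
   Context: For $f:\mathbb F_p\to\mathbb C$, $\mathbb E[f]=\frac1p\sum_{x\in\mathbb F_p} f(x)$ and $\Vert f\Vert_2=\big(\frac1p\sum_{x\in\mathbb F_p}|f(x)|^2\big)^{1/2}$ (normalized counting measure). In $F-\mathbb E[f_1]\cdot\mathbb E[f_2]$, the product $\mathbb E[f_1]\mathbb E[f_2]$ denotes the constant function. -}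

module Defs where

open import Algebra.Bundles.Raw using (RawRing)
open import Data.Fin.Base using (Fin; toℕ)
open import Data.Integer.Base as ℤ using (+[1+_])
import Data.Integer.Properties as ℤ
open import Data.Nat.Base as ℕ using (ℕ; zero; suc; z≤n; s≤s)
import Data.Nat.Properties as ℕ
import Data.Nat.Coprimality as Coprimality
open import Data.Nat.DivMod using (_mod_)
open import Data.Product.Base using (_×_; _,_; ∃-syntax)
open import Data.Rational.Base
open import Data.Rational.Properties
open import Data.Rational.Solver using (module +-*-Solver)
open import Data.Sum.Base using (inj₁; inj₂)
open import Level using (0ℓ)
open import Relation.Binary.PropositionalEquality
open import Relation.Nullary using (yes; no)

open import Algebra.Definitions.RawSemiring +-*-rawSemiring using (_^_)
  renaming (_×_ to _·_)

half : ℚ → ℚ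
half ε = ½ * ε

half+half : ∀ ε → half ε + half ε ≡ ε
half+half ε = solve 1 (λ e → con ½ :* e :+ con ½ :* e := e) refl ε
  where open +-*-Solver

*-pos : ∀ {p q} → 0ℚ < p → 0ℚ < q → 0ℚ < p * q
*-pos {p} {q} 0<p 0<q =
  positive⁻¹ (p * q) {{pos*pos⇒pos p {{positive 0<p}} q {{positive 0<q}}}}

half-pos : ∀ {ε} → 0ℚ < ε → 0ℚ < half ε
half-pos = *-pos (positive⁻¹ ½)

*-nonNeg : ∀ {p q} → 0ℚ ≤ p → 0ℚ ≤ q → 0ℚ ≤ p * q
*-nonNeg {p} {q} 0≤p 0≤q =
  nonNegative⁻¹ (p * q)
    {{nonNeg*nonNeg⇒nonNeg p {{nonNegative 0≤p}} q {{nonNegative 0≤q}}}}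

+-nonNeg : ∀ {p q} → 0ℚ ≤ p → 0ℚ ≤ q → 0ℚ ≤ p + q
+-nonNeg {p} {q} 0≤p 0≤q = ≤-trans (≤-reflexive (sym (+-identityˡ 0ℚ))) (+-mono-≤ 0≤p 0≤q)

*-mono-≤-nonNeg : ∀ {p q r s} → 0ℚ ≤ p → 0ℚ ≤ s → p ≤ q → r ≤ s → p * r ≤ q * s
*-mono-≤-nonNeg {p} {q} {r} {s} 0≤p 0≤s p≤q r≤s = ≤-trans
  (*-monoˡ-≤-nonNeg p {{nonNegative 0≤p}} r≤s)
  (*-monoʳ-≤-nonNeg s {{nonNegative 0≤s}} p≤q)

p≤p+q : ∀ {p q} → 0ℚ ≤ q → p ≤ p + q
p≤p+q {p} {q} 0≤q = ≤-trans (≤-reflexive (sym (+-identityʳ p))) (+-monoʳ-≤ p 0≤q)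

p≤∣p∣ : ∀ p → p ≤ ∣ p ∣
p≤∣p∣ p with ≤-total 0ℚ p
... | inj₁ 0≤p = ≤-reflexive (sym (0≤p⇒∣p∣≡p 0≤p))
... | inj₂ p≤0 = ≤-trans p≤0 (0≤∣p∣ p)

∣p-q∣≡∣q-p∣ : ∀ p q → ∣ p - q ∣ ≡ ∣ q - p ∣
∣p-q∣≡∣q-p∣ p q = trans (sym (∣-p∣≡∣p∣ (p - q)))
  (cong ∣_∣ (solve 2 (λ a b → :- (a :- b) := b :- a) refl p q))
  where open +-*-Solver

∣p-q∣<ε⇒p<q+ε : ∀ {p q ε} → ∣ p - q ∣ < ε → p < q + ε
∣p-q∣<ε⇒p<q+ε {p} {q} {ε} h = subst (_< q + ε)
  (solve 2 (λ a b → b :+ (a :- b) := a) refl p q)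
  (+-monoʳ-< q (≤-<-trans (p≤∣p∣ (p - q)) h))
  where open +-*-Solver

p<q+ε⇒p-q<ε : ∀ {p q ε} → p < q + ε → p - q < ε
p<q+ε⇒p-q<ε {p} {q} {ε} h = subst (p - q <_)
  (solve 2 (λ b e → (b :+ e) :- b := e) refl q ε)
  (+-monoˡ-< (- q) h)
  where open +-*-Solver

∣p-q∣<ε : ∀ {p q ε} → p < q + ε → q < p + ε → ∣ p - q ∣ < ε
∣p-q∣<ε {p} {q} {ε} h k with ∣p∣≡p∨∣p∣≡-p (p - q)
... | inj₁ e = subst (_< ε) (sym e) (p<q+ε⇒p-q<ε h)
... | inj₂ e = subst (_< ε)
  (sym (trans e (solve 2 (λ a b → :- (a :- b) := b :- a) refl p q)))
  (p<q+ε⇒p-q<ε k)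
  where open +-*-Solver

fromℕ : ℕ → ℚ
fromℕ n = mkℚ (ℤ.+ n) 0 (Coprimality.sym (Coprimality.1-coprimeTo n))

1/suc_ : ℕ → ℚ
1/suc n = 1/ fromℕ (suc n)

1/suc-pos : ∀ n → 0ℚ < 1/suc n
1/suc-pos n = positive⁻¹ (1/suc n)

archimedean : ∀ ε → 0ℚ < ε → ∃[ N ] ∀ n → N ℕ.≤ n → 1/suc n < ε
archimedean ε@(mkℚ +[1+ a ] b _) _ = suc b , λ n b<n → *<* (ℤ.+<+ (begin-strict
  1 ℕ.* suc b       ≡⟨ ℕ.*-identityˡ (suc b) ⟩
  suc b             ≤⟨ b<n ⟩
  n                 <⟨ ℕ.n<1+n n ⟩
  suc n             ≤⟨ ℕ.m≤n*m (suc n) (suc a) ⟩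
  suc a ℕ.* suc n   ∎))
  where open ℕ.≤-Reasoning
archimedean (mkℚ (ℤ.+ 0) b _) (*<* (ℤ.+<+ ()))
archimedean (mkℚ (ℤ.-[1+ a ]) b _) (*<* ())

^-nonNeg : ∀ {p} d → 0ℚ ≤ p → 0ℚ ≤ p ^ d
^-nonNeg zero    _   = nonNegative⁻¹ 1ℚ
^-nonNeg (suc d) 0≤p = *-nonNeg 0≤p (^-nonNeg d 0≤p)

^-pos : ∀ {p} d → 0ℚ < p → 0ℚ < p ^ d
^-pos zero    _   = positive⁻¹ 1ℚ
^-pos (suc d) 0<p = *-pos 0<p (^-pos d 0<p)

^-mono-≤ : ∀ {p q} d → 0ℚ ≤ p → p ≤ q → p ^ d ≤ q ^ d
^-mono-≤ zero    _   _   = ≤-refl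
^-mono-≤ (suc d) 0≤p p≤q =
  *-mono-≤-nonNeg 0≤p (^-nonNeg d (≤-trans 0≤p p≤q)) p≤q (^-mono-≤ d 0≤p p≤q)

^-cancel-< : ∀ {p q} d → 0ℚ ≤ q → p ^ d < q ^ d → p < q
^-cancel-< {p} {q} d 0≤q h with p <? q
... | yes p<q = p<q
... | no  p≮q with () ← <-irrefl refl (<-≤-trans h (^-mono-≤ d 0≤q (≮⇒≥ p≮q)))

1≤p⇒1≤p^d : ∀ {p} d → 1ℚ ≤ p → 1ℚ ≤ p ^ d
1≤p⇒1≤p^d zero    _   = ≤-refl
1≤p⇒1≤p^d {p} (suc d) 1≤p = ≤-trans
  (≤-reflexive (sym (*-identityˡ 1ℚ)))
  (*-mono-≤-nonNeg 0≤1 (≤-trans 0≤1 ih) 1≤p ih)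
  where
  0≤1 = nonNegative⁻¹ 1ℚ
  ih = 1≤p⇒1≤p^d d 1≤p

1≤p⇒p≤p^[1+d] : ∀ {p} d → 1ℚ ≤ p → p ≤ p ^ suc d
1≤p⇒p≤p^[1+d] {p} d 1≤p = ≤-trans
  (≤-reflexive (sym (*-identityʳ p)))
  (*-mono-≤-nonNeg 0≤p (^-nonNeg d 0≤p) ≤-refl (1≤p⇒1≤p^d d 1≤p))
  where 0≤p = ≤-trans (nonNegative⁻¹ 1ℚ) 1≤p

^-superadditive : ∀ {p q} d → 0ℚ ≤ p → 0ℚ ≤ q →
                  p ^ suc d + q ^ suc d ≤ (p + q) ^ suc d
^-superadditive {p} {q} d 0≤p 0≤q = ≤-trans
  (+-mono-≤
    (*-monoˡ-≤-nonNeg p {{nonNegative 0≤p}} (^-mono-≤ d 0≤p (p≤p+q 0≤q)))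
    (*-monoˡ-≤-nonNeg q {{nonNegative 0≤q}} (^-mono-≤ d 0≤q
      (≤-trans (p≤p+q 0≤p) (≤-reflexive (+-comm q p))))))
  (≤-reflexive (sym (*-distribʳ-+ ((p + q) ^ d) p q)))

-- climb d q s k r is the last of r, r + s, …, r + k s reached by taking
-- steps of size s for as long as the d-th power stays at most q.

climb : ℕ → ℚ → ℚ → ℕ → ℚ → ℚ
climb d q s zero    r = r
climb d q s (suc k) r with (r + s) ^ d ≤? q
... | yes _ = climb d q s k (r + s)
... | no  _ = r

-- For q ≥ 0 and d ≥ 1 this is the largest multiple r of 1/(n+1) with
-- r ^ d ≤ q: the steps allowed lead up to 1 + numerator of q, whose d-th
-- power exceeds q.

rootApprox : ℕ → ℕ → ℚ → ℚ
rootApprox d n q = climb d q (1/suc n) (suc ℤ.∣ ↥ q ∣ ℕ.* suc n) 0ℚ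

climb-nonNeg : ∀ d q s k {r} → 0ℚ ≤ s → 0ℚ ≤ r → 0ℚ ≤ climb d q s k r
climb-nonNeg d q s zero        0≤s 0≤r = 0≤r
climb-nonNeg d q s (suc k) {r} 0≤s 0≤r with (r + s) ^ d ≤? q
... | yes _ = climb-nonNeg d q s k 0≤s (+-nonNeg 0≤r 0≤s)
... | no  _ = 0≤r

climb-lower : ∀ d q s k {r} → r ^ d ≤ q → climb d q s k r ^ d ≤ q
climb-lower d q s zero        h = h
climb-lower d q s (suc k) {r} h with (r + s) ^ d ≤? q
... | yes h′ = climb-lower d q s k h′
... | no  _  = h

climb-upper : ∀ d q s k {r} → 0ℚ ≤ s → 1ℚ ≤ r + k · s → q < r + k · s →
              q < (climb (suc d) q s k r + s) ^ suc d
climb-upper d q s zero    {r} 0≤s 1≤ q< = <-≤-trans q<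
  (≤-trans r+0≤r+s (1≤p⇒p≤p^[1+d] d (≤-trans 1≤ r+0≤r+s)))
  where r+0≤r+s = +-monoʳ-≤ r 0≤s
climb-upper d q s (suc k) {r} 0≤s 1≤ q< with (r + s) ^ suc d ≤? q
... | yes _ = climb-upper d q s k 0≤s
  (subst (1ℚ ≤_) (sym (+-assoc r s (k · s))) 1≤)
  (subst (q <_) (sym (+-assoc r s (k · s))) q<)
... | no ≰q = ≰⇒> ≰q

fromℕ-suc : ∀ n → 1ℚ + fromℕ n ≡ fromℕ (suc n)
fromℕ-suc n = trans
  (/-cong {q₂ = 1} (cong (λ i → ℤ.+ 1 ℤ.+ i) (ℤ.*-identityʳ (ℤ.+ n))) refl)
  (normalize-coprime (Coprimality.sym (Coprimality.1-coprimeTo (suc n))))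

·-* : ∀ k x → k · x ≡ fromℕ k * x
·-* zero    x = sym (*-zeroˡ x)
·-* (suc k) x = begin
  x + k · x            ≡⟨ cong (x +_) (·-* k x) ⟩
  x + fromℕ k * x      ≡⟨ cong (_+ fromℕ k * x) (sym (*-identityˡ x)) ⟩
  1ℚ * x + fromℕ k * x ≡⟨ sym (*-distribʳ-+ x 1ℚ (fromℕ k)) ⟩
  (1ℚ + fromℕ k) * x   ≡⟨ cong (_* x) (fromℕ-suc k) ⟩
  fromℕ (suc k) * x    ∎
  where open ≡-Reasoning

fromℕ-* : ∀ m n → fromℕ (m ℕ.* n) ≡ fromℕ m * fromℕ n
fromℕ-* m n = sym (trans
  (/-cong {q₂ = 1} (sym (ℤ.pos-* m n)) refl)
  (normalize-coprime (Coprimality.sym (Coprimality.1-coprimeTo (m ℕ.* n)))))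

steps : ∀ m n → (m ℕ.* suc n) · (1/suc n) ≡ fromℕ m
steps m n = begin
  (m ℕ.* suc n) · (1/suc n)               ≡⟨ ·-* (m ℕ.* suc n) (1/suc n) ⟩
  fromℕ (m ℕ.* suc n) * 1/suc n           ≡⟨ cong (_* 1/suc n) (fromℕ-* m (suc n)) ⟩
  fromℕ m * fromℕ (suc n) * 1/suc n       ≡⟨ *-assoc (fromℕ m) (fromℕ (suc n)) (1/suc n) ⟩
  fromℕ m * (fromℕ (suc n) * 1/suc n)     ≡⟨ cong (fromℕ m *_) (*-inverseʳ (fromℕ (suc n))) ⟩
  fromℕ m * 1ℚ                            ≡⟨ *-identityʳ (fromℕ m) ⟩
  fromℕ m                                 ∎
  where open ≡-Reasoning

q<fromℕ[1+∣↥q∣] : ∀ q → q < fromℕ (suc ℤ.∣ ↥ q ∣)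
q<fromℕ[1+∣↥q∣] (mkℚ (ℤ.+ a) b _) = *<* (subst₂ ℤ._<_
  (ℤ.pos-* a 1) (ℤ.pos-* (suc a) (suc b))
  (ℤ.+<+ (begin-strict
    a ℕ.* 1           ≡⟨ ℕ.*-identityʳ a ⟩
    a                 <⟨ ℕ.n<1+n a ⟩
    suc a             ≤⟨ ℕ.m≤m*n (suc a) (suc b) ⟩
    suc a ℕ.* suc b   ∎)))
  where open ℕ.≤-Reasoning
q<fromℕ[1+∣↥q∣] (mkℚ (ℤ.-[1+ a ]) b _) = *<* ℤ.-<+

1≤fromℕ[1+n] : ∀ n → 1ℚ ≤ fromℕ (suc n)
1≤fromℕ[1+n] n = *≤* (ℤ.+≤+ (s≤s z≤n))

rootApprox-nonNeg : ∀ d n q → 0ℚ ≤ rootApprox d n q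
rootApprox-nonNeg d n q =
  climb-nonNeg d q (1/suc n) (suc ℤ.∣ ↥ q ∣ ℕ.* suc n) (<⇒≤ (1/suc-pos n)) ≤-refl

rootApprox-lower : ∀ d n q → 0ℚ ≤ q → rootApprox (suc d) n q ^ suc d ≤ q
rootApprox-lower d n q 0≤q =
  climb-lower (suc d) q (1/suc n) (suc ℤ.∣ ↥ q ∣ ℕ.* suc n) {0ℚ}
    (≤-trans (≤-reflexive (*-zeroˡ (0ℚ ^ d))) 0≤q)

rootApprox-upper : ∀ d n q → q < (rootApprox (suc d) n q + 1/suc n) ^ suc d
rootApprox-upper d n q =
  climb-upper d q (1/suc n) (suc ℤ.∣ ↥ q ∣ ℕ.* suc n) {0ℚ} (<⇒≤ (1/suc-pos n))
    (subst (1ℚ ≤_) (sym total) (1≤fromℕ[1+n] ℤ.∣ ↥ q ∣))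
    (subst (q <_) (sym total) (q<fromℕ[1+∣↥q∣] q))
  where
  total : 0ℚ + (suc ℤ.∣ ↥ q ∣ ℕ.* suc n) · (1/suc n) ≡ fromℕ (suc ℤ.∣ ↥ q ∣)
  total = trans (+-identityˡ _) (steps (suc ℤ.∣ ↥ q ∣) n)

-- Reals are Cauchy sequences of rationals up to _≈ʳ_; the arithmetic
-- operations are pointwise.

IsCauchy : (ℕ → ℚ) → Set
IsCauchy x = ∀ ε → 0ℚ < ε →
  ∃[ N ] ∀ m n → N ℕ.≤ m → N ℕ.≤ n → ∣ x m - x n ∣ < ε

record ℝ : Set where
  constructor mkℝ
  field
    seq    : ℕ → ℚ
    cauchy : IsCauchy seq

open ℝ public

infix 4 _≈ʳ_ _≤ʳ_ _<ʳ_

_≈ʳ_ : ℝ → ℝ → Set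
x ≈ʳ y = ∀ ε → 0ℚ < ε → ∃[ N ] ∀ n → N ℕ.≤ n → ∣ seq x n - seq y n ∣ < ε

_≤ʳ_ : ℝ → ℝ → Set
x ≤ʳ y = ∀ ε → 0ℚ < ε → ∃[ N ] ∀ n → N ℕ.≤ n → seq x n < seq y n + ε

_<ʳ_ : ℝ → ℝ → Set
x <ʳ y = ∃[ ε ] 0ℚ < ε × ∃[ N ] ∀ n → N ℕ.≤ n → seq x n + ε < seq y n

fromℚ : ℚ → ℝ
fromℚ q = mkℝ (λ _ → q) λ ε 0<ε →
  0 , λ _ _ _ _ → subst (_< ε) (sym (cong ∣_∣ (+-inverseʳ q))) 0<ε

0ʳ 1ʳ : ℝ
0ʳ = fromℚ 0ℚ
1ʳ = fromℚ 1ℚ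

infix  8 -ʳ_
infixl 7 _*ʳ_
infixl 6 _+ʳ_ _-ʳ_

_+ʳ_ : ℝ → ℝ → ℝ
x +ʳ y = mkℝ (λ n → seq x n + seq y n) λ ε 0<ε →
  let N , x-close = cauchy x (half ε) (half-pos 0<ε)
      M , y-close = cauchy y (half ε) (half-pos 0<ε)
  in N ℕ.⊔ M , λ m n m≥ n≥ → begin-strict
    ∣ (seq x m + seq y m) - (seq x n + seq y n) ∣
      ≡⟨ cong ∣_∣ (solve 4 (λ a b c d → (a :+ b) :- (c :+ d) := (a :- c) :+ (b :- d))
           refl (seq x m) (seq y m) (seq x n) (seq y n)) ⟩
    ∣ (seq x m - seq x n) + (seq y m - seq y n) ∣
      ≤⟨ ∣p+q∣≤∣p∣+∣q∣ (seq x m - seq x n) (seq y m - seq y n) ⟩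
    ∣ seq x m - seq x n ∣ + ∣ seq y m - seq y n ∣
      <⟨ +-mono-< (x-close m n (ℕ.m⊔n≤o⇒m≤o N M m≥) (ℕ.m⊔n≤o⇒m≤o N M n≥))
                  (y-close m n (ℕ.m⊔n≤o⇒n≤o N M m≥) (ℕ.m⊔n≤o⇒n≤o N M n≥)) ⟩
    half ε + half ε
      ≡⟨ half+half ε ⟩
    ε ∎
  where
  open ≤-Reasoning
  open +-*-Solver

-ʳ_ : ℝ → ℝ
-ʳ x = mkℝ (λ n → - seq x n) λ ε 0<ε →
  let N , close = cauchy x ε 0<ε
  in N , λ m n m≥ n≥ → subst (_< ε)
    (cong ∣_∣ (solve 2 (λ a b → b :- a := :- a :- :- b) refl (seq x m) (seq x n)))
    (close n m n≥ m≥)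
  where open +-*-Solver

_-ʳ_ : ℝ → ℝ → ℝ
x -ʳ y = x +ʳ -ʳ y

eventually-bounded : ∀ x → ∃[ B ] 0ℚ < B × ∃[ N ] ∀ n → N ℕ.≤ n → ∣ seq x n ∣ < B
eventually-bounded x =
  let N , close = cauchy x 1ℚ (positive⁻¹ 1ℚ)
  in 1ℚ + ∣ seq x N ∣
   , +-mono-<-≤ (positive⁻¹ 1ℚ) (0≤∣p∣ (seq x N))
   , N , λ n n≥ → begin-strict
    ∣ seq x n ∣
      ≡⟨ cong ∣_∣ (solve 2 (λ a b → a := (a :- b) :+ b) refl (seq x n) (seq x N)) ⟩
    ∣ (seq x n - seq x N) + seq x N ∣
      ≤⟨ ∣p+q∣≤∣p∣+∣q∣ (seq x n - seq x N) (seq x N) ⟩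
    ∣ seq x n - seq x N ∣ + ∣ seq x N ∣
      <⟨ +-monoˡ-< ∣ seq x N ∣ (close n N n≥ ℕ.≤-refl) ⟩
    1ℚ + ∣ seq x N ∣ ∎
  where
  open ≤-Reasoning
  open +-*-Solver

divide : ∀ B ε → 0ℚ < B → 0ℚ < ε → ∃[ δ ] 0ℚ < δ × B * δ ≡ ε
divide B ε 0<B 0<ε = 1/ B * ε , *-pos 0<1/B 0<ε , (begin
  B * (1/ B * ε)  ≡⟨ sym (*-assoc B (1/ B) ε) ⟩
  B * 1/ B * ε    ≡⟨ cong (_* ε) (*-inverseʳ B) ⟩
  1ℚ * ε          ≡⟨ *-identityˡ ε ⟩
  ε               ∎)
  where
  open ≡-Reasoning
  instance
    B-pos : Positive B
    B-pos = positive 0<B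
    B-nonZero : NonZero B
    B-nonZero = pos⇒nonZero B
  0<1/B : 0ℚ < 1/ B
  0<1/B = positive⁻¹ (1/ B) {{1/pos⇒pos B}}

*-small : ∀ {a b B δ} → ∣ a ∣ < B → ∣ b ∣ < δ → 0ℚ < B → ∣ a * b ∣ < B * δ
*-small {a} {b} {B} {δ} a< b< 0<B = begin-strict
  ∣ a * b ∣       ≡⟨ ∣p*q∣≡∣p∣*∣q∣ a b ⟩
  ∣ a ∣ * ∣ b ∣   ≤⟨ *-monoʳ-≤-nonNeg ∣ b ∣ {{∣-∣-nonNeg b}} (<⇒≤ a<) ⟩
  B * ∣ b ∣       <⟨ *-monoʳ-<-pos B {{positive 0<B}} b< ⟩
  B * δ           ∎
  where open ≤-Reasoning

_*ʳ_ : ℝ → ℝ → ℝ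
x *ʳ y = mkℝ (λ n → seq x n * seq y n) λ ε 0<ε →
  let A , 0<A , K , x-bound = eventually-bounded x
      B , 0<B , L , y-bound = eventually-bounded y
      α , 0<α , Aα≡ = divide A (half ε) 0<A (half-pos 0<ε)
      β , 0<β , Bβ≡ = divide B (half ε) 0<B (half-pos 0<ε)
      N , x-close = cauchy x β 0<β
      M , y-close = cauchy y α 0<α
      KL = K ℕ.⊔ L
      NM = N ℕ.⊔ M
  in KL ℕ.⊔ NM , λ m n m≥ n≥ →
    let m≥KL = ℕ.m⊔n≤o⇒m≤o KL NM m≥
        n≥KL = ℕ.m⊔n≤o⇒m≤o KL NM n≥
        m≥NM = ℕ.m⊔n≤o⇒n≤o KL NM m≥
        n≥NM = ℕ.m⊔n≤o⇒n≤o KL NM n≥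
    in begin-strict
    ∣ seq x m * seq y m - seq x n * seq y n ∣
      ≡⟨ cong ∣_∣ (solve 4 (λ a b c d → a :* b :- c :* d := a :* (b :- d) :+ d :* (a :- c))
           refl (seq x m) (seq y m) (seq x n) (seq y n)) ⟩
    ∣ seq x m * (seq y m - seq y n) + seq y n * (seq x m - seq x n) ∣
      ≤⟨ ∣p+q∣≤∣p∣+∣q∣ (seq x m * (seq y m - seq y n)) (seq y n * (seq x m - seq x n)) ⟩
    ∣ seq x m * (seq y m - seq y n) ∣ + ∣ seq y n * (seq x m - seq x n) ∣
      <⟨ +-mono-<
           (*-small (x-bound m (ℕ.m⊔n≤o⇒m≤o K L m≥KL))
             (y-close m n (ℕ.m⊔n≤o⇒n≤o N M m≥NM) (ℕ.m⊔n≤o⇒n≤o N M n≥NM)) 0<A)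
           (*-small (y-bound n (ℕ.m⊔n≤o⇒n≤o K L n≥KL))
             (x-close m n (ℕ.m⊔n≤o⇒m≤o N M m≥NM) (ℕ.m⊔n≤o⇒m≤o N M n≥NM)) 0<B) ⟩
    A * α + B * β
      ≡⟨ cong₂ _+_ Aα≡ Bβ≡ ⟩
    half ε + half ε
      ≡⟨ half+half ε ⟩
    ε ∎
  where
  open ≤-Reasoning
  open +-*-Solver

ℝ-rawRing : RawRing 0ℓ 0ℓ
ℝ-rawRing = record
  { Carrier = ℝ ; _≈_ = _≈ʳ_
  ; _+_ = _+ʳ_ ; _*_ = _*ʳ_ ; -_ = -ʳ_ ; 0# = 0ʳ ; 1# = 1ʳ }

rootSeq : ℕ → (ℕ → ℚ) → ℕ → ℚ
rootSeq d x n = rootApprox d n (0ℚ ⊔ x n)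

rootSeq-cauchy : ∀ d .{{_ : ℕ.NonZero d}} x → IsCauchy x → IsCauchy (rootSeq d x)
rootSeq-cauchy (suc d) x x-cauchy ε 0<ε =
  let N , x-close = x-cauchy δ 0<δ
      M , 1/suc< = archimedean (half ε) (half-pos 0<ε)
      below : ∀ m n → N ℕ.⊔ M ℕ.≤ m → N ℕ.⊔ M ℕ.≤ n → r m < r n + ε
      below m n m≥ n≥ =
        let x-near = <⇒≤ (∣p-q∣<ε⇒p<q+ε {x m} {x n}
              (x-close m n (ℕ.m⊔n≤o⇒m≤o N M m≥) (ℕ.m⊔n≤o⇒m≤o N M n≥)))
        in ^-cancel-< (suc d) (+-nonNeg (r≥0 n) (<⇒≤ 0<ε)) (begin-strict
        r m ^ suc d
          ≤⟨ rootApprox-lower d m (0ℚ ⊔ x m) (p≤p⊔q 0ℚ (x m)) ⟩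
        0ℚ ⊔ x m
          ≤⟨ ⊔-lub (+-nonNeg (p≤p⊔q 0ℚ (x n)) (<⇒≤ 0<δ))
                   (≤-trans x-near (+-monoˡ-≤ δ (p≤q⊔p 0ℚ (x n)))) ⟩
        (0ℚ ⊔ x n) + δ
          <⟨ +-monoˡ-< δ (rootApprox-upper d n (0ℚ ⊔ x n)) ⟩
        (r n + 1/suc n) ^ suc d + half ε ^ suc d
          ≤⟨ ^-superadditive d (+-nonNeg (r≥0 n) (<⇒≤ (1/suc-pos n)))
               (<⇒≤ (half-pos 0<ε)) ⟩
        (r n + 1/suc n + half ε) ^ suc d
          ≤⟨ ^-mono-≤ (suc d)
               (+-nonNeg (+-nonNeg (r≥0 n) (<⇒≤ (1/suc-pos n))) (<⇒≤ (half-pos 0<ε)))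
               (+-monoˡ-≤ (half ε)
                 (+-monoʳ-≤ (r n) (<⇒≤ (1/suc< n (ℕ.m⊔n≤o⇒n≤o N M n≥))))) ⟩
        (r n + half ε + half ε) ^ suc d
          ≡⟨ cong (_^ suc d) (trans (+-assoc (r n) (half ε) (half ε))
               (cong (r n +_) (half+half ε))) ⟩
        (r n + ε) ^ suc d ∎)
  in N ℕ.⊔ M , λ m n m≥ n≥ → ∣p-q∣<ε (below m n m≥ n≥) (below n m n≥ m≥)
  where
  open ≤-Reasoning
  r : ℕ → ℚ
  r = rootSeq (suc d) x
  r≥0 : ∀ n → 0ℚ ≤ r n
  r≥0 n = rootApprox-nonNeg (suc d) n (0ℚ ⊔ x n)
  δ : ℚ
  δ = half ε ^ suc d
  0<δ : 0ℚ < δ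
  0<δ = ^-pos (suc d) (half-pos 0<ε)

-- The nonnegative d-th root of x when x ≥ 0 (and 0 when x ≤ 0).

root : (d : ℕ) .{{_ : ℕ.NonZero d}} → ℝ → ℝ
root d x = mkℝ (rootSeq d (seq x)) (rootSeq-cauchy d (seq x) (cauchy x))

√ : ℝ → ℝ
√ = root 2

infixl 6 _+i_
record ℂ : Set where
  constructor _+i_
  field
    re im : ℝ

open ℂ public

infix 4 _≈ᶜ_
infix  8 -ᶜ_
infixl 7 _*ᶜ_
infixl 6 _+ᶜ_ _-ᶜ_

_≈ᶜ_ : ℂ → ℂ → Set
z ≈ᶜ w = re z ≈ʳ re w × im z ≈ʳ im w

_+ᶜ_ _*ᶜ_ : ℂ → ℂ → ℂ
z +ᶜ w = (re z +ʳ re w) +i (im z +ʳ im w)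
z *ᶜ w = (re z *ʳ re w -ʳ im z *ʳ im w) +i (re z *ʳ im w +ʳ im z *ʳ re w)

-ᶜ_ : ℂ → ℂ
-ᶜ z = (-ʳ re z) +i (-ʳ im z)

_-ᶜ_ : ℂ → ℂ → ℂ
z -ᶜ w = z +ᶜ -ᶜ w

fromℝ : ℝ → ℂ
fromℝ x = x +i 0ʳ

∣_∣ᶜ : ℂ → ℝ
∣ z ∣ᶜ = √ (re z *ʳ re z +ʳ im z *ʳ im z)

ℂ-rawRing : RawRing 0ℓ 0ℓ
ℂ-rawRing = record
  { Carrier = ℂ ; _≈_ = _≈ᶜ_
  ; _+_ = _+ᶜ_ ; _*_ = _*ᶜ_ ; -_ = -ᶜ_ ; 0# = fromℝ 0ʳ ; 1# = fromℝ 1ʳ }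

open import Algebra.Definitions.RawMonoid (RawRing.+-rawMonoid ℝ-rawRing) public
  using () renaming (sum to Σʳ)
open import Algebra.Definitions.RawMonoid (RawRing.+-rawMonoid ℂ-rawRing) public
  using () renaming (sum to Σᶜ)

-- Residues mod p, with _⊕_ and _⊗_ below; a field when p is prime.

𝔽 : ℕ → Set
𝔽 = Fin

module _ {p : ℕ} .{{_ : ℕ.NonZero p}} where

  infixl 7 _⊗_
  infixl 6 _⊕_

  _⊕_ _⊗_ : 𝔽 p → 𝔽 p → 𝔽 p
  x ⊕ y = (toℕ x ℕ.+ toℕ y) mod p
  x ⊗ y = (toℕ x ℕ.* toℕ y) mod p

  𝔼 : (𝔽 p → ℂ) → ℂ
  𝔼 f = fromℝ (fromℚ (ℤ.+ 1 / p)) *ᶜ Σᶜ f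

  𝔼ʳ : (𝔽 p → ℝ) → ℝ
  𝔼ʳ f = fromℚ (ℤ.+ 1 / p) *ʳ Σʳ f

  ‖_‖₂ : (𝔽 p → ℂ) → ℝ
  ‖ f ‖₂ = √ (𝔼ʳ λ x → ∣ f x ∣ᶜ *ʳ ∣ f x ∣ᶜ)

{-# OPTIONS --safe #-}

-- Let T g x = Σ_y f(x + y) g(x + y²) with Σ g = 0, and w = T g.  By duality and
-- Cauchy–Schwarz ‖w‖⁴ ≤ ‖g‖² Var Q, where Q(z) = Σ_y w(z − y²) f(z − y² + y).
-- Expanding the square and writing s = y² − (y + d)², t = s + d, the off-diagonal
-- part of Var Q becomes a pairing Σ W_s(x) Φ_t(x + Y(s, t)) of the derivatives
-- W_s(x) = w(x) w(x + s) and Φ_t(x) = f(x) f(x + t), and the variance correction is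
-- exactly the contribution of the means of the W_s.  So the W_s may be centered, and
-- the pairing is bounded through the operator M B_s(x) = Σ_t B_t(x + Y(s, t)): its
-- entries are commuting convolutions, so ‖M M* W‖² is at most a sum of correlations
-- of W over the closed 4-cycles s, t, j, t′.  The displacement of a cycle with fixed
-- k = j − s, u = t − s, v = t′ − s is affine in s, and only O(p²) of the triples
-- (k, u, v) give slope 0; all others average a correlation of a mean-zero function
-- to 0.  This yields ‖w‖⁸ ≤ 64 p³ ‖f‖⁸ ‖g‖⁸ for sums over 𝔽 p, a saving of p^(-1/8)
-- in normalized norms.
--
-- These are polynomial inequalities over ℚ, valid for every term of the sequences
-- that represent the reals; only the roots need a passage to the limit.

module Submission where

open import Algebra.Bundles using (CommutativeRing)
import Algebra.Properties.CommutativeSemiring.Exp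
import Algebra.Properties.Semiring.Sum
open import Algebra.Solver.Ring.AlmostCommutativeRing using (fromCommutativeRing; _-Raw-AlmostCommutative⟶_)
import Algebra.Solver.Ring
open import Data.Fin.Base using (Fin; zero; suc; toℕ; fromℕ<)
open import Data.Fin.Permutation using (permutation)
import Data.Fin.Properties as Fin
open import Data.Integer.Base using (+_)
open import Data.Integer.Base as ℤ using (ℤ; _%ℕ_; _/ℕ_; 0ℤ; 1ℤ)
import Data.Integer.DivMod as ℤ
import Data.Integer.Properties as ℤ
open import Data.Integer.Solver using () renaming (module +-*-Solver to ℤSolver)
open import Data.Maybe.Base using (Maybe; just; nothing)
open import Data.Nat.Base using (ℕ; NonZero)
open import Data.Nat.Base as ℕ using (zero; suc)
import Data.Nat.Coprimality as Coprimality
import Data.Nat.Divisibility as ℕ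
import Data.Nat.DivMod as ℕ
open import Data.Nat.GCD using (module Bézout)
open import Data.Nat.Primality using (Prime; euclidsLemma)
import Data.Nat.Properties as ℕ
open import Data.Product.Base using (_×_; _,_; ∃-syntax; proj₁; proj₂; uncurry)
open import Data.Rational.Base hiding (NonZero)
open import Data.Rational.Properties hiding (_≟_)
open import Data.Rational.Solver using (module +-*-Solver)
import Data.Sum.Base as Sum
open import Data.Sum.Base using (_⊎_; inj₁; inj₂)
open import Level using (0ℓ)
open import Relation.Binary.PropositionalEquality
open import Relation.Nullary using (Dec; yes; no; contradiction; ¬_)
open import Defs

open import Algebra.Definitions.RawSemiring +-*-rawSemiring using (_^_)

open Algebra.Properties.CommutativeSemiring.Exp
  (CommutativeRing.commutativeSemiring +-*-commutativeRing)
  using (^-distrib-*; ^-assocʳ)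

open Algebra.Properties.Semiring.Sum (CommutativeRing.semiring +-*-commutativeRing)
  using (sum; sum-cong-≗; ∑-distrib-+; ∑-comm; *-distribˡ-sum; sum-permute)

-- Termwise work over `ℚ` excludes the characters of `𝔽 p`, so the convolution operators are never
-- diagonalized; Lagrange's identity, which needs only that they commute, replaces a comparison of
-- norms frequency by frequency. Duality closes up because `w` is itself paired with `T g`: with X
-- the centered pairing, ‖w‖⁴ ≤ ‖g‖² (‖w‖² ‖f‖² + X) and X⁴ ≤ 7 p³ ‖w‖⁸ ‖f‖⁸. In the fourth power of
-- the first inequality a factor ‖w‖⁸ cancels. Recovering y from s and d means dividing by 2d. Hence
-- p = 2 is settled separately by the trivial bound, and d = 0 by the convention 1/0 = 0, which
-- costs nothing since the spurious term is a square. Constants: 7 linear conditions describe the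
-- degenerate cycles, 64 = 8 (1 + 7), and splitting into real and imaginary parts gives 2⁴ · 64 · 64
-- = 2¹⁶. The exponent 1/10 comes from weakening 1/8 with the help of the bound without saving, and
-- 16 · 2¹⁶ = 4¹⁰ yields the final constant 4.

sq : ℚ → ℚ
sq x = x * x

sq-nonNeg : ∀ x → 0ℚ ≤ sq x
sq-nonNeg x with ≤-total 0ℚ x
... | inj₁ 0≤x = *-nonNeg 0≤x 0≤x
... | inj₂ x≤0 = subst (0ℚ ≤_) (solve 1 (λ x → (:- x) :* (:- x) := x :* x) refl x)
  (*-nonNeg (neg-antimono-≤ x≤0) (neg-antimono-≤ x≤0))
  where open +-*-Solver

-- Certificate form of a polynomial inequality: the difference is exhibited as a visibly nonnegative
-- `d`, which leaves an identity for the ring solver.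
≤-by : ∀ {x y} d → 0ℚ ≤ d → y ≡ x + d → x ≤ y
≤-by {x} {y} d 0≤d eq = begin
  x      ≡⟨ +-identityʳ x ⟨
  x + 0ℚ ≤⟨ +-monoʳ-≤ x 0≤d ⟩
  x + d  ≡⟨ eq ⟨
  y      ∎
  where open ≤-Reasoning

-- Sums as positive linear functionals

record Integral (X : Set) : Set where
  field
    ∫        : (X → ℚ) → ℚ
    ∫-cong   : {f g : X → ℚ} → (∀ x → f x ≡ g x) → ∫ f ≡ ∫ g
    ∫-+      : (f g : X → ℚ) → ∫ (λ x → f x + g x) ≡ ∫ f + ∫ g
    ∫-*      : ∀ c (f : X → ℚ) → ∫ (λ x → c * f x) ≡ c * ∫ f
    ∫-nonNeg : ∀ {f : X → ℚ} → (∀ x → 0ℚ ≤ f x) → 0ℚ ≤ ∫ f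

  ∫-*ʳ : (f : X → ℚ) (c : ℚ) → ∫ (λ x → f x * c) ≡ ∫ f * c
  ∫-*ʳ f c = trans (∫-cong λ x → *-comm (f x) c) (trans (∫-* c f) (*-comm c (∫ f)))

  ∫-neg : (f : X → ℚ) → ∫ (λ x → - f x) ≡ - ∫ f
  ∫-neg f = begin
    ∫ (λ x → - f x)       ≡⟨ ∫-cong (λ x → neg≡-1* (f x)) ⟩
    ∫ (λ x → - 1ℚ * f x)  ≡⟨ ∫-* (- 1ℚ) f ⟩
    - 1ℚ * ∫ f            ≡⟨ neg≡-1* (∫ f) ⟨
    - ∫ f                 ∎
    where
    open ≡-Reasoning
    open +-*-Solver
    neg≡-1* : ∀ x → - x ≡ - 1ℚ * x
    neg≡-1* = solve 1 (λ x → :- x := con (- 1ℚ) :* x) refl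

  ∫-- : (f g : X → ℚ) → ∫ (λ x → f x - g x) ≡ ∫ f - ∫ g
  ∫-- f g = trans (∫-+ f (λ x → - g x)) (cong (λ c → ∫ f + c) (∫-neg g))

  ∫-mono : {f g : X → ℚ} → (∀ x → f x ≤ g x) → ∫ f ≤ ∫ g
  ∫-mono {f} {g} h = ≤-by (∫ λ x → g x - f x) (∫-nonNeg λ x → p≤q⇒0≤q-p (h x)) (begin
    ∫ g                          ≡⟨ ∫-cong (λ x → solve 2 (λ a b → b := a :+ (b :- a)) refl (f x) (g x)) ⟩
    ∫ (λ x → f x + (g x - f x))  ≡⟨ ∫-+ f _ ⟩
    ∫ f + ∫ (λ x → g x - f x)    ∎)
    where
    open ≡-Reasoning
    open +-*-Solver
    p≤q⇒0≤q-p : ∀ {p q} → p ≤ q → 0ℚ ≤ q - p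
    p≤q⇒0≤q-p {p} {q} h = subst (_≤ q - p) (+-inverseʳ p) (+-monoˡ-≤ (- p) h)

  ∫-linear₃ : ∀ a b c (f g h : X → ℚ) →
    ∫ (λ x → a * f x + (b * g x + c * h x)) ≡ a * ∫ f + (b * ∫ g + c * ∫ h)
  ∫-linear₃ a b c f g h = begin
    ∫ (λ x → a * f x + (b * g x + c * h x))
      ≡⟨ ∫-+ (λ x → a * f x) (λ x → b * g x + c * h x) ⟩
    ∫ (λ x → a * f x) + ∫ (λ x → b * g x + c * h x)
      ≡⟨ cong₂ _+_ (∫-* a f) (∫-+ (λ x → b * g x) (λ x → c * h x)) ⟩
    a * ∫ f + (∫ (λ x → b * g x) + ∫ (λ x → c * h x))
      ≡⟨ cong (λ x → a * ∫ f + x) (cong₂ _+_ (∫-* b g) (∫-* c h)) ⟩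
    a * ∫ f + (b * ∫ g + c * ∫ h) ∎
    where open ≡-Reasoning

  -- Lagrange's identity: the double integral `E` of the squares of `f x * g y - f y * g x` is twice
  -- the gap between the two sides. Nothing is divided by, so a vanishing norm is not a special
  -- case.
  cauchy-schwarz : (f g : X → ℚ) → sq (∫ λ x → f x * g x) ≤ ∫ (λ x → sq (f x)) * ∫ (λ x → sq (g x))
  cauchy-schwarz f g = ≤-by (½ * E) (*-nonNeg (nonNegative⁻¹ ½) E≥0)
    (trans (solve 3 (λ f g d → f :* g := d :* d :+ con ½ :*
             (f :* g :+ ((:- (d :+ d)) :* d :+ g :* f))) refl F G D)
      (cong (λ e → sq D + ½ * e) (sym E≡)))
    where
    open ≡-Reasoning
    open +-*-Solver
    F = ∫ λ x → sq (f x)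
    G = ∫ λ x → sq (g x)
    D = ∫ λ x → f x * g x
    E = ∫ λ x → ∫ λ y → sq (f x * g y - f y * g x)
    E≥0 : 0ℚ ≤ E
    E≥0 = ∫-nonNeg λ x → ∫-nonNeg λ y → sq-nonNeg (f x * g y - f y * g x)
    inner : ∀ x → ∫ (λ y → sq (f x * g y - f y * g x))
      ≡ sq (f x) * G + (- (D + D) * (f x * g x) + sq (g x) * F)
    inner x = begin
      ∫ (λ y → sq (f x * g y - f y * g x))
        ≡⟨ ∫-cong (λ y → solve 4 (λ a b c d → (a :* d :- c :* b) :* (a :* d :- c :* b)
             := a :* a :* (d :* d) :+ ((:- (a :* b :+ a :* b)) :* (c :* d) :+ b :* b :* (c :* c)))
             refl (f x) (g x) (f y) (g y)) ⟩
      ∫ (λ y → sq (f x) * sq (g y) + (- (f x * g x + f x * g x) * (f y * g y) + sq (g x) * sq (f y)))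
        ≡⟨ ∫-linear₃ (sq (f x)) (- (f x * g x + f x * g x)) (sq (g x)) _ _ _ ⟩
      sq (f x) * G + (- (f x * g x + f x * g x) * D + sq (g x) * F)
        ≡⟨ solve 5 (λ a b d f g → a :* a :* g :+ ((:- (a :* b :+ a :* b)) :* d :+ b :* b :* f)
             := a :* a :* g :+ ((:- (d :+ d)) :* (a :* b) :+ b :* b :* f)) refl (f x) (g x) D F G ⟩
      sq (f x) * G + (- (D + D) * (f x * g x) + sq (g x) * F) ∎
    E≡ : E ≡ F * G + (- (D + D) * D + G * F)
    E≡ = begin
      E
        ≡⟨ ∫-cong inner ⟩
      ∫ (λ x → sq (f x) * G + (- (D + D) * (f x * g x) + sq (g x) * F))
        ≡⟨ ∫-cong (λ x → cong₂ _+_ (*-comm (sq (f x)) G)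
             (cong (λ e → - (D + D) * (f x * g x) + e) (*-comm (sq (g x)) F))) ⟩
      ∫ (λ x → G * sq (f x) + (- (D + D) * (f x * g x) + F * sq (g x)))
        ≡⟨ ∫-linear₃ G (- (D + D)) F _ _ _ ⟩
      G * F + (- (D + D) * D + F * G)
        ≡⟨ cong₂ (λ a b → a + (- (D + D) * D + b)) (*-comm G F) (*-comm F G) ⟩
      F * G + (- (D + D) * D + G * F) ∎

counting : ∀ n → Integral (Fin n)
counting n = record
  { ∫        = sum
  ; ∫-cong   = sum-cong-≗
  ; ∫-+      = ∑-distrib-+
  ; ∫-*      = λ c f → sym (*-distribˡ-sum c f)
  ; ∫-nonNeg = sum-nonNeg }
  where
  sum-nonNeg : ∀ {n} {f : Fin n → ℚ} → (∀ x → 0ℚ ≤ f x) → 0ℚ ≤ sum f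
  sum-nonNeg {zero}  h = ≤-refl
  sum-nonNeg {suc n} h = +-nonNeg (h zero) (sum-nonNeg λ x → h (suc x))

-- Iterated sums are again positive linear functionals, so Cauchy-Schwarz for doubly indexed
-- families is an instance of the general one.
_⊗ᴵ_ : {X Y : Set} → Integral X → Integral Y → Integral (X × Y)
I ⊗ᴵ J = record
  { ∫        = λ f → I.∫ λ x → J.∫ λ y → f (x , y)
  ; ∫-cong   = λ h → I.∫-cong λ x → J.∫-cong λ y → h (x , y)
  ; ∫-+      = λ f g → trans (I.∫-cong λ x → J.∫-+ _ _) (I.∫-+ _ _)
  ; ∫-*      = λ c f → trans (I.∫-cong λ x → J.∫-* c _) (I.∫-* c _)
  ; ∫-nonNeg = λ h → I.∫-nonNeg λ x → J.∫-nonNeg λ y → h (x , y) }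
  where
  module I = Integral I
  module J = Integral J

sum-const : ∀ n c → sum {n} (λ _ → c) ≡ fromℕ n * c
sum-const zero    c = sym (*-zeroˡ c)
sum-const (suc n) c = begin
  c + sum {n} (λ _ → c)   ≡⟨ cong₂ _+_ (sym (*-identityˡ c)) (sum-const n c) ⟩
  1ℚ * c + fromℕ n * c    ≡⟨ *-distribʳ-+ c 1ℚ (fromℕ n) ⟨
  (1ℚ + fromℕ n) * c      ≡⟨ cong (_* c) (fromℕ-suc n) ⟩
  fromℕ (suc n) * c       ∎
  where open ≡-Reasoning

sum-bijection : ∀ {m n} (π : Fin m → Fin n) (π⁻¹ : Fin n → Fin m) →
  (∀ x → π (π⁻¹ x) ≡ x) → (∀ x → π⁻¹ (π x) ≡ x) →
  ∀ f → sum f ≡ sum (λ x → f (π x))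
sum-bijection π π⁻¹ ππ⁻¹ π⁻¹π f = sum-permute f (permutation π π⁻¹ ππ⁻¹ π⁻¹π)

-- Indicators of decidable propositions

𝟙 : {A : Set} → Dec A → ℚ
𝟙 (yes _) = 1ℚ
𝟙 (no _)  = 0ℚ

𝟙-nonNeg : {A : Set} (d : Dec A) → 0ℚ ≤ 𝟙 d
𝟙-nonNeg (yes _) = nonNegative⁻¹ 1ℚ
𝟙-nonNeg (no _)  = ≤-refl

𝟙-yes : {A : Set} (d : Dec A) → A → 𝟙 d ≡ 1ℚ
𝟙-yes (yes _) _ = refl
𝟙-yes (no ¬a) a = contradiction a ¬a

𝟙-no : {A : Set} (d : Dec A) → ¬ A → 𝟙 d ≡ 0ℚ
𝟙-no (yes a) ¬a = contradiction a ¬a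
𝟙-no (no _)  _  = refl

𝟙-cong : {A B : Set} (a? : Dec A) (b? : Dec B) → (A → B) → (B → A) → 𝟙 a? ≡ 𝟙 b?
𝟙-cong (yes a) b? f g = sym (𝟙-yes b? (f a))
𝟙-cong (no ¬a) b? f g = sym (𝟙-no b? λ b → ¬a (g b))

sum-𝟙 : ∀ {n} (a : Fin n) → Integral.∫ (counting n) (λ x → 𝟙 (x Fin.≟ a)) ≡ 1ℚ
sum-𝟙 {suc n} zero = cong (λ x → 1ℚ + x) (trans (sum-const n 0ℚ) (*-zeroʳ (fromℕ n)))
sum-𝟙 {suc n} (suc a) = trans (+-identityˡ _) (trans
  (Integral.∫-cong (counting n) λ x →
    𝟙-cong (suc x Fin.≟ suc a) (x Fin.≟ a) Fin.suc-injective (cong suc))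
  (sum-𝟙 a))

fromℕ-mono : ∀ {m n} → m ℕ.≤ n → fromℕ m ≤ fromℕ n
fromℕ-mono {m} {n} m≤n = *≤* (subst₂ ℤ._≤_
  (sym (ℤ.*-identityʳ (+ m))) (sym (ℤ.*-identityʳ (+ n))) (ℤ.+≤+ m≤n))

-- The number of linear conditions in `Degenerate`.
seven : ℚ
seven = + 7 / 1

-- Inequalities for fourth powers

fourth : ℚ → ℚ
fourth x = sq (sq x)

fourth-nonNeg : ∀ x → 0ℚ ≤ fourth x
fourth-nonNeg x = sq-nonNeg (sq x)

sq-mono : ∀ {x y} → 0ℚ ≤ x → x ≤ y → sq x ≤ sq y
sq-mono 0≤x x≤y = *-mono-≤-nonNeg 0≤x (≤-trans 0≤x x≤y) x≤y x≤y

fourth-mono : ∀ {x y} → 0ℚ ≤ x → x ≤ y → fourth x ≤ fourth y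
fourth-mono {x} 0≤x x≤y = sq-mono (sq-nonNeg x) (sq-mono 0≤x x≤y)

sq-+-≤ : ∀ x y → sq (x + y) ≤ (1ℚ + 1ℚ) * (sq x + sq y)
sq-+-≤ x y = ≤-by (sq (x - y)) (sq-nonNeg (x - y))
  (solve 2 (λ x y → con (1ℚ + 1ℚ) :* (x :* x :+ y :* y)
    := (x :+ y) :* (x :+ y) :+ (x :- y) :* (x :- y)) refl x y)
  where open +-*-Solver

fourth-* : ∀ x y → fourth (x * y) ≡ fourth x * fourth y
fourth-* = solve 2 (λ x y → (x :* y :* (x :* y)) :* (x :* y :* (x :* y))
  := (x :* x :* (x :* x)) :* (y :* y :* (y :* y))) refl
  where open +-*-Solver

-- `sq-+-≤` applied twice; its factor 2 is squared once, which gives 8 = 2² · 2.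
fourth-+-≤ : ∀ x y → fourth (x + y) ≤ (+ 8 / 1) * (fourth x + fourth y)
fourth-+-≤ x y = begin
  sq (sq (x + y))
    ≤⟨ sq-mono (sq-nonNeg (x + y)) (sq-+-≤ x y) ⟩
  sq (two * (sq x + sq y))
    ≡⟨ solve 1 (λ s → (con two :* s) :* (con two :* s) := con two :* con two :* (s :* s)) refl (sq x + sq y) ⟩
  two * two * sq (sq x + sq y)
    ≤⟨ *-monoˡ-≤-nonNeg (two * two) (sq-+-≤ (sq x) (sq y)) ⟩
  two * two * (two * (fourth x + fourth y))
    ≡⟨ *-assoc (two * two) two (fourth x + fourth y) ⟨
  (+ 8 / 1) * (fourth x + fourth y) ∎
  where
  open ≤-Reasoning
  open +-*-Solver
  two = 1ℚ + 1ℚ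

fourth-superadditive : ∀ {x y} → 0ℚ ≤ x → 0ℚ ≤ y → fourth x + fourth y ≤ fourth (x + y)
fourth-superadditive {x} {y} 0≤x 0≤y = ≤-by
  ((+ 4 / 1) * (x * y) * (sq x + sq y) + (+ 6 / 1) * sq (x * y))
  (+-nonNeg
    (*-nonNeg (*-nonNeg (nonNegative⁻¹ (+ 4 / 1)) (*-nonNeg 0≤x 0≤y))
              (+-nonNeg (sq-nonNeg x) (sq-nonNeg y)))
    (*-nonNeg (nonNegative⁻¹ (+ 6 / 1)) (sq-nonNeg (x * y))))
  (solve 2 (λ x y → ((x :+ y) :* (x :+ y)) :* ((x :+ y) :* (x :+ y))
    := ((x :* x) :* (x :* x) :+ (y :* y) :* (y :* y))
      :+ (con (+ 4 / 1) :* (x :* y) :* (x :* x :+ y :* y)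
        :+ con (+ 6 / 1) :* ((x :* y) :* (x :* y)))) refl x y)
  where open +-*-Solver

-- Cancels a factor `b` that may be zero: were `b` larger than `K`, it would be positive and the
-- cancellation legitimate.
b²≤bK⇒b≤K : ∀ {b K} → 0ℚ ≤ K → b * b ≤ b * K → b ≤ K
b²≤bK⇒b≤K {b} {K} 0≤K h with b ≤? K
... | yes b≤K = b≤K
... | no b≰K = contradiction
  (<-≤-trans (*-monoʳ-<-pos b {{positive (≤-<-trans 0≤K (≰⇒> b≰K))}} (≰⇒> b≰K)) h)
  (<-irrefl refl)

-- X stands for the pairing Σ W_s(x) Φ_t(x + Y(s, t)) and a for ‖w‖².

cycle-estimate⇒bound : ∀ a F G X P³ → 0ℚ ≤ F → 0ℚ ≤ G → 1ℚ ≤ P³ →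
  sq a ≤ G * (a * F + X) → fourth X ≤ seven * P³ * (fourth a * fourth F) →
  fourth a ≤ (+ 64 / 1) * P³ * (fourth F * fourth G)
cycle-estimate⇒bound a F G X P³ 0≤F 0≤G 1≤P³ a²≤ X⁴≤ =
  b²≤bK⇒b≤K (*-nonNeg (*-nonNeg (nonNegative⁻¹ (+ 64 / 1)) (≤-trans (nonNegative⁻¹ 1ℚ) 1≤P³))
      (*-nonNeg (fourth-nonNeg F) (fourth-nonNeg G))) (begin
    fourth a * fourth a
      ≡⟨ fourth-* a a ⟨
    fourth (sq a)
      ≤⟨ fourth-mono (sq-nonNeg a) a²≤ ⟩
    fourth (G * (a * F + X))
      ≡⟨ fourth-* G (a * F + X) ⟩
    fourth G * fourth (a * F + X)
      ≤⟨ *-monoˡ-≤-nonNeg (fourth G) {{nonNegative (fourth-nonNeg G)}} (fourth-+-≤ (a * F) X) ⟩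
    fourth G * (8ℚ * (fourth (a * F) + fourth X))
      -- `1 ≤ P³` puts the diagonal term `a * F` on the scale of the bound for `X`; this is the 1 in
      -- 64 = 8 · (1 + 7).
      ≤⟨ *-monoˡ-≤-nonNeg (fourth G) {{nonNegative (fourth-nonNeg G)}} (*-monoˡ-≤-nonNeg 8ℚ
           (+-mono-≤ (≤-trans (≤-reflexive (trans (fourth-* a F) (sym (*-identityˡ (fourth a * fourth F)))))
             (*-monoʳ-≤-nonNeg (fourth a * fourth F) {{nonNegative aF≥0}} 1≤P³)) X⁴≤)) ⟩
    fourth G * (8ℚ * (P³ * (fourth a * fourth F) + seven * P³ * (fourth a * fourth F)))
      ≡⟨ solve 4 (λ a f g p → g :* (con 8ℚ :* (p :* (a :* f) :+ con seven :* p :* (a :* f)))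
           := a :* (con (+ 64 / 1) :* p :* (f :* g))) refl (fourth a) (fourth F) (fourth G) P³ ⟩
    fourth a * ((+ 64 / 1) * P³ * (fourth F * fourth G)) ∎)
  where
  open ≤-Reasoning
  open +-*-Solver
  8ℚ = + 8 / 1
  aF≥0 = *-nonNeg (fourth-nonNeg a) (fourth-nonNeg F)

fromℕ-*-1/ : ∀ n .{{_ : NonZero n}} → fromℕ n * (1ℤ / n) ≡ 1ℚ
fromℕ-*-1/ (suc n) = trans
  (cong (fromℕ (suc n) *_) (normalize-coprime (Coprimality.1-coprimeTo (suc n))))
  (*-inverseʳ (fromℕ (suc n)))

1/-nonNeg : ∀ n .{{_ : NonZero n}} → 0ℚ ≤ 1ℤ / n
1/-nonNeg n = nonNegative⁻¹ (1ℤ / n) {{normalize-nonNeg 1 n}}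

-- The reciprocal `r` of `p` is an abstract rational known only through `0≤r` and `Pr≡1`, so it
-- behaves as a variable in the ring computations.
module Modulus (p : ℕ) .{{_ : NonZero p}} (r : ℚ) (0≤r : 0ℚ ≤ r) (Pr≡1 : fromℕ p * r ≡ 1ℚ) where

  -- Residues modulo p

  residue : ℤ → 𝔽 p
  residue i = fromℕ< (ℤ.n%ℕd<d i p)

  toℕ-residue : ∀ i → toℕ (residue i) ≡ i %ℕ p
  toℕ-residue i = Fin.toℕ-fromℕ< (ℤ.n%ℕd<d i p)

  -- The difference of two numbers below `p` has absolute value below `p`, and as a multiple of `p`
  -- it must then vanish.
  remainder-unique : ∀ {m n} k → m ℕ.< p → n ℕ.< p → + m ≡ + n ℤ.+ k ℤ.* + p → m ≡ n
  remainder-unique {m} {n} k m<p n<p eq = ℤ.+-injective (begin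
    + m               ≡⟨ eq ⟩
    + n ℤ.+ k ℤ.* + p ≡⟨ cong (λ k → + n ℤ.+ k ℤ.* + p) (ℤ.∣i∣≡0⇒i≡0 {k} (quotient≡0 ℤ.∣ k ∣ ∣k∣p<p)) ⟩
    + n ℤ.+ 0ℤ        ≡⟨ ℤ.+-identityʳ (+ n) ⟩
    + n               ∎)
    where
    open ≡-Reasoning
    difference : k ℤ.* + p ≡ m ℤ.⊖ n
    difference = trans (solve 2 (λ a b → b := (a :+ b) :- a) refl (+ n) (k ℤ.* + p))
      (trans (cong (ℤ._- + n) (sym eq)) (ℤ.m-n≡m⊖n m n))
      where open ℤSolver
    ∣k∣p<p : ℤ.∣ k ∣ ℕ.* p ℕ.< p
    ∣k∣p<p = subst (ℕ._< p)
      (trans (cong ℤ.∣_∣ (sym difference)) (ℤ.abs-* k (+ p)))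
      (ℕ.≤-<-trans (ℤ.∣m⊝n∣≤m⊔n m n) (ℕ.⊔-pres-<m m<p n<p))
    quotient≡0 : ∀ a → a ℕ.* p ℕ.< p → a ≡ 0
    quotient≡0 zero  _ = refl
    quotient≡0 (suc a) h = contradiction h (ℕ.≤⇒≯ (ℕ.m≤m+n p (a ℕ.* p)))

  residue-cong : ∀ i j k → i ≡ j ℤ.+ k ℤ.* + p → residue i ≡ residue j
  residue-cong i j k eq = Fin.toℕ-injective
    (trans (toℕ-residue i) (trans
      (remainder-unique (j /ℕ p ℤ.+ k ℤ.- i /ℕ p) (ℤ.n%ℕd<d i p) (ℤ.n%ℕd<d j p) (begin
        + (i %ℕ p)
          ≡⟨ solve 2 (λ a b → a := (a :+ b) :- b) refl (+ (i %ℕ p)) (i /ℕ p ℤ.* + p) ⟩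
        (+ (i %ℕ p) ℤ.+ i /ℕ p ℤ.* + p) ℤ.- i /ℕ p ℤ.* + p
          ≡⟨ cong (ℤ._- i /ℕ p ℤ.* + p) (trans (sym (ℤ.a≡a%ℕn+[a/ℕn]*n i p)) eq) ⟩
        (j ℤ.+ k ℤ.* + p) ℤ.- i /ℕ p ℤ.* + p
          ≡⟨ cong (λ j → (j ℤ.+ k ℤ.* + p) ℤ.- i /ℕ p ℤ.* + p) (ℤ.a≡a%ℕn+[a/ℕn]*n j p) ⟩
        ((+ (j %ℕ p) ℤ.+ j /ℕ p ℤ.* + p) ℤ.+ k ℤ.* + p) ℤ.- i /ℕ p ℤ.* + p
          ≡⟨ solve 5 (λ r a k b q → ((r :+ a :* q) :+ k :* q) :- b :* q := r :+ (a :+ k :- b) :* q)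
               refl (+ (j %ℕ p)) (j /ℕ p) k (i /ℕ p) (+ p) ⟩
        + (j %ℕ p) ℤ.+ (j /ℕ p ℤ.+ k ℤ.- i /ℕ p) ℤ.* + p ∎))
    (sym (toℕ-residue j))))
    where
    open ≡-Reasoning
    open ℤSolver

  lift : 𝔽 p → ℤ
  lift x = + toℕ x

  lift-residue : ∀ i → i ≡ lift (residue i) ℤ.+ (i /ℕ p) ℤ.* + p
  lift-residue i = trans (ℤ.a≡a%ℕn+[a/ℕn]*n i p)
    (cong (λ m → + m ℤ.+ (i /ℕ p) ℤ.* + p) (sym (toℕ-residue i)))

  residue-lift : ∀ x → residue (lift x) ≡ x
  residue-lift x = Fin.toℕ-injective
    (trans (toℕ-residue (lift x)) (ℕ.m<n⇒m%n≡m (Fin.toℕ<n x)))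

  -- The analogue for `_⊕_` holds by computation, but a product in `ℤ` is formed through signs and
  -- needs `ℤ.pos-*`.
  ⊗-residue : ∀ x y → x ⊗ y ≡ residue (lift x ℤ.* lift y)
  ⊗-residue x y = cong residue (ℤ.pos-* (toℕ x) (toℕ y))

  infix 8 ⊖_
  ⊖_ : 𝔽 p → 𝔽 p
  ⊖ x = residue (ℤ.- lift x)

  residue-+ : ∀ i j → residue (i ℤ.+ j) ≡ residue i ⊕ residue j
  residue-+ i j = residue-cong (i ℤ.+ j) (lift (residue i) ℤ.+ lift (residue j)) (i /ℕ p ℤ.+ j /ℕ p) (trans
    (cong₂ ℤ._+_ (lift-residue i) (lift-residue j))
    (solve 5 (λ a b c d q → (a :+ b :* q) :+ (c :+ d :* q) := (a :+ c) :+ (b :+ d) :* q)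
      refl (lift (residue i)) (i /ℕ p) (lift (residue j)) (j /ℕ p) (+ p)))
    where open ℤSolver

  residue-* : ∀ i j → residue (i ℤ.* j) ≡ residue i ⊗ residue j
  residue-* i j = trans
    (residue-cong (i ℤ.* j) (lift (residue i) ℤ.* lift (residue j))
      (lift (residue i) ℤ.* (j /ℕ p) ℤ.+ (i /ℕ p) ℤ.* lift (residue j)
                    ℤ.+ (i /ℕ p) ℤ.* (j /ℕ p) ℤ.* + p) (trans
      (cong₂ ℤ._*_ (lift-residue i) (lift-residue j))
      (solve 5 (λ a b c d q → (a :+ b :* q) :* (c :+ d :* q)
          := a :* c :+ (a :* d :+ b :* c :+ b :* d :* q) :* q)
        refl (lift (residue i)) (i /ℕ p) (lift (residue j)) (j /ℕ p) (+ p))))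
    (sym (⊗-residue (residue i) (residue j)))
    where open ℤSolver

  residue-neg : ∀ i → residue (ℤ.- i) ≡ ⊖ residue i
  residue-neg i = residue-cong (ℤ.- i) (ℤ.- lift (residue i)) (ℤ.- (i /ℕ p)) (trans
    (cong ℤ.-_ (lift-residue i))
    (solve 3 (λ a b q → :- (a :+ b :* q) := :- a :+ (:- b) :* q)
      refl (lift (residue i)) (i /ℕ p) (+ p)))
    where open ℤSolver

  0# 1# : 𝔽 p
  0# = residue 0ℤ
  1# = residue 1ℤ

  private
    -- Every element of `𝔽 p` is the residue of an integer, so the ring laws can be checked on
    -- residues, where they are inherited from `ℤ`.
    transport₁ : ∀ {f g : 𝔽 p → 𝔽 p} →
      (∀ i → f (residue i) ≡ g (residue i)) → ∀ x → f x ≡ g x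
    transport₁ {f} {g} h x = subst (λ x → f x ≡ g x) (residue-lift x) (h (lift x))

    transport₂ : ∀ {f g : 𝔽 p → 𝔽 p → 𝔽 p} →
      (∀ i j → f (residue i) (residue j) ≡ g (residue i) (residue j)) → ∀ x y → f x y ≡ g x y
    transport₂ h x = transport₁ λ j → transport₁ (λ i → h i j) x

    transport₃ : ∀ {f g : 𝔽 p → 𝔽 p → 𝔽 p → 𝔽 p} →
      (∀ i j k → f (residue i) (residue j) (residue k) ≡ g (residue i) (residue j) (residue k)) →
      ∀ x y z → f x y z ≡ g x y z
    transport₃ h x y = transport₁ λ k → transport₂ (λ i j → h i j k) x y

  ⊕-assoc : ∀ x y z → x ⊕ y ⊕ z ≡ x ⊕ (y ⊕ z)
  ⊕-assoc = transport₃ λ i j k → begin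
    residue i ⊕ residue j ⊕ residue k   ≡⟨ cong (_⊕ residue k) (residue-+ i j) ⟨
    residue (i ℤ.+ j) ⊕ residue k       ≡⟨ residue-+ (i ℤ.+ j) k ⟨
    residue (i ℤ.+ j ℤ.+ k)             ≡⟨ cong residue (ℤ.+-assoc i j k) ⟩
    residue (i ℤ.+ (j ℤ.+ k))           ≡⟨ residue-+ i (j ℤ.+ k) ⟩
    residue i ⊕ residue (j ℤ.+ k)       ≡⟨ cong (residue i ⊕_) (residue-+ j k) ⟩
    residue i ⊕ (residue j ⊕ residue k) ∎
    where open ≡-Reasoning

  ⊗-assoc : ∀ x y z → x ⊗ y ⊗ z ≡ x ⊗ (y ⊗ z)
  ⊗-assoc = transport₃ λ i j k → begin
    residue i ⊗ residue j ⊗ residue k   ≡⟨ cong (_⊗ residue k) (residue-* i j) ⟨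
    residue (i ℤ.* j) ⊗ residue k       ≡⟨ residue-* (i ℤ.* j) k ⟨
    residue (i ℤ.* j ℤ.* k)             ≡⟨ cong residue (ℤ.*-assoc i j k) ⟩
    residue (i ℤ.* (j ℤ.* k))           ≡⟨ residue-* i (j ℤ.* k) ⟩
    residue i ⊗ residue (j ℤ.* k)       ≡⟨ cong (residue i ⊗_) (residue-* j k) ⟩
    residue i ⊗ (residue j ⊗ residue k) ∎
    where open ≡-Reasoning

  ⊕-comm : ∀ x y → x ⊕ y ≡ y ⊕ x
  ⊕-comm x y = cong residue (ℤ.+-comm (lift x) (lift y))

  ⊗-comm : ∀ x y → x ⊗ y ≡ y ⊗ x
  ⊗-comm x y = cong (λ n → residue (+ n)) (ℕ.*-comm (toℕ x) (toℕ y))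

  ⊕-identityˡ : ∀ x → 0# ⊕ x ≡ x
  ⊕-identityˡ = transport₁ λ i →
    trans (sym (residue-+ 0ℤ i)) (cong residue (ℤ.+-identityˡ i))

  ⊗-identityˡ : ∀ x → 1# ⊗ x ≡ x
  ⊗-identityˡ = transport₁ λ i →
    trans (sym (residue-* 1ℤ i)) (cong residue (ℤ.*-identityˡ i))

  ⊖-inverseˡ : ∀ x → ⊖ x ⊕ x ≡ 0#
  ⊖-inverseˡ = transport₁ λ i → trans (cong (_⊕ residue i) (sym (residue-neg i)))
    (trans (sym (residue-+ (ℤ.- i) i)) (cong residue (ℤ.+-inverseˡ i)))

  ⊗-distribˡ-⊕ : ∀ x y z → x ⊗ (y ⊕ z) ≡ x ⊗ y ⊕ x ⊗ z
  ⊗-distribˡ-⊕ = transport₃ λ i j k → begin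
    residue i ⊗ (residue j ⊕ residue k)     ≡⟨ cong (residue i ⊗_) (residue-+ j k) ⟨
    residue i ⊗ residue (j ℤ.+ k)           ≡⟨ residue-* i (j ℤ.+ k) ⟨
    residue (i ℤ.* (j ℤ.+ k))               ≡⟨ cong residue (ℤ.*-distribˡ-+ i j k) ⟩
    residue (i ℤ.* j ℤ.+ i ℤ.* k)           ≡⟨ residue-+ (i ℤ.* j) (i ℤ.* k) ⟩
    residue (i ℤ.* j) ⊕ residue (i ℤ.* k)   ≡⟨ cong₂ _⊕_ (residue-* i j) (residue-* i k) ⟩
    residue i ⊗ residue j ⊕ residue i ⊗ residue k ∎
    where open ≡-Reasoning

  𝔽-commutativeRing : CommutativeRing 0ℓ 0ℓ
  𝔽-commutativeRing = record
    { Carrier = 𝔽 p ; _≈_ = _≡_ ; _+_ = _⊕_ ; _*_ = _⊗_ ; -_ = ⊖_ ; 0# = 0# ; 1# = 1#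
    ; isCommutativeRing = record
      { isRing = record
        { +-isAbelianGroup = record
          { isGroup = record
            { isMonoid = record
              { isSemigroup = record
                { isMagma = record { isEquivalence = isEquivalence ; ∙-cong = cong₂ _⊕_ }
                ; assoc = ⊕-assoc }
              ; identity = ⊕-identityˡ , λ x → trans (⊕-comm x 0#) (⊕-identityˡ x) }
            ; inverse = ⊖-inverseˡ , λ x → trans (⊕-comm x (⊖ x)) (⊖-inverseˡ x)
            ; ⁻¹-cong = cong ⊖_ }
          ; comm = ⊕-comm }
        ; *-cong = cong₂ _⊗_
        ; *-assoc = ⊗-assoc
        ; *-identity = ⊗-identityˡ , λ x → trans (⊗-comm x 1#) (⊗-identityˡ x)
        ; distrib = ⊗-distribˡ-⊕ , λ x y z → trans (⊗-comm (y ⊕ z) x)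
            (trans (⊗-distribˡ-⊕ x y z) (cong₂ _⊕_ (⊗-comm x y) (⊗-comm x z))) }
      ; *-comm = ⊗-comm } }

  -- The ring solver for `𝔽 p` takes its coefficients in `ℤ`, because constants of `𝔽 p` do not
  -- compute for a variable `p`.
  residue-homomorphism : ℤ.+-*-rawRing -Raw-AlmostCommutative⟶ fromCommutativeRing 𝔽-commutativeRing
  residue-homomorphism = record
    { ⟦_⟧ = residue ; +-homo = residue-+ ; *-homo = residue-* ; -‿homo = residue-neg
    ; 0-homo = refl ; 1-homo = refl }


  residue-≟ : ∀ i j → Maybe (residue i ≡ residue j)
  residue-≟ i j with i ℤ.≟ j
  ... | yes refl = just refl
  ... | no _ = nothing

  module 𝔽-Solver = Algebra.Solver.Ring ℤ.+-*-rawRing (fromCommutativeRing 𝔽-commutativeRing)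
    residue-homomorphism residue-≟

  infixl 6 _⊝_
  _⊝_ : 𝔽 p → 𝔽 p → 𝔽 p
  x ⊝ y = x ⊕ ⊖ y

  two : 𝔽 p
  two = residue (+ 2)

  toℕ-0# : toℕ 0# ≡ 0
  toℕ-0# = trans (toℕ-residue 0ℤ) (ℕ.m<n⇒m%n≡m (ℕ.>-nonZero⁻¹ p))

  residue≡0⇒∣ : ∀ n → residue (+ n) ≡ 0# → p ℕ.∣ n
  residue≡0⇒∣ n eq = ℕ.m%n≡0⇒n∣m n p
    (trans (sym (toℕ-residue (+ n))) (trans (cong toℕ eq) toℕ-0#))

  ∣⇒residue≡0 : ∀ n → p ℕ.∣ n → residue (+ n) ≡ 0#
  ∣⇒residue≡0 n p∣n = Fin.toℕ-injective
    (trans (toℕ-residue (+ n)) (trans (ℕ.n∣m⇒m%n≡0 n p p∣n) (sym toℕ-0#)))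

  two≡0⇒p≤2 : two ≡ 0# → p ℕ.≤ 2
  two≡0⇒p≤2 eq = ℕ.∣⇒≤ (residue≡0⇒∣ 2 eq)

  infix 4 _≟_
  _≟_ : (x y : 𝔽 p) → Dec (x ≡ y)
  _≟_ = Fin._≟_

  -- Sums over 𝔽 p

  open Integral (counting p) public
    renaming (∫ to ∑; ∫-cong to ∑-cong; ∫-+ to ∑-+; ∫-* to ∑-*; ∫-nonNeg to ∑-nonNeg;
              ∫-*ʳ to ∑-*ʳ; ∫-neg to ∑-neg; ∫-- to ∑--; ∫-mono to ∑-mono)
    using ()

  P : ℚ
  P = fromℕ p

  P-nonNeg : 0ℚ ≤ P
  P-nonNeg = fromℕ-mono ℕ.z≤n

  ∑-const : ∀ c → ∑ (λ _ → c) ≡ P * c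
  ∑-const = sum-const p

  ∑-swap : (f : 𝔽 p → 𝔽 p → ℚ) → ∑ (λ x → ∑ λ y → f x y) ≡ ∑ (λ y → ∑ λ x → f x y)
  ∑-swap = ∑-comm

  ∑-product : (f g : 𝔽 p → ℚ) → ∑ f * ∑ g ≡ ∑ (λ x → ∑ λ y → f x * g y)
  ∑-product f g = trans (sym (∑-*ʳ f (∑ g))) (∑-cong λ x → sym (∑-* (f x) g))

  ∑-shift : ∀ a (f : 𝔽 p → ℚ) → ∑ f ≡ ∑ (λ x → f (x ⊕ a))
  ∑-shift a f = sum-bijection (_⊕ a) (_⊝ a)
    (λ x → solve 2 (λ x a → x :- a :+ a := x) refl x a)
    (λ x → solve 2 (λ x a → x :+ a :- a := x) refl x a) f
    where open 𝔽-Solver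

  ∑-shiftˡ : ∀ a (f : 𝔽 p → ℚ) → ∑ f ≡ ∑ (λ x → f (a ⊕ x))
  ∑-shiftˡ a f = trans (∑-shift a f) (∑-cong λ x → cong f (⊕-comm x a))

  -- Behind every diagonal and mean term: a variable that occurs only as a translation can be summed
  -- out, and the sum factors.
  ∑-convolution : (f g : 𝔽 p → ℚ) → ∑ (λ y → ∑ λ x → f x * g (x ⊕ y)) ≡ ∑ f * ∑ g
  ∑-convolution f g = begin
    ∑ (λ y → ∑ λ x → f x * g (x ⊕ y)) ≡⟨ ∑-swap (λ y x → f x * g (x ⊕ y)) ⟩
    ∑ (λ x → ∑ λ y → f x * g (x ⊕ y)) ≡⟨ ∑-cong (λ x → ∑-shiftˡ x (λ y → f x * g y)) ⟨
    ∑ (λ x → ∑ λ y → f x * g y)       ≡⟨ ∑-product f g ⟨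
    ∑ f * ∑ g                         ∎
    where open ≡-Reasoning

  ab≤½a²+½b² : ∀ a b → a * b ≤ ½ * (sq a + sq b)
  ab≤½a²+½b² a b = ≤-by (½ * sq (a - b)) (*-nonNeg (nonNegative⁻¹ ½) (sq-nonNeg (a - b)))
    (solve 2 (λ a b → con ½ :* (a :* a :+ b :* b)
      := a :* b :+ con ½ :* ((a :- b) :* (a :- b))) refl a b)
    where open +-*-Solver

  center : (𝔽 p → ℚ) → 𝔽 p → ℚ
  center f x = f x - r * ∑ f

  private
    ∑-mean : ∀ c → ∑ (λ _ → r * c) ≡ c
    ∑-mean c = begin
      ∑ (λ _ → r * c) ≡⟨ ∑-const (r * c) ⟩
      P * (r * c)     ≡⟨ *-assoc P r c ⟨
      P * r * c       ≡⟨ cong (_* c) Pr≡1 ⟩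
      1ℚ * c          ≡⟨ *-identityˡ c ⟩
      c               ∎
      where open ≡-Reasoning

  ∑-center : ∀ f → ∑ (center f) ≡ 0ℚ
  ∑-center f = begin
    ∑ (center f)            ≡⟨ ∑-- f (λ _ → r * ∑ f) ⟩
    ∑ f - ∑ (λ _ → r * ∑ f) ≡⟨ cong (λ c → ∑ f - c) (∑-mean (∑ f)) ⟩
    ∑ f - ∑ f               ≡⟨ +-inverseʳ (∑ f) ⟩
    0ℚ                      ∎
    where open ≡-Reasoning

  ∑-center-* : ∀ f g → ∑ (λ x → center f x * g x) ≡ ∑ (λ x → f x * g x) - r * (∑ f * ∑ g)
  ∑-center-* f g = begin
    ∑ (λ x → center f x * g x)
      ≡⟨ ∑-cong (λ x → solve 3 (λ a c b → (a :- c) :* b := a :* b :- c :* b) refl (f x) (r * ∑ f) (g x)) ⟩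
    ∑ (λ x → f x * g x - r * ∑ f * g x)
      ≡⟨ ∑-- (λ x → f x * g x) (λ x → r * ∑ f * g x) ⟩
    ∑ (λ x → f x * g x) - ∑ (λ x → r * ∑ f * g x)
      ≡⟨ cong (λ c → ∑ (λ x → f x * g x) - c)
           (trans (∑-* (r * ∑ f) g) (*-assoc r (∑ f) (∑ g))) ⟩
    ∑ (λ x → f x * g x) - r * (∑ f * ∑ g) ∎
    where
    open ≡-Reasoning
    open +-*-Solver

  ∑-sq-center : ∀ f → ∑ (λ x → sq (center f x)) ≡ ∑ (λ x → sq (f x)) - r * sq (∑ f)
  ∑-sq-center f = begin
    ∑ (λ x → center f x * center f x)
      ≡⟨ ∑-center-* f (center f) ⟩
    ∑ (λ x → f x * center f x) - r * (∑ f * ∑ (center f))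
      ≡⟨ cong₂ (λ a b → a - r * (∑ f * b)) (∑-cong λ x → *-comm (f x) (center f x)) (∑-center f) ⟩
    ∑ (λ x → center f x * f x) - r * (∑ f * 0ℚ)
      ≡⟨ cong (λ a → a - r * (∑ f * 0ℚ)) (∑-center-* f f) ⟩
    ∑ (λ x → sq (f x)) - r * sq (∑ f) - r * (∑ f * 0ℚ)
      ≡⟨ solve 3 (λ a r s → a :- r :* (s :* s) :- r :* (s :* con 0ℚ) := a :- r :* (s :* s))
           refl (∑ (λ x → sq (f x))) r (∑ f) ⟩
    ∑ (λ x → sq (f x)) - r * sq (∑ f) ∎
    where
    open ≡-Reasoning
    open +-*-Solver

  ∑-sq-center-≤ : ∀ f → ∑ (λ x → sq (center f x)) ≤ ∑ (λ x → sq (f x))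
  ∑-sq-center-≤ f = ≤-by (r * sq (∑ f)) (*-nonNeg 0≤r (sq-nonNeg (∑ f)))
    (trans (solve 2 (λ a b → a := (a :- b) :+ b) refl (∑ (λ x → sq (f x))) (r * sq (∑ f)))
      (cong (_+ r * sq (∑ f)) (sym (∑-sq-center f))))
    where open +-*-Solver

  -- Convolution operators commute, so Lagrange's identity
  -- Σ ‖Uⱼ gₖ‖² − ‖Σ Uⱼ* gⱼ‖² = ½ Σ ‖Uⱼ gₖ − Uₖ gⱼ‖² ≥ 0 is available for them.

  module _ (δ : 𝔽 p → 𝔽 p → 𝔽 p) (g : 𝔽 p → 𝔽 p → ℚ) where

    private
      U : 𝔽 p → 𝔽 p → 𝔽 p → ℚ
      U j k x = ∑ λ t → g k (x ⊝ δ j t)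

      U* : 𝔽 p → 𝔽 p → ℚ
      U* j x = ∑ λ t → g j (x ⊕ δ j t)

      -- This is where commutativity enters: moving both operators to the other side of the inner
      -- product gives ⟨Uⱼ* gⱼ, Uₖ* gₖ⟩ = ⟨Uⱼ gₖ, Uₖ gⱼ⟩. Term by term it is the translation by
      -- `δ j t ⊕ δ k t′`.
      interchange : ∀ j k → ∑ (λ x → U* j x * U* k x) ≡ ∑ (λ x → U j k x * U k j x)
      interchange j k = begin
        ∑ (λ x → U* j x * U* k x)
          ≡⟨ expand (λ t x → g j (x ⊕ δ j t)) (λ t x → g k (x ⊕ δ k t)) ⟩
        ∑ (λ t → ∑ λ t′ → ∑ λ x → g j (x ⊕ δ j t) * g k (x ⊕ δ k t′))
          ≡⟨ ∑-cong (λ t → ∑-cong λ t′ → shifted t t′) ⟩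
        ∑ (λ t → ∑ λ t′ → ∑ λ x → g k (x ⊝ δ j t) * g j (x ⊝ δ k t′))
          ≡⟨ expand (λ t x → g k (x ⊝ δ j t)) (λ t x → g j (x ⊝ δ k t)) ⟨
        ∑ (λ x → U j k x * U k j x) ∎
        where
        open ≡-Reasoning
        expand : ∀ (a b : 𝔽 p → 𝔽 p → ℚ) → ∑ (λ x → ∑ (λ t → a t x) * ∑ (λ t → b t x))
          ≡ ∑ (λ t → ∑ λ t′ → ∑ λ x → a t x * b t′ x)
        expand a b = begin
          ∑ (λ x → ∑ (λ t → a t x) * ∑ (λ t → b t x))
            ≡⟨ ∑-cong (λ x → ∑-product (λ t → a t x) (λ t → b t x)) ⟩
          ∑ (λ x → ∑ λ t → ∑ λ t′ → a t x * b t′ x)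
            ≡⟨ ∑-swap (λ x t → ∑ λ t′ → a t x * b t′ x) ⟩
          ∑ (λ t → ∑ λ x → ∑ λ t′ → a t x * b t′ x)
            ≡⟨ ∑-cong (λ t → ∑-swap λ x t′ → a t x * b t′ x) ⟩
          ∑ (λ t → ∑ λ t′ → ∑ λ x → a t x * b t′ x) ∎
        shifted : ∀ t t′ → ∑ (λ x → g j (x ⊕ δ j t) * g k (x ⊕ δ k t′))
          ≡ ∑ (λ x → g k (x ⊝ δ j t) * g j (x ⊝ δ k t′))
        shifted t t′ = begin
          ∑ (λ x → g j (x ⊕ δ j t) * g k (x ⊕ δ k t′))
            ≡⟨ ∑-cong (λ x → trans (*-comm (g j (x ⊕ δ j t)) (g k (x ⊕ δ k t′)))
                 (cong₂ (λ a b → g k a * g j b)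
                   (solve 3 (λ x a b → x :+ b := x :+ (a :+ b) :- a) refl x (δ j t) (δ k t′))
                   (solve 3 (λ x a b → x :+ a := x :+ (a :+ b) :- b) refl x (δ j t) (δ k t′)))) ⟩
          ∑ (λ x → g k (x ⊕ (δ j t ⊕ δ k t′) ⊝ δ j t) * g j (x ⊕ (δ j t ⊕ δ k t′) ⊝ δ k t′))
            ≡⟨ ∑-shift (δ j t ⊕ δ k t′) (λ x → g k (x ⊝ δ j t) * g j (x ⊝ δ k t′)) ⟨
          ∑ (λ x → g k (x ⊝ δ j t) * g j (x ⊝ δ k t′)) ∎
          where open 𝔽-Solver

    lagrange : ∑ (λ x → sq (∑ λ j → ∑ λ t → g j (x ⊕ δ j t)))
      ≤ ∑ (λ j → ∑ λ k → ∑ λ x → sq (∑ λ t → g k (x ⊝ δ j t)))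
    lagrange = begin
      ∑ (λ x → sq (∑ λ j → U* j x))
        ≡⟨ ∑-cong (λ x → ∑-product (λ j → U* j x) (λ j → U* j x)) ⟩
      ∑ (λ x → ∑ λ j → ∑ λ k → U* j x * U* k x)
        ≡⟨ ∑-swap (λ x j → ∑ λ k → U* j x * U* k x) ⟩
      ∑ (λ j → ∑ λ x → ∑ λ k → U* j x * U* k x)
        ≡⟨ ∑-cong (λ j → ∑-swap λ x k → U* j x * U* k x) ⟩
      ∑ (λ j → ∑ λ k → ∑ λ x → U* j x * U* k x)
        ≡⟨ ∑-cong (λ j → ∑-cong λ k → interchange j k) ⟩
      ∑ (λ j → ∑ λ k → ∑ λ x → U j k x * U k j x)
        ≤⟨ ∑-mono (λ j → ∑-mono λ k → ∑-mono λ x → ab≤½a²+½b² (U j k x) (U k j x)) ⟩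
      ∑ (λ j → ∑ λ k → ∑ λ x → ½ * (sq (U j k x) + sq (U k j x)))
        ≡⟨ ∑-cong (λ j → ∑-cong λ k → trans (∑-* ½ (λ x → sq (U j k x) + sq (U k j x)))
             (cong (½ *_) (∑-+ (λ x → sq (U j k x)) (λ x → sq (U k j x))))) ⟩
      ∑ (λ j → ∑ λ k → ½ * (E j k + E k j))
        ≡⟨ ∑-cong (λ j → trans (∑-* ½ (λ k → E j k + E k j)) (cong (½ *_) (∑-+ (E j) (λ k → E k j)))) ⟩
      ∑ (λ j → ½ * (∑ (E j) + ∑ λ k → E k j))
        ≡⟨ trans (∑-* ½ (λ j → ∑ (E j) + ∑ λ k → E k j))
             (cong (½ *_) (∑-+ (λ j → ∑ (E j)) (λ j → ∑ λ k → E k j))) ⟩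
      ½ * (∑ (λ j → ∑ (E j)) + ∑ λ j → ∑ λ k → E k j)
        ≡⟨ cong (λ e → ½ * (∑ (λ j → ∑ (E j)) + e)) (∑-swap E) ⟨
      ½ * (∑ (λ j → ∑ (E j)) + ∑ (λ j → ∑ (E j)))
        ≡⟨ solve 1 (λ e → con ½ :* (e :+ e) := e) refl (∑ (λ j → ∑ (E j))) ⟩
      ∑ (λ j → ∑ (E j)) ∎
      where
      open ≤-Reasoning
      open +-*-Solver
      E : 𝔽 p → 𝔽 p → ℚ
      E j k = ∑ λ x → sq (U j k x)

  -- Families of functions and their translates

  module Families (Y : 𝔽 p → 𝔽 p → 𝔽 p) where


    Family : Set
    Family = 𝔽 p → 𝔽 p → ℚ

    N : Family → ℚ
    N A = ∑ λ s → ∑ λ x → sq (A s x)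

    N-nonNeg : (A : Family) → 0ℚ ≤ N A
    N-nonNeg A = ∑-nonNeg λ s → ∑-nonNeg λ x → sq-nonNeg (A s x)

    M M* : Family → Family
    M B s x = ∑ λ t → B t (x ⊕ Y s t)
    M* A t x = ∑ λ s → A s (x ⊝ Y s t)

    families-cauchy-schwarz : (A B : Family) → sq (∑ λ s → ∑ λ x → A s x * B s x) ≤ N A * N B
    families-cauchy-schwarz A B =
      Integral.cauchy-schwarz (counting p ⊗ᴵ counting p) (uncurry A) (uncurry B)

    pairing-M : (A B : Family) → ∑ (λ s → ∑ λ t → ∑ λ x → A s x * B t (x ⊕ Y s t))
      ≡ ∑ (λ s → ∑ λ x → A s x * M B s x)
    pairing-M A B = ∑-cong λ s → trans (∑-swap λ t x → A s x * B t (x ⊕ Y s t))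
      (∑-cong λ x → ∑-* (A s x) (λ t → B t (x ⊕ Y s t)))

    pairing-M* : (A B : Family) → ∑ (λ s → ∑ λ t → ∑ λ x → A s x * B t (x ⊕ Y s t))
      ≡ ∑ (λ t → ∑ λ x → M* A t x * B t x)
    pairing-M* A B = begin
      ∑ (λ s → ∑ λ t → ∑ λ x → A s x * B t (x ⊕ Y s t))
        ≡⟨ ∑-swap (λ s t → ∑ λ x → A s x * B t (x ⊕ Y s t)) ⟩
      ∑ (λ t → ∑ λ s → ∑ λ x → A s x * B t (x ⊕ Y s t))
        ≡⟨ ∑-cong (λ t → ∑-cong λ s → translate s t) ⟩
      ∑ (λ t → ∑ λ s → ∑ λ x → A s (x ⊝ Y s t) * B t x)
        ≡⟨ ∑-cong (λ t → ∑-swap λ s x → A s (x ⊝ Y s t) * B t x) ⟩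
      ∑ (λ t → ∑ λ x → ∑ λ s → A s (x ⊝ Y s t) * B t x)
        ≡⟨ ∑-cong (λ t → ∑-cong λ x → ∑-*ʳ (λ s → A s (x ⊝ Y s t)) (B t x)) ⟩
      ∑ (λ t → ∑ λ x → M* A t x * B t x) ∎
      where
      open ≡-Reasoning
      translate : ∀ s t → ∑ (λ x → A s x * B t (x ⊕ Y s t)) ≡ ∑ (λ x → A s (x ⊝ Y s t) * B t x)
      translate s t = sym (trans (∑-shift (Y s t) (λ x → A s (x ⊝ Y s t) * B t x))
        (∑-cong λ x → cong (λ z → A s z * B t (x ⊕ Y s t))
          (solve 2 (λ x y → x :+ y :- y := x) refl x (Y s t))))
        where open 𝔽-Solver

    module _ (A B : Family) where

      private
        X = ∑ λ s → ∑ λ t → ∑ λ x → A s x * B t (x ⊕ Y s t)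

      pairing-≤ : sq X ≤ N (M* A) * N B
      pairing-≤ = subst (λ x → sq x ≤ N (M* A) * N B) (sym (pairing-M* A B))
        (families-cauchy-schwarz (M* A) B)

      -- ‖M* A‖² = ⟨A, M M* A⟩, so `M*` is controlled through `M M*`; the pairing is read in two
      -- ways with `M* A` as second family.
      N-M*-≤ : sq (N (M* A)) ≤ N A * N (M (M* A))
      N-M*-≤ = subst (λ x → sq x ≤ N A * N (M (M* A)))
        (trans (sym (pairing-M A (M* A))) (pairing-M* A (M* A)))
        (families-cauchy-schwarz A (M (M* A)))

      pairing⁴-≤ : sq (sq X) ≤ N A * N (M (M* A)) * sq (N B)
      pairing⁴-≤ = begin
        sq (sq X)
          ≤⟨ *-mono-≤-nonNeg (sq-nonNeg X) (*-nonNeg (N-nonNeg (M* A)) (N-nonNeg B)) pairing-≤ pairing-≤ ⟩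
        sq (N (M* A) * N B)
          ≡⟨ solve 2 (λ a b → (a :* b) :* (a :* b) := a :* a :* (b :* b)) refl (N (M* A)) (N B) ⟩
        sq (N (M* A)) * sq (N B)
          ≤⟨ *-monoʳ-≤-nonNeg (sq (N B)) {{nonNegative (sq-nonNeg (N B))}} N-M*-≤ ⟩
        N A * N (M (M* A)) * sq (N B) ∎
        where
        open ≤-Reasoning
        open +-*-Solver

    δ : 𝔽 p → 𝔽 p → 𝔽 p → 𝔽 p
    δ s j t = Y s t ⊝ Y j t

    correlation : (𝔽 p → ℚ) → 𝔽 p → ℚ
    correlation g z = ∑ λ x → g x * g (x ⊕ z)

    -- Counts the closed 4-cycles s, t, j, t′ by their total displacement.

    cycles : (𝔽 p → ℚ) → ℚ
    cycles C = ∑ λ s → ∑ λ j → ∑ λ t → ∑ λ t′ → C (δ s j t ⊝ δ s j t′)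

    -- The row `s` of `M M*` consists of convolutions with the displacements `δ s j t`. Lagrange's
    -- inequality detaches the index `k` of the function from the index `j` of the operator, so the
    -- same weighted count of cycles is applied to each member of the family on its own. Expanding
    -- the square then gives correlations.
    N-MM*-≤ : (A : Family) → N (M (M* A)) ≤ ∑ (λ k → cycles (correlation (A k)))
    N-MM*-≤ A = begin
      N (M (M* A))
        ≡⟨ ∑-cong (λ s → ∑-cong λ x → cong sq (trans
             (∑-swap λ t j → A j (x ⊕ Y s t ⊝ Y j t))
             (∑-cong λ j → ∑-cong λ t → cong (A j) (⊕-assoc x (Y s t) (⊖ Y j t))))) ⟩
      ∑ (λ s → ∑ λ x → sq (∑ λ j → ∑ λ t → A j (x ⊕ δ s j t)))
        ≤⟨ ∑-mono (λ s → lagrange (δ s) A) ⟩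
      ∑ (λ s → ∑ λ j → ∑ λ k → ∑ λ x → sq (∑ λ t → A k (x ⊝ δ s j t)))
        ≡⟨ ∑-cong (λ s → ∑-cong λ j → ∑-cong λ k → autocorrelate (A k) (δ s j)) ⟩
      ∑ (λ s → ∑ λ j → ∑ λ k → inner s j k)
        ≡⟨ ∑-cong (λ s → ∑-swap λ j k → inner s j k) ⟩
      ∑ (λ s → ∑ λ k → ∑ λ j → inner s j k)
        ≡⟨ ∑-swap (λ s k → ∑ λ j → inner s j k) ⟩
      ∑ (λ k → cycles (correlation (A k))) ∎
      where
      open ≤-Reasoning
      inner : 𝔽 p → 𝔽 p → 𝔽 p → ℚ
      inner s j k = ∑ λ t → ∑ λ t′ → correlation (A k) (δ s j t ⊝ δ s j t′)
      autocorrelate : (g : 𝔽 p → ℚ) (d : 𝔽 p → 𝔽 p) → ∑ (λ x → sq (∑ λ t → g (x ⊝ d t)))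
        ≡ ∑ (λ t → ∑ λ t′ → correlation g (d t ⊝ d t′))
      autocorrelate g d = begin-equality
        ∑ (λ x → sq (∑ λ t → g (x ⊝ d t)))
          ≡⟨ ∑-cong (λ x → ∑-product (λ t → g (x ⊝ d t)) (λ t → g (x ⊝ d t))) ⟩
        ∑ (λ x → ∑ λ t → ∑ λ t′ → g (x ⊝ d t) * g (x ⊝ d t′))
          ≡⟨ ∑-swap (λ x t → ∑ λ t′ → g (x ⊝ d t) * g (x ⊝ d t′)) ⟩
        ∑ (λ t → ∑ λ x → ∑ λ t′ → g (x ⊝ d t) * g (x ⊝ d t′))
          ≡⟨ ∑-cong (λ t → ∑-swap λ x t′ → g (x ⊝ d t) * g (x ⊝ d t′)) ⟩
        ∑ (λ t → ∑ λ t′ → ∑ λ x → g (x ⊝ d t) * g (x ⊝ d t′))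
          ≡⟨ ∑-cong (λ t → ∑-cong λ t′ → trans
               (∑-shift (d t) (λ x → g (x ⊝ d t) * g (x ⊝ d t′)))
               (∑-cong λ x → cong₂ (λ a b → g a * g b)
                 (solve 2 (λ x a → x :+ a :- a := x) refl x (d t))
                 (solve 3 (λ x a b → x :+ a :- b := x :+ (a :- b)) refl x (d t) (d t′)))) ⟩
        ∑ (λ t → ∑ λ t′ → correlation g (d t ⊝ d t′)) ∎
        where open 𝔽-Solver

    correlation-≤ : (g : 𝔽 p → ℚ) → ∀ z → correlation g z ≤ ∑ (λ x → sq (g x))
    correlation-≤ g z = begin
      ∑ (λ x → g x * g (x ⊕ z))
        ≤⟨ ∑-mono (λ x → ab≤½a²+½b² (g x) (g (x ⊕ z))) ⟩
      ∑ (λ x → ½ * (sq (g x) + sq (g (x ⊕ z))))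
        ≡⟨ trans (∑-* ½ (λ x → sq (g x) + sq (g (x ⊕ z))))
             (cong (½ *_) (∑-+ (λ x → sq (g x)) (λ x → sq (g (x ⊕ z))))) ⟩
      ½ * (∑ (λ x → sq (g x)) + ∑ (λ x → sq (g (x ⊕ z))))
        ≡⟨ cong (λ e → ½ * (∑ (λ x → sq (g x)) + e)) (∑-shift z (λ x → sq (g x))) ⟨
      ½ * (∑ (λ x → sq (g x)) + ∑ (λ x → sq (g x)))
        ≡⟨ solve 1 (λ e → con ½ :* (e :+ e) := e) refl (∑ λ x → sq (g x)) ⟩
      ∑ (λ x → sq (g x)) ∎
      where
      open ≤-Reasoning
      open +-*-Solver

    ∑-correlation : (g : 𝔽 p → ℚ) → ∑ (correlation g) ≡ sq (∑ g)
    ∑-correlation g = ∑-convolution g g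

  -- The quadratic average

  module Quadratic (f : 𝔽 p → ℚ) where


    T : (𝔽 p → ℚ) → 𝔽 p → ℚ
    T g x = ∑ λ y → f (x ⊕ y) * g (x ⊕ y ⊗ y)

    Q : (𝔽 p → ℚ) → 𝔽 p → ℚ
    Q w z = ∑ λ y → w (z ⊝ y ⊗ y) * f (z ⊝ y ⊗ y ⊕ y)

    private
      x+a-a : ∀ x a → x ⊕ a ⊝ a ≡ x
      x+a-a = solve 2 (λ x a → x :+ a :- a := x) refl
        where open 𝔽-Solver

    T-Q-adjoint : ∀ g w → ∑ (λ x → w x * T g x) ≡ ∑ (λ z → g z * Q w z)
    T-Q-adjoint g w = begin
      ∑ (λ x → w x * ∑ λ y → f (x ⊕ y) * g (x ⊕ y ⊗ y))
        ≡⟨ ∑-cong (λ x → ∑-* (w x) (λ y → f (x ⊕ y) * g (x ⊕ y ⊗ y))) ⟨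
      ∑ (λ x → ∑ λ y → w x * (f (x ⊕ y) * g (x ⊕ y ⊗ y)))
        ≡⟨ ∑-swap (λ x y → w x * (f (x ⊕ y) * g (x ⊕ y ⊗ y))) ⟩
      ∑ (λ y → ∑ λ x → w x * (f (x ⊕ y) * g (x ⊕ y ⊗ y)))
        ≡⟨ ∑-cong (λ y → ∑-cong λ x → trans
             (solve 3 (λ a b c → a :* (b :* c) := c :* (a :* b)) refl (w x) (f (x ⊕ y)) (g (x ⊕ y ⊗ y)))
             (cong (λ a → g (x ⊕ y ⊗ y) * (w a * f (a ⊕ y))) (sym (x+a-a x (y ⊗ y))))) ⟩
      ∑ (λ y → ∑ λ x → term y (x ⊕ y ⊗ y))
        ≡⟨ ∑-cong (λ y → ∑-shift (y ⊗ y) (term y)) ⟨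
      ∑ (λ y → ∑ (term y))
        ≡⟨ ∑-swap term ⟩
      ∑ (λ z → ∑ λ y → term y z)
        ≡⟨ ∑-cong (λ z → ∑-* (g z) (λ y → w (z ⊝ y ⊗ y) * f (z ⊝ y ⊗ y ⊕ y))) ⟩
      ∑ (λ z → g z * Q w z) ∎
      where
      open ≡-Reasoning
      open +-*-Solver
      term : 𝔽 p → 𝔽 p → ℚ
      term y z = g z * (w (z ⊝ y ⊗ y) * f (z ⊝ y ⊗ y ⊕ y))

    ∑-Q : ∀ w → ∑ (Q w) ≡ ∑ w * ∑ f
    ∑-Q w = begin
      ∑ (λ z → ∑ λ y → term y z)                          ≡⟨ ∑-swap (λ z y → term y z) ⟩
      ∑ (λ y → ∑ (term y))                                ≡⟨ ∑-cong (λ y → ∑-shift (y ⊗ y) (term y)) ⟩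
      ∑ (λ y → ∑ λ x → term y (x ⊕ y ⊗ y))                ≡⟨ ∑-cong (λ y → ∑-cong λ x →
                                                               cong (λ a → w a * f (a ⊕ y)) (x+a-a x (y ⊗ y))) ⟩
      ∑ (λ y → ∑ λ x → w x * f (x ⊕ y))                   ≡⟨ ∑-convolution w f ⟩
      ∑ w * ∑ f                                           ∎
      where
      open ≡-Reasoning
      term : 𝔽 p → 𝔽 p → ℚ
      term y z = w (z ⊝ y ⊗ y) * f (z ⊝ y ⊗ y ⊕ y)

    -- The contribution of the pair y, y + d to the sum of `sq (Q w z)` after z = x + y², where s =
    -- y² - (y + d)². Keeping `s` as a separate argument allows it to replace `y` as the variable of
    -- summation.
    H : (𝔽 p → ℚ) → 𝔽 p → 𝔽 p → 𝔽 p → ℚ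
    H w y s d = ∑ λ x → w x * w (x ⊕ s) * (f (x ⊕ y) * f (x ⊕ y ⊕ (s ⊕ d)))

    ∑-sq-Q : ∀ w → ∑ (λ z → sq (Q w z)) ≡ ∑ (λ d → ∑ λ y → H w y (y ⊗ y ⊝ (y ⊕ d) ⊗ (y ⊕ d)) d)
    ∑-sq-Q w = begin
      ∑ (λ z → sq (∑ λ y → term y z))
        ≡⟨ ∑-cong (λ z → ∑-product (λ y → term y z) (λ y → term y z)) ⟩
      ∑ (λ z → ∑ λ y → ∑ λ y′ → term y z * term y′ z)
        ≡⟨ ∑-cong (λ z → ∑-cong λ y → ∑-shiftˡ y (λ y′ → term y z * term y′ z)) ⟩
      ∑ (λ z → ∑ λ y → ∑ λ d → term y z * term (y ⊕ d) z)
        ≡⟨ ∑-cong (λ z → ∑-swap λ y d → term y z * term (y ⊕ d) z) ⟩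
      ∑ (λ z → ∑ λ d → ∑ λ y → term y z * term (y ⊕ d) z)
        ≡⟨ ∑-swap (λ z d → ∑ λ y → term y z * term (y ⊕ d) z) ⟩
      ∑ (λ d → ∑ λ z → ∑ λ y → term y z * term (y ⊕ d) z)
        ≡⟨ ∑-cong (λ d → ∑-swap λ z y → term y z * term (y ⊕ d) z) ⟩
      ∑ (λ d → ∑ λ y → ∑ λ z → term y z * term (y ⊕ d) z)
        ≡⟨ ∑-cong (λ d → ∑-cong λ y → trans
             (∑-shift (y ⊗ y) (λ z → term y z * term (y ⊕ d) z))
             (∑-cong λ x → rearranged d y x)) ⟩
      ∑ (λ d → ∑ λ y → H w y (y ⊗ y ⊝ (y ⊕ d) ⊗ (y ⊕ d)) d) ∎
      where
      open ≡-Reasoning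
      term : 𝔽 p → 𝔽 p → ℚ
      term y z = w (z ⊝ y ⊗ y) * f (z ⊝ y ⊗ y ⊕ y)
      rearranged : ∀ d y x → let s = y ⊗ y ⊝ (y ⊕ d) ⊗ (y ⊕ d) in
        term y (x ⊕ y ⊗ y) * term (y ⊕ d) (x ⊕ y ⊗ y)
          ≡ w x * w (x ⊕ s) * (f (x ⊕ y) * f (x ⊕ y ⊕ (s ⊕ d)))
      rearranged d y x = trans
        (cong₂ _*_ (cong (λ a → w a * f (a ⊕ y)) (x+a-a x (y ⊗ y)))
          (cong₂ (λ a b → w a * f b)
            (𝔽.solve 3 (λ x y d → x 𝔽.:+ y 𝔽.:* y 𝔽.:- (y 𝔽.:+ d) 𝔽.:* (y 𝔽.:+ d)
              𝔽.:= x 𝔽.:+ (y 𝔽.:* y 𝔽.:- (y 𝔽.:+ d) 𝔽.:* (y 𝔽.:+ d))) refl x y d)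
            (𝔽.solve 3 (λ x y d → x 𝔽.:+ y 𝔽.:* y 𝔽.:- (y 𝔽.:+ d) 𝔽.:* (y 𝔽.:+ d) 𝔽.:+ (y 𝔽.:+ d)
              𝔽.:= x 𝔽.:+ y 𝔽.:+ (y 𝔽.:* y 𝔽.:- (y 𝔽.:+ d) 𝔽.:* (y 𝔽.:+ d) 𝔽.:+ d)) refl x y d)))
        (solve 4 (λ a b c d → a :* b :* (c :* d) := a :* c :* (b :* d)) refl (w x) (f (x ⊕ y)) _ _)
        where
        open +-*-Solver
        module 𝔽 = 𝔽-Solver

    -- Cauchy-Schwarz in `y` alone. Its fourth power has `P` to the fourth instead of 64 P³, which
    -- suffices for p = 2.
    ∑-sq-T-trivial : ∀ g → ∑ (λ x → sq (T g x)) ≤ P * ∑ (λ x → sq (f x)) * ∑ (λ x → sq (g x))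
    ∑-sq-T-trivial g = begin
      ∑ (λ x → sq (T g x))
        ≤⟨ ∑-mono (λ x → cauchy-schwarz (λ y → f (x ⊕ y)) (λ y → g (x ⊕ y ⊗ y))) ⟩
      ∑ (λ x → ∑ (λ y → sq (f (x ⊕ y))) * ∑ λ y → sq (g (x ⊕ y ⊗ y)))
        ≡⟨ ∑-cong (λ x → cong (_* ∑ λ y → sq (g (x ⊕ y ⊗ y))) (sym (∑-shiftˡ x (λ y → sq (f y))))) ⟩
      ∑ (λ x → F * ∑ λ y → sq (g (x ⊕ y ⊗ y)))
        ≡⟨ ∑-* F (λ x → ∑ λ y → sq (g (x ⊕ y ⊗ y))) ⟩
      F * ∑ (λ x → ∑ λ y → sq (g (x ⊕ y ⊗ y)))
        ≡⟨ cong (F *_) (trans (∑-swap λ x y → sq (g (x ⊕ y ⊗ y)))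
             (trans (∑-cong λ y → sym (∑-shift (y ⊗ y) (λ x → sq (g x)))) (∑-const G))) ⟩
      F * (P * G)
        ≡⟨ solve 3 (λ f q g → f :* (q :* g) := q :* f :* g) refl F P G ⟩
      P * F * G ∎
      where
      open ≤-Reasoning
      open +-*-Solver
      open Integral (counting p) using (cauchy-schwarz)
      F = ∑ λ x → sq (f x)
      G = ∑ λ x → sq (g x)

  -- The field 𝔽 p and the cycle estimate

  module Field (isPrime : Prime p) where

    x⊗y≡0⇒x≡0∨y≡0 : ∀ x y → x ⊗ y ≡ 0# → x ≡ 0# ⊎ y ≡ 0#
    x⊗y≡0⇒x≡0∨y≡0 x y eq =
      Sum.map (divisible x) (divisible y)
        (euclidsLemma (toℕ x) (toℕ y) isPrime (residue≡0⇒∣ (toℕ x ℕ.* toℕ y) eq))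
      where
      divisible : ∀ z → p ℕ.∣ toℕ z → z ≡ 0#
      divisible z h = trans (sym (residue-lift z)) (∣⇒residue≡0 (toℕ z) h)

    -- Bézout for `p` and `toℕ x`. Coefficients are natural numbers, so 1 stands on the side of `p`
    -- or on that of `x`, and the inverse is `b` or -b accordingly.
    inverse : ∀ x → x ≢ 0# → ∃[ y ] x ⊗ y ≡ 1#
    inverse x x≢0 with Coprimality.coprime-Bézout
      (Coprimality.prime⇒coprime isPrime {{ℕ.≢-nonZero toℕx≢0}} (Fin.toℕ<n x))
      where
      toℕx≢0 : toℕ x ≢ 0
      toℕx≢0 eq = x≢0 (Fin.toℕ-injective (trans eq (sym toℕ-0#)))
    ... | Bézout.-+ a b eq = residue (+ b) , (begin
      x ⊗ residue (+ b)                   ≡⟨ cong (_⊗ residue (+ b)) (residue-lift x) ⟨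
      residue (lift x) ⊗ residue (+ b)    ≡⟨ residue-* (lift x) (+ b) ⟨
      residue (lift x ℤ.* + b)            ≡⟨ residue-cong (lift x ℤ.* + b) 1ℤ (+ a) (begin
        lift x ℤ.* + b          ≡⟨ ℤ.*-comm (lift x) (+ b) ⟩
        + b ℤ.* lift x          ≡⟨ ℤ.pos-* b (toℕ x) ⟨
        + (b ℕ.* toℕ x)         ≡⟨ cong +_ eq ⟨
        1ℤ ℤ.+ + (a ℕ.* p)      ≡⟨ cong (λ i → 1ℤ ℤ.+ i) (ℤ.pos-* a p) ⟩
        1ℤ ℤ.+ + a ℤ.* + p      ∎) ⟩
      1#                                  ∎)
      where open ≡-Reasoning
    ... | Bézout.+- a b eq = residue (ℤ.- + b) , (begin
      x ⊗ residue (ℤ.- + b)                ≡⟨ cong (_⊗ residue (ℤ.- + b)) (residue-lift x) ⟨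
      residue (lift x) ⊗ residue (ℤ.- + b) ≡⟨ residue-* (lift x) (ℤ.- + b) ⟨
      residue (lift x ℤ.* ℤ.- + b)         ≡⟨ residue-cong (lift x ℤ.* ℤ.- + b) 1ℤ (ℤ.- + a) (begin
        lift x ℤ.* ℤ.- + b
          ≡⟨ solve 2 (λ n b → n :* :- b := con 1ℤ :- (con 1ℤ :+ b :* n)) refl (lift x) (+ b) ⟩
        1ℤ ℤ.- (1ℤ ℤ.+ + b ℤ.* lift x)
          ≡⟨ cong (λ i → 1ℤ ℤ.- (1ℤ ℤ.+ i)) (ℤ.pos-* b (toℕ x)) ⟨
        1ℤ ℤ.- + (1 ℕ.+ b ℕ.* toℕ x)
          ≡⟨ cong (λ n → 1ℤ ℤ.- + n) eq ⟩
        1ℤ ℤ.- + (a ℕ.* p)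
          ≡⟨ cong (λ i → 1ℤ ℤ.- i) (ℤ.pos-* a p) ⟩
        1ℤ ℤ.- + a ℤ.* + p
          ≡⟨ cong (λ i → 1ℤ ℤ.+ i) (ℤ.neg-distribˡ-* (+ a) (+ p)) ⟩
        1ℤ ℤ.+ ℤ.- + a ℤ.* + p ∎) ⟩
      1#                                   ∎)
      where
      open ≡-Reasoning
      open ℤSolver

    -- A total inverse with value 0 at 0, so that `Y s t` makes sense for t = s too and all sums
    -- range over the whole of `𝔽 p`.
    inv : 𝔽 p → 𝔽 p
    inv x with x ≟ 0#
    ... | yes _   = 0#
    ... | no x≢0 = proj₁ (inverse x x≢0)

    inv-0# : ∀ {x} → x ≡ 0# → inv x ≡ 0#
    inv-0# {x} x≡0 with x ≟ 0#
    ... | yes _   = refl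
    ... | no x≢0 = contradiction x≡0 x≢0

    ⊗-inverseʳ : ∀ {x} → x ≢ 0# → x ⊗ inv x ≡ 1#
    ⊗-inverseʳ {x} x≢0 with x ≟ 0#
    ... | yes x≡0 = contradiction x≡0 x≢0
    ... | no x≢0  = proj₂ (inverse x x≢0)

    halfInv : 𝔽 p → 𝔽 p
    halfInv d = inv (two ⊗ d)

    halfInv-0# : halfInv 0# ≡ 0#
    halfInv-0# = inv-0# (solve 0 (con (+ 2) :* con 0ℤ := con 0ℤ) refl)
      where open 𝔽-Solver

    ⊗-nonZero : ∀ {x y} → x ≢ 0# → y ≢ 0# → x ⊗ y ≢ 0#
    ⊗-nonZero {x} {y} x≢0 y≢0 eq with x⊗y≡0⇒x≡0∨y≡0 x y eq
    ... | inj₁ x≡0 = x≢0 x≡0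
    ... | inj₂ y≡0 = y≢0 y≡0

    ⊖-nonZero : ∀ {x} → x ≢ 0# → ⊖ x ≢ 0#
    ⊖-nonZero {x} x≢0 eq = x≢0 (begin
      x         ≡⟨ solve 1 (λ x → x := :- :- x) refl x ⟩
      ⊖ (⊖ x)   ≡⟨ cong ⊖_ eq ⟩
      ⊖ 0#      ≡⟨ solve 0 (:- con 0ℤ := con 0ℤ) refl ⟩
      0#        ∎)
      where
      open ≡-Reasoning
      open 𝔽-Solver

    x⊝y≡0⇒x≡y : ∀ {x y} → x ⊝ y ≡ 0# → x ≡ y
    x⊝y≡0⇒x≡y {x} {y} eq = begin
      x         ≡⟨ solve 2 (λ x y → x := (x :- y) :+ y) refl x y ⟩
      x ⊝ y ⊕ y ≡⟨ cong (_⊕ y) eq ⟩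
      0# ⊕ y    ≡⟨ ⊕-identityˡ y ⟩
      y         ∎
      where
      open ≡-Reasoning
      open 𝔽-Solver

    -- Odd characteristic: slopes of cycles and their degeneracy

    module Odd (two≢0 : two ≢ 0#) where

      halfInv-inverse : ∀ {d} → d ≢ 0# → two ⊗ d ⊗ halfInv d ≡ 1#
      halfInv-inverse d≢0 = ⊗-inverseʳ (⊗-nonZero two≢0 d≢0)

      -- For `k ≡ 0#` the slope vanishes identically, the next four conditions on `u` and `v` are
      -- the poles of the fractions in it (`u≡0`, `u≡k`, `v≡0`, `v≡k`), and the last two are the
      -- roots `v` of u(u - k) = v(v - k). Each is a single linear equation and so holds for p²
      -- triples.
      data Degenerate (k u v : 𝔽 p) : Set where
        k≡0   : k ≡ 0# → Degenerate k u v
        u≡0   : u ≡ 0# → Degenerate k u v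
        u≡k   : u ≡ k → Degenerate k u v
        v≡0   : v ≡ 0# → Degenerate k u v
        v≡k   : v ≡ k → Degenerate k u v
        v≡u   : v ≡ u → Degenerate k u v
        v≡k⊝u : v ≡ k ⊝ u → Degenerate k u v

      -- Minus the coefficient of `s` in the total displacement of the cycle s, s + u, s + k, s + v:
      -- each `root-of s d` contributes -1/(2d).
      slope : 𝔽 p → 𝔽 p → 𝔽 p → 𝔽 p
      slope k u v = (halfInv u ⊝ halfInv (u ⊝ k)) ⊝ (halfInv v ⊝ halfInv (v ⊝ k))

      -- Away from the poles, 1/u − 1/(u − k) = −k/(u(u − k)), so a vanishing slope
      -- forces u(u − k) = v(v − k), that is (u − v)(u + v − k) = 0.

      slope≡0⇒degenerate : ∀ k u v → slope k u v ≡ 0# → Degenerate k u v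
      slope≡0⇒degenerate k u v eq
        with k ≟ 0# | u ≟ 0# | u ⊝ k ≟ 0# | v ≟ 0# | v ⊝ k ≟ 0#
      ... | yes h | _ | _ | _ | _ = k≡0 h
      ... | _ | yes h | _ | _ | _ = u≡0 h
      ... | _ | _ | yes h | _ | _ = u≡k (x⊝y≡0⇒x≡y h)
      ... | _ | _ | _ | yes h | _ = v≡0 h
      ... | _ | _ | _ | _ | yes h = v≡k (x⊝y≡0⇒x≡y h)
      ... | no k≢0 | no u≢0 | no u≢k | no v≢0 | no v≢k
        with x⊗y≡0⇒x≡0∨y≡0 _ _ factored
        where
        open ≡-Reasoning
        γ = halfInv u ⊝ halfInv (u ⊝ k)

        cleared : ∀ w → w ≢ 0# → w ⊝ k ≢ 0# →
          two ⊗ w ⊗ (w ⊝ k) ⊗ (halfInv w ⊝ halfInv (w ⊝ k)) ≡ ⊖ k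
        cleared w w≢0 w≢k = begin
          two ⊗ w ⊗ (w ⊝ k) ⊗ (halfInv w ⊝ halfInv (w ⊝ k))
            ≡⟨ solve 4 (λ w k a b → con (+ 2) :* w :* (w :- k) :* (a :- b)
                 := (w :- k) :* (con (+ 2) :* w :* a) :- w :* (con (+ 2) :* (w :- k) :* b))
                 refl w k (halfInv w) (halfInv (w ⊝ k)) ⟩
          (w ⊝ k) ⊗ (two ⊗ w ⊗ halfInv w) ⊝ w ⊗ (two ⊗ (w ⊝ k) ⊗ halfInv (w ⊝ k))
            ≡⟨ cong₂ (λ a b → (w ⊝ k) ⊗ a ⊝ w ⊗ b) (halfInv-inverse w≢0) (halfInv-inverse w≢k) ⟩
          (w ⊝ k) ⊗ 1# ⊝ w ⊗ 1#
            ≡⟨ solve 2 (λ w k → (w :- k) :* con 1ℤ :- w :* con 1ℤ := :- k) refl w k ⟩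
          ⊖ k ∎
          where open 𝔽-Solver

        product≡0 : (v ⊝ u) ⊗ (v ⊕ u ⊝ k) ⊗ (two ⊗ γ) ≡ 0#
        product≡0 = begin
          (v ⊝ u) ⊗ (v ⊕ u ⊝ k) ⊗ (two ⊗ γ)
            ≡⟨ solve 4 (λ u v k c → (v :- u) :* (v :+ u :- k) :* (con (+ 2) :* c)
                 := con (+ 2) :* v :* (v :- k) :* c :- con (+ 2) :* u :* (u :- k) :* c)
                 refl u v k γ ⟩
          two ⊗ v ⊗ (v ⊝ k) ⊗ γ ⊝ two ⊗ u ⊗ (u ⊝ k) ⊗ γ
            ≡⟨ cong₂ (λ c d → two ⊗ v ⊗ (v ⊝ k) ⊗ c ⊝ d) (x⊝y≡0⇒x≡y eq) (cleared u u≢0 u≢k) ⟩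
          two ⊗ v ⊗ (v ⊝ k) ⊗ (halfInv v ⊝ halfInv (v ⊝ k)) ⊝ ⊖ k
            ≡⟨ cong (_⊝ ⊖ k) (cleared v v≢0 v≢k) ⟩
          ⊖ k ⊝ ⊖ k
            ≡⟨ solve 1 (λ k → (:- k) :- (:- k) := con 0ℤ) refl k ⟩
          0# ∎
          where open 𝔽-Solver

        γ≢0 : two ⊗ γ ≢ 0#
        γ≢0 h = k≢0 (begin
          k                             ≡⟨ solve 1 (λ k → k := :- :- k) refl k ⟩
          ⊖ (⊖ k)                       ≡⟨ cong ⊖_ (cleared u u≢0 u≢k) ⟨
          ⊖ (two ⊗ u ⊗ (u ⊝ k) ⊗ γ)     ≡⟨ solve 3 (λ u k c → :- (con (+ 2) :* u :* (u :- k) :* c)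
                                               := :- (u :* (u :- k) :* (con (+ 2) :* c))) refl u k γ ⟩
          ⊖ (u ⊗ (u ⊝ k) ⊗ (two ⊗ γ))   ≡⟨ cong (λ c → ⊖ (u ⊗ (u ⊝ k) ⊗ c)) h ⟩
          ⊖ (u ⊗ (u ⊝ k) ⊗ 0#)          ≡⟨ solve 2 (λ u k → :- (u :* (u :- k) :* con 0ℤ) := con 0ℤ) refl u k ⟩
          0#                            ∎)
          where open 𝔽-Solver

        factored : (v ⊝ u) ⊗ (v ⊕ u ⊝ k) ≡ 0#
        factored with x⊗y≡0⇒x≡0∨y≡0 _ _ product≡0
        ... | inj₁ h = h
        ... | inj₂ h = contradiction h γ≢0
      ... | inj₁ h = v≡u (x⊝y≡0⇒x≡y h)
      ... | inj₂ h = v≡k⊝u (x⊝y≡0⇒x≡y (trans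
        (solve 3 (λ u v k → v :- (k :- u) := v :+ u :- k) refl u v k) h))
        where open 𝔽-Solver

      ∑-affine : ∀ m b → m ≢ 0# → (f : 𝔽 p → ℚ) → ∑ f ≡ ∑ (λ x → f (m ⊗ x ⊕ b))
      ∑-affine m b m≢0 f = sum-bijection (λ x → m ⊗ x ⊕ b) (λ x → inv m ⊗ (x ⊝ b))
        (λ x → begin
          m ⊗ (inv m ⊗ (x ⊝ b)) ⊕ b
            ≡⟨ solve 4 (λ m n x b → m :* (n :* (x :- b)) :+ b := (m :* n) :* (x :- b) :+ b) refl m (inv m) x b ⟩
          m ⊗ inv m ⊗ (x ⊝ b) ⊕ b
            ≡⟨ cong (λ e → e ⊗ (x ⊝ b) ⊕ b) (⊗-inverseʳ m≢0) ⟩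
          1# ⊗ (x ⊝ b) ⊕ b
            ≡⟨ solve 2 (λ x b → con 1ℤ :* (x :- b) :+ b := x) refl x b ⟩
          x ∎)
        (λ x → begin
          inv m ⊗ (m ⊗ x ⊕ b ⊝ b)
            ≡⟨ solve 4 (λ m n x b → n :* (m :* x :+ b :- b) := (m :* n) :* x) refl m (inv m) x b ⟩
          m ⊗ inv m ⊗ x
            ≡⟨ cong (_⊗ x) (⊗-inverseʳ m≢0) ⟩
          1# ⊗ x
            ≡⟨ ⊗-identityˡ x ⟩
          x ∎)
        f
        where
        open ≡-Reasoning
        open 𝔽-Solver

      -- The solution y of y² − (y + d)² = s when d ≠ 0.

      root-of : 𝔽 p → 𝔽 p → 𝔽 p
      root-of s d = ⊖ ((s ⊕ d ⊗ d) ⊗ halfInv d)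

      Y : 𝔽 p → 𝔽 p → 𝔽 p
      Y s t = root-of s (t ⊝ s)

      open Families Y

      -- For fixed `d` the quadratic terms of y² - (y + d)² cancel and leave an affine map of slope
      -- -2d, which is a bijection as 2d ≠ 0.
      ∑-root-of : ∀ d → d ≢ 0# → (h : 𝔽 p → 𝔽 p → ℚ) →
        ∑ (λ y → h y (y ⊗ y ⊝ (y ⊕ d) ⊗ (y ⊕ d))) ≡ ∑ (λ s → h (root-of s d) s)
      ∑-root-of d d≢0 h = sym (begin
        ∑ (λ s → h (root-of s d) s)
          ≡⟨ ∑-affine (⊖ (two ⊗ d)) (⊖ (d ⊗ d)) (⊖-nonZero (⊗-nonZero two≢0 d≢0)) (λ s → h (root-of s d) s) ⟩
        ∑ (λ y → h (root-of (line y) d) (line y))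
          ≡⟨ ∑-cong (λ y → cong₂ h (solution y)
               (solve 2 (λ y d → (:- (con (+ 2) :* d)) :* y :+ :- (d :* d)
                 := y :* y :- (y :+ d) :* (y :+ d)) refl y d)) ⟩
        ∑ (λ y → h y (y ⊗ y ⊝ (y ⊕ d) ⊗ (y ⊕ d))) ∎)
        where
        open ≡-Reasoning
        open 𝔽-Solver
        line : 𝔽 p → 𝔽 p
        line y = ⊖ (two ⊗ d) ⊗ y ⊕ ⊖ (d ⊗ d)
        solution : ∀ y → root-of (line y) d ≡ y
        solution y = begin
          ⊖ ((line y ⊕ d ⊗ d) ⊗ halfInv d)
            ≡⟨ solve 3 (λ y d e → :- (((:- (con (+ 2) :* d)) :* y :+ :- (d :* d) :+ d :* d) :* e)
                 := con (+ 2) :* d :* e :* y) refl y d (halfInv d) ⟩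
          two ⊗ d ⊗ halfInv d ⊗ y
            ≡⟨ cong (_⊗ y) (halfInv-inverse d≢0) ⟩
          1# ⊗ y
            ≡⟨ ⊗-identityˡ y ⟩
          y ∎

      -- A majorant of the indicator of `Degenerate`. Counting with multiplicity makes its sum exact
      -- without inclusion-exclusion: each condition is solved for one of its variables, the last
      -- four for `v`, two for `u` and the first for `k`.
      degeneracies : 𝔽 p → 𝔽 p → 𝔽 p → ℚ
      degeneracies k u v = 𝟙 (k ≟ 0#) + 𝟙 (u ≟ 0#) + 𝟙 (u ≟ k)
        + 𝟙 (v ≟ 0#) + 𝟙 (v ≟ k) + 𝟙 (v ≟ u) + 𝟙 (v ≟ k ⊝ u)

      ∑-degeneracies : ∑ (λ k → ∑ λ u → ∑ λ v → degeneracies k u v) ≡ seven * (P * P)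
      ∑-degeneracies = begin
        ∑ (λ k → ∑ λ u → ∑ λ v → degeneracies k u v)
          ≡⟨ ∑-cong (λ k → ∑-cong λ u → over-v k u) ⟩
        ∑ (λ k → ∑ λ u → P * 𝟙 (k ≟ 0#) + P * 𝟙 (u ≟ 0#) + P * 𝟙 (u ≟ k) + four)
          ≡⟨ ∑-cong (λ k → over-u k) ⟩
        ∑ (λ k → P * P * 𝟙 (k ≟ 0#) + (P + P + P * four))
          ≡⟨ trans (∑-+ (λ k → P * P * 𝟙 (k ≟ 0#)) _) (cong₂ _+_
               (trans (∑-* (P * P) (λ k → 𝟙 (k ≟ 0#))) (cong (P * P *_) (sum-𝟙 0#)))
               (∑-const (P + P + P * four))) ⟩
        P * P * 1ℚ + P * (P + P + P * four)
          ≡⟨ solve 1 (λ q → q :* q :* con 1ℚ :+ q :* (q :+ q :+ q :* con four)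
               := (con seven) :* (q :* q)) refl P ⟩
        seven * (P * P) ∎
        where
        open ≡-Reasoning
        open +-*-Solver
        -- The four conditions that determine `v`, with one solution each.
        four = 1ℚ + 1ℚ + 1ℚ + 1ℚ
        _⊞_ : ∀ {f g : 𝔽 p → ℚ} {a b} → ∑ f ≡ a → ∑ g ≡ b → ∑ (λ x → f x + g x) ≡ a + b
        _⊞_ {f} {g} h k = trans (∑-+ f g) (cong₂ _+_ h k)
        infixl 6 _⊞_
        over-v : ∀ k u → ∑ (λ v → degeneracies k u v)
          ≡ P * 𝟙 (k ≟ 0#) + P * 𝟙 (u ≟ 0#) + P * 𝟙 (u ≟ k) + four
        over-v k u = trans
          (_⊞_ {λ v → 𝟙 (k ≟ 0#) + 𝟙 (u ≟ 0#) + 𝟙 (u ≟ k) + 𝟙 (v ≟ 0#) + 𝟙 (v ≟ k) + 𝟙 (v ≟ u)}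
               {λ v → 𝟙 (v ≟ k ⊝ u)}
          (_⊞_ {λ v → 𝟙 (k ≟ 0#) + 𝟙 (u ≟ 0#) + 𝟙 (u ≟ k) + 𝟙 (v ≟ 0#) + 𝟙 (v ≟ k)} {λ v → 𝟙 (v ≟ u)}
          (_⊞_ {λ v → 𝟙 (k ≟ 0#) + 𝟙 (u ≟ 0#) + 𝟙 (u ≟ k) + 𝟙 (v ≟ 0#)} {λ v → 𝟙 (v ≟ k)}
          (_⊞_ {λ v → 𝟙 (k ≟ 0#) + 𝟙 (u ≟ 0#) + 𝟙 (u ≟ k)} {λ v → 𝟙 (v ≟ 0#)}
            (∑-const (𝟙 (k ≟ 0#) + 𝟙 (u ≟ 0#) + 𝟙 (u ≟ k))) (sum-𝟙 0#)) (sum-𝟙 k)) (sum-𝟙 u)) (sum-𝟙 (k ⊝ u)))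
          (solve 4 (λ q a b c → q :* (a :+ b :+ c) :+ con 1ℚ :+ con 1ℚ :+ con 1ℚ :+ con 1ℚ
            := q :* a :+ q :* b :+ q :* c :+ con four) refl P (𝟙 (k ≟ 0#)) (𝟙 (u ≟ 0#)) (𝟙 (u ≟ k)))
        over-u : ∀ k → ∑ (λ u → P * 𝟙 (k ≟ 0#) + P * 𝟙 (u ≟ 0#) + P * 𝟙 (u ≟ k) + four)
          ≡ P * P * 𝟙 (k ≟ 0#) + (P + P + P * four)
        over-u k = trans
          (_⊞_ {λ u → P * 𝟙 (k ≟ 0#) + P * 𝟙 (u ≟ 0#) + P * 𝟙 (u ≟ k)} {λ u → four}
          (_⊞_ {λ u → P * 𝟙 (k ≟ 0#) + P * 𝟙 (u ≟ 0#)} {λ u → P * 𝟙 (u ≟ k)}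
          (_⊞_ {λ u → P * 𝟙 (k ≟ 0#)} {λ u → P * 𝟙 (u ≟ 0#)}
            (∑-const (P * 𝟙 (k ≟ 0#))) (single 0#)) (single k)) (∑-const four))
          (solve 2 (λ q a → q :* (q :* a) :+ q :* con 1ℚ :+ q :* con 1ℚ :+ q :* con four
            := q :* q :* a :+ (q :+ q :+ q :* con four)) refl P (𝟙 (k ≟ 0#)))
          where
          single : ∀ a → ∑ (λ u → P * 𝟙 (u ≟ a)) ≡ P * 1ℚ
          single a = trans (∑-* P (λ u → 𝟙 (u ≟ a))) (cong (P *_) (sum-𝟙 a))

      degenerate⇒1≤degeneracies : ∀ {k u v} → Degenerate k u v → 1ℚ ≤ degeneracies k u v
      degenerate⇒1≤degeneracies {k} {u} {v} = λ where
          (k≡0 h)   → left₇ (left₆ (left₅ (left₄ (left₃ (left (u ≟ 0#) (hit (k ≟ 0#) h))))))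
          (u≡0 h)   → left₇ (left₆ (left₅ (left₄ (left₃ (right (hit (u ≟ 0#) h) (𝟙-nonNeg (k ≟ 0#)))))))
          (u≡k h)   → left₇ (left₆ (left₅ (left₄ (right (hit (u ≟ k) h) s₂))))
          (v≡0 h)   → left₇ (left₆ (left₅ (right (hit (v ≟ 0#) h) s₃)))
          (v≡k h)   → left₇ (left₆ (right (hit (v ≟ k) h) s₄))
          (v≡u h)   → left₇ (right (hit (v ≟ u) h) s₅)
          (v≡k⊝u h) → right (hit (v ≟ k ⊝ u) h) s₆
        where
        hit : {A : Set} (a? : Dec A) → A → 1ℚ ≤ 𝟙 a?
        hit a? a = ≤-reflexive (sym (𝟙-yes a? a))
        left : ∀ {x} {A : Set} (a? : Dec A) → 1ℚ ≤ x → 1ℚ ≤ x + 𝟙 a?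
        left a? h = ≤-trans h (p≤p+q (𝟙-nonNeg a?))
        right : ∀ {x y} → 1ℚ ≤ y → 0ℚ ≤ x → 1ℚ ≤ x + y
        right {x} {y} h 0≤x = ≤-trans h (≤-trans (p≤p+q 0≤x) (≤-reflexive (+-comm y x)))
        left₃ : ∀ {x} → 1ℚ ≤ x → 1ℚ ≤ x + 𝟙 (u ≟ k)
        left₃ = left (u ≟ k)
        left₄ : ∀ {x} → 1ℚ ≤ x → 1ℚ ≤ x + 𝟙 (v ≟ 0#)
        left₄ = left (v ≟ 0#)
        left₅ : ∀ {x} → 1ℚ ≤ x → 1ℚ ≤ x + 𝟙 (v ≟ k)
        left₅ = left (v ≟ k)
        left₆ : ∀ {x} → 1ℚ ≤ x → 1ℚ ≤ x + 𝟙 (v ≟ u)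
        left₆ = left (v ≟ u)
        left₇ : ∀ {x} → 1ℚ ≤ x → 1ℚ ≤ x + 𝟙 (v ≟ k ⊝ u)
        left₇ = left (v ≟ k ⊝ u)
        s₂ = +-nonNeg (𝟙-nonNeg (k ≟ 0#)) (𝟙-nonNeg (u ≟ 0#))
        s₃ = +-nonNeg s₂ (𝟙-nonNeg (u ≟ k))
        s₄ = +-nonNeg s₃ (𝟙-nonNeg (v ≟ 0#))
        s₅ = +-nonNeg s₄ (𝟙-nonNeg (v ≟ k))
        s₆ = +-nonNeg s₅ (𝟙-nonNeg (v ≟ u))

      degeneracies-nonNeg : ∀ k u v → 0ℚ ≤ degeneracies k u v
      degeneracies-nonNeg k u v =
        +-nonNeg (+-nonNeg (+-nonNeg (+-nonNeg (+-nonNeg (+-nonNeg (𝟙-nonNeg (k ≟ 0#)) (𝟙-nonNeg (u ≟ 0#)))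
          (𝟙-nonNeg (u ≟ k))) (𝟙-nonNeg (v ≟ 0#))) (𝟙-nonNeg (v ≟ k))) (𝟙-nonNeg (v ≟ u))) (𝟙-nonNeg (v ≟ k ⊝ u))

      module _ (C : 𝔽 p → ℚ) (K : ℚ) (0≤K : 0ℚ ≤ K) (C≤K : ∀ z → C z ≤ K) (∑C≡0 : ∑ C ≡ 0ℚ) where

        private
          displacement : 𝔽 p → 𝔽 p → 𝔽 p → 𝔽 p → 𝔽 p
          displacement s k u v = δ s (s ⊕ k) (s ⊕ u) ⊝ δ s (s ⊕ k) (s ⊕ v)

          offset : 𝔽 p → 𝔽 p → 𝔽 p → 𝔽 p
          offset k u v = (root-of 0# u ⊝ root-of k (u ⊝ k)) ⊝ (root-of 0# v ⊝ root-of k (v ⊝ k))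

          -- In the coordinates k, u, v relative to `s` the denominators 2(t - s) and 2(t - j) no
          -- longer involve `s`, so `s` survives only in the numerators, linearly.
          affine : ∀ s k u v → displacement s k u v ≡ ⊖ slope k u v ⊗ s ⊕ offset k u v
          affine s k u v = trans
            (cong₂ _⊝_ (cong₂ _⊝_ (cong (root-of s) (s+u-s u)) (cong (root-of (s ⊕ k)) (s+u-s-k u)))
                       (cong₂ _⊝_ (cong (root-of s) (s+u-s v)) (cong (root-of (s ⊕ k)) (s+u-s-k v))))
            (solve 8 (λ s k u v a b c d →
              ((:- ((s :+ u :* u) :* a)) :- (:- ((s :+ k :+ (u :- k) :* (u :- k)) :* b)))
                :- ((:- ((s :+ v :* v) :* c)) :- (:- ((s :+ k :+ (v :- k) :* (v :- k)) :* d)))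
              := (:- ((a :- b) :- (c :- d))) :* s
                :+ (((:- ((con 0ℤ :+ u :* u) :* a)) :- (:- ((k :+ (u :- k) :* (u :- k)) :* b)))
                :- ((:- ((con 0ℤ :+ v :* v) :* c)) :- (:- ((k :+ (v :- k) :* (v :- k)) :* d)))))
              refl s k u v (halfInv u) (halfInv (u ⊝ k)) (halfInv v) (halfInv (v ⊝ k)))
            where
            open 𝔽-Solver
            s+u-s : ∀ w → s ⊕ w ⊝ s ≡ w
            s+u-s w = solve 2 (λ s w → s :+ w :- s := w) refl s w
            s+u-s-k : ∀ w → s ⊕ w ⊝ (s ⊕ k) ≡ w ⊝ k
            s+u-s-k w = solve 3 (λ s w k → s :+ w :- (s :+ k) := w :- k) refl s w k

          -- With nonzero slope the displacement runs once through `𝔽 p` and the sum is that of `C`,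
          -- namely 0. With slope 0 there is no averaging and each of the p terms costs `K`.
          over-s : ∀ k u v → ∑ (λ s → C (displacement s k u v)) ≤ degeneracies k u v * (P * K)
          over-s k u v = by-slope (slope k u v ≟ 0#)
            where
            open ≤-Reasoning
            by-slope : Dec (slope k u v ≡ 0#) →
              ∑ (λ s → C (displacement s k u v)) ≤ degeneracies k u v * (P * K)
            by-slope (yes m≡0) = begin
              ∑ (λ s → C (displacement s k u v))
                ≤⟨ ∑-mono (λ s → C≤K (displacement s k u v)) ⟩
              ∑ (λ s → K)
                ≡⟨ trans (∑-const K) (sym (*-identityˡ (P * K))) ⟩
              1ℚ * (P * K)
                ≤⟨ *-monoʳ-≤-nonNeg (P * K) {{nonNegative PK≥0}}
                     (degenerate⇒1≤degeneracies (slope≡0⇒degenerate k u v m≡0)) ⟩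
              degeneracies k u v * (P * K) ∎
              where PK≥0 = *-nonNeg P-nonNeg 0≤K
            by-slope (no m≢0) = begin
              ∑ (λ s → C (displacement s k u v))
                ≡⟨ ∑-cong (λ s → cong C (affine s k u v)) ⟩
              ∑ (λ s → C (⊖ slope k u v ⊗ s ⊕ offset k u v))
                ≡⟨ ∑-affine (⊖ slope k u v) (offset k u v) (⊖-nonZero m≢0) C ⟨
              ∑ C
                ≡⟨ ∑C≡0 ⟩
              0ℚ
                ≤⟨ *-nonNeg (degeneracies-nonNeg k u v) (*-nonNeg P-nonNeg 0≤K) ⟩
              degeneracies k u v * (P * K) ∎

        cycles-≤ : cycles C ≤ seven * (P * P * P) * K
        cycles-≤ = begin
          ∑ (λ s → ∑ λ j → ∑ λ t → ∑ λ t′ → C (δ s j t ⊝ δ s j t′))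
            ≡⟨ ∑-cong (λ s → trans
                 (∑-shiftˡ s (λ j → ∑ λ t → ∑ λ t′ → C (δ s j t ⊝ δ s j t′)))
                 (∑-cong λ k → trans
                   (∑-shiftˡ s (λ t → ∑ λ t′ → C (δ s (s ⊕ k) t ⊝ δ s (s ⊕ k) t′)))
                   (∑-cong λ u → ∑-shiftˡ s (λ t′ → C (δ s (s ⊕ k) (s ⊕ u) ⊝ δ s (s ⊕ k) t′))))) ⟩
          ∑ (λ s → ∑ λ k → ∑ λ u → ∑ λ v → C (displacement s k u v))
            ≡⟨ ∑-swap (λ s k → ∑ λ u → ∑ λ v → C (displacement s k u v)) ⟩
          ∑ (λ k → ∑ λ s → ∑ λ u → ∑ λ v → C (displacement s k u v))
            ≡⟨ ∑-cong (λ k → ∑-swap λ s u → ∑ λ v → C (displacement s k u v)) ⟩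
          ∑ (λ k → ∑ λ u → ∑ λ s → ∑ λ v → C (displacement s k u v))
            ≡⟨ ∑-cong (λ k → ∑-cong λ u → ∑-swap λ s v → C (displacement s k u v)) ⟩
          ∑ (λ k → ∑ λ u → ∑ λ v → ∑ λ s → C (displacement s k u v))
            ≤⟨ ∑-mono (λ k → ∑-mono λ u → ∑-mono λ v → over-s k u v) ⟩
          ∑ (λ k → ∑ λ u → ∑ λ v → degeneracies k u v * (P * K))
            ≡⟨ trans (∑-cong λ k → trans (∑-cong λ u → ∑-*ʳ (degeneracies k u) (P * K))
                 (∑-*ʳ (λ u → ∑ (degeneracies k u)) (P * K)))
                 (∑-*ʳ (λ k → ∑ λ u → ∑ (degeneracies k u)) (P * K)) ⟩
          ∑ (λ k → ∑ λ u → ∑ λ v → degeneracies k u v) * (P * K)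
            ≡⟨ cong (_* (P * K)) ∑-degeneracies ⟩
          seven * (P * P) * (P * K)
            ≡⟨ solve 3 (λ c q k → c :* (q :* q) :* (q :* k) := c :* (q :* q :* q) :* k) refl seven P K ⟩
          seven * (P * P * P) * K ∎
          where
          open ≤-Reasoning
          open +-*-Solver

      -- A correlation never exceeds the square norm and its sum is the square of the sum of the
      -- function; mean zero thus supplies exactly what the cycle estimate asks of `C`.
      N-MM*-mean-zero : (A : Family) → (∀ k → ∑ (A k) ≡ 0ℚ) → N (M (M* A)) ≤ seven * (P * P * P) * N A
      N-MM*-mean-zero A ∑A≡0 = begin
        N (M (M* A))
          ≤⟨ N-MM*-≤ A ⟩
        ∑ (λ k → cycles (correlation (A k)))
          ≤⟨ ∑-mono (λ k → cycles-≤ (correlation (A k)) (∑ λ x → sq (A k x))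
               (∑-nonNeg λ x → sq-nonNeg (A k x)) (correlation-≤ (A k))
               (trans (∑-correlation (A k)) (trans (cong sq (∑A≡0 k)) (*-zeroˡ 0ℚ)))) ⟩
        ∑ (λ k → seven * (P * P * P) * ∑ λ x → sq (A k x))
          ≡⟨ ∑-* (seven * (P * P * P)) (λ k → ∑ λ x → sq (A k x)) ⟩
        seven * (P * P * P) * N A ∎
        where open ≤-Reasoning

      -- Second moment and variance of the dual average

      module _ (f : 𝔽 p → ℚ) where

        open Quadratic f


        F : ℚ
        F = ∑ λ x → sq (f x)

        -- The substitution of `s` for `y` is exact when `d` is nonzero; only `d = 0#` makes this an
        -- inequality. That term is kept in the sum on the right, so that t = s + d can later range
        -- over all of `𝔽 p`.
        ∑-sq-Q-≤ : ∀ w → ∑ (λ z → sq (Q w z))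
          ≤ ∑ (λ x → sq (w x)) * F + ∑ (λ d → ∑ λ s → H w (root-of s d) s d)
        ∑-sq-Q-≤ w = begin
          ∑ (λ z → sq (Q w z))
            ≡⟨ ∑-sq-Q w ⟩
          ∑ (λ d → ∑ λ y → H w y (y ⊗ y ⊝ (y ⊕ d) ⊗ (y ⊕ d)) d)
            ≤⟨ ∑-mono summand ⟩
          ∑ (λ d → c * 𝟙 (d ≟ 0#) + ∑ λ s → H w (root-of s d) s d)
            ≡⟨ ∑-+ (λ d → c * 𝟙 (d ≟ 0#)) (λ d → ∑ λ s → H w (root-of s d) s d) ⟩
          ∑ (λ d → c * 𝟙 (d ≟ 0#)) + ∑ (λ d → ∑ λ s → H w (root-of s d) s d)
            ≡⟨ cong (_+ ∑ λ d → ∑ λ s → H w (root-of s d) s d)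
                 (trans (∑-* c (λ d → 𝟙 (d ≟ 0#))) (trans (cong (c *_) (sum-𝟙 0#)) (*-identityʳ c))) ⟩
          c + ∑ (λ d → ∑ λ s → H w (root-of s d) s d) ∎
          where
          open ≤-Reasoning
          c = ∑ (λ x → sq (w x)) * F

          diagonal : ∑ (λ y → H w y (y ⊗ y ⊝ (y ⊕ 0#) ⊗ (y ⊕ 0#)) 0#) ≡ c
          diagonal = trans
            (∑-cong λ y → ∑-cong λ x → cong₂ _*_
              (cong (λ a → w x * w a)
                (solve 2 (λ x y → x :+ (y :* y :- (y :+ con 0ℤ) :* (y :+ con 0ℤ)) := x) refl x y))
              (cong (λ a → f (x ⊕ y) * f a)
                (solve 2 (λ x y → x :+ y :+ (y :* y :- (y :+ con 0ℤ) :* (y :+ con 0ℤ) :+ con 0ℤ) := x :+ y)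
                  refl x y)))
            (∑-convolution (λ x → sq (w x)) (λ x → sq (f x)))
            where open 𝔽-Solver

          root-of-0 : ∀ s → root-of s 0# ≡ 0#
          root-of-0 s = trans (cong (λ e → ⊖ ((s ⊕ 0# ⊗ 0#) ⊗ e)) halfInv-0#)
            (solve 1 (λ s → :- ((s :+ con 0ℤ :* con 0ℤ) :* con 0ℤ) := con 0ℤ) refl s)
            where open 𝔽-Solver

          -- The junk value halfInv 0 = 0 only adds a square.

          junk : ∑ (λ s → H w (root-of s 0#) s 0#) ≡ sq (∑ λ x → w x * f x)
          junk = trans
            (∑-cong λ s → ∑-cong λ x → trans
              (cong₂ (λ a b → w x * w (x ⊕ s) * (f a * f b))
                (trans (cong (x ⊕_) (root-of-0 s)) (𝔽.solve 1 (λ x → x 𝔽.:+ 𝔽.con 0ℤ 𝔽.:= x) refl x))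
                (trans (cong (λ y → x ⊕ y ⊕ (s ⊕ 0#)) (root-of-0 s))
                  (𝔽.solve 2 (λ x s → x 𝔽.:+ 𝔽.con 0ℤ 𝔽.:+ (s 𝔽.:+ 𝔽.con 0ℤ) 𝔽.:= x 𝔽.:+ s) refl x s)))
              (solve 4 (λ a b c d → a :* b :* (c :* d) := a :* c :* (b :* d)) refl
                (w x) (w (x ⊕ s)) (f x) (f (x ⊕ s))))
            (∑-convolution (λ x → w x * f x) (λ x → w x * f x))
            where
            open +-*-Solver
            module 𝔽 = 𝔽-Solver

          summand : ∀ d → ∑ (λ y → H w y (y ⊗ y ⊝ (y ⊕ d) ⊗ (y ⊕ d)) d)
            ≤ c * 𝟙 (d ≟ 0#) + ∑ λ s → H w (root-of s d) s d
          summand d = by-cases (d ≟ 0#)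
            where
            by-cases : (d≟0 : Dec (d ≡ 0#)) → ∑ (λ y → H w y (y ⊗ y ⊝ (y ⊕ d) ⊗ (y ⊕ d)) d)
              ≤ c * 𝟙 d≟0 + ∑ λ s → H w (root-of s d) s d
            by-cases (yes refl) = begin
              ∑ (λ y → H w y (y ⊗ y ⊝ (y ⊕ 0#) ⊗ (y ⊕ 0#)) 0#) ≡⟨ trans diagonal (sym (*-identityʳ c)) ⟩
              c * 1ℚ                                           ≤⟨ p≤p+q (subst (0ℚ ≤_) (sym junk)
                                                                    (sq-nonNeg (∑ λ x → w x * f x))) ⟩
              c * 1ℚ + ∑ (λ s → H w (root-of s 0#) s 0#)       ∎
            by-cases (no d≢0) = ≤-reflexive (trans (∑-root-of d d≢0 (λ y s → H w y s d))
              (trans (sym (+-identityˡ _)) (cong (_+ ∑ λ s → H w (root-of s d) s d) (sym (*-zeroʳ c)))))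

        module _ (w : 𝔽 p → ℚ) where

          private
            a : ℚ
            a = ∑ λ x → sq (w x)

            W W⁰ Φ : Family
            W s x = w x * w (x ⊕ s)
            W⁰ s = center (W s)
            Φ t x = f x * f (x ⊕ t)

          X : ℚ
          X = ∑ λ s → ∑ λ t → ∑ λ x → W⁰ s x * Φ t (x ⊕ Y s t)

          -- The sums of `W s` over all `s` add up to (∑ w)², those of `Φ t` to (∑ f)². By `∑-Q` the
          -- second term is therefore r (∑ Q w)², the gap between second moment and variance.
          mean-part : ∑ (λ d → ∑ λ s → H w (root-of s d) s d) ≡ X + r * sq (∑ w * ∑ f)
          mean-part = begin
            ∑ (λ d → ∑ λ s → H w (root-of s d) s d)
              ≡⟨ ∑-swap (λ d s → H w (root-of s d) s d) ⟩
            ∑ (λ s → ∑ λ d → H w (root-of s d) s d)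
              ≡⟨ ∑-cong (λ s → ∑-shift (⊖ s) (λ d → H w (root-of s d) s d)) ⟩
            ∑ (λ s → ∑ λ t → H w (Y s t) s (t ⊝ s))
              ≡⟨ ∑-cong (λ s → ∑-cong λ t → ∑-cong λ x → trans
                   (cong (λ b → W s x * (f (x ⊕ Y s t) * f b))
                     (𝔽.solve 4 (λ x y s t → x 𝔽.:+ y 𝔽.:+ (s 𝔽.:+ (t 𝔽.:- s)) 𝔽.:= x 𝔽.:+ y 𝔽.:+ t)
                       refl x (Y s t) s t))
                   (solve 3 (λ w c b → w :* b := (w :- c) :* b :+ c :* b) refl
                     (W s x) (r * ∑ (W s)) (Φ t (x ⊕ Y s t)))) ⟩
            ∑ (λ s → ∑ λ t → ∑ λ x → W⁰ s x * Φ t (x ⊕ Y s t) + r * ∑ (W s) * Φ t (x ⊕ Y s t))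
              ≡⟨ ∑-cong (λ s → ∑-cong λ t → trans
                   (∑-+ (λ x → W⁰ s x * Φ t (x ⊕ Y s t)) (λ x → r * ∑ (W s) * Φ t (x ⊕ Y s t)))
                   (cong (λ e → ∑ (λ x → W⁰ s x * Φ t (x ⊕ Y s t)) + e) (trans
                     (∑-* (r * ∑ (W s)) (λ x → Φ t (x ⊕ Y s t)))
                     (cong (r * ∑ (W s) *_) (sym (∑-shift (Y s t) (Φ t))))))) ⟩
            ∑ (λ s → ∑ λ t → ∑ (λ x → W⁰ s x * Φ t (x ⊕ Y s t)) + r * ∑ (W s) * ∑ (Φ t))
              ≡⟨ trans (∑-cong λ s → ∑-+ (λ t → ∑ (λ x → W⁰ s x * Φ t (x ⊕ Y s t))) (λ t → r * ∑ (W s) * ∑ (Φ t)))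
                   (∑-+ (λ s → ∑ λ t → ∑ (λ x → W⁰ s x * Φ t (x ⊕ Y s t))) (λ s → ∑ λ t → r * ∑ (W s) * ∑ (Φ t))) ⟩
            X + ∑ (λ s → ∑ λ t → r * ∑ (W s) * ∑ (Φ t))
              ≡⟨ cong (λ e → X + e) (trans (sym (∑-product (λ s → r * ∑ (W s)) (λ t → ∑ (Φ t))))
                   (cong₂ _*_ (trans (∑-* r (λ s → ∑ (W s))) (cong (r *_) (∑-convolution w w)))
                            (∑-convolution f f))) ⟩
            X + r * (∑ w * ∑ w) * (∑ f * ∑ f)
              ≡⟨ solve 4 (λ x r a b → x :+ r :* (a :* a) :* (b :* b) := x :+ r :* ((a :* b) :* (a :* b)))
                   refl X r (∑ w) (∑ f) ⟩
            X + r * sq (∑ w * ∑ f) ∎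
            where
            open ≡-Reasoning
            open +-*-Solver
            module 𝔽 = 𝔽-Solver

          variance-Q : ∑ (λ z → sq (center (Q w) z)) ≤ a * F + X
          variance-Q = begin
            ∑ (λ z → sq (center (Q w) z))
              ≡⟨ trans (∑-sq-center (Q w)) (cong (λ e → ∑ (λ z → sq (Q w z)) - r * sq e) (∑-Q w)) ⟩
            ∑ (λ z → sq (Q w z)) - r * sq (∑ w * ∑ f)
              ≤⟨ +-monoˡ-≤ (- (r * sq (∑ w * ∑ f))) (∑-sq-Q-≤ w) ⟩
            a * F + ∑ (λ d → ∑ λ s → H w (root-of s d) s d) - r * sq (∑ w * ∑ f)
              ≡⟨ cong (λ e → a * F + e - r * sq (∑ w * ∑ f)) mean-part ⟩
            a * F + (X + r * sq (∑ w * ∑ f)) - r * sq (∑ w * ∑ f)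
              ≡⟨ solve 3 (λ c x m → c :+ (x :+ m) :- m := c :+ x) refl (a * F) X (r * sq (∑ w * ∑ f)) ⟩
            a * F + X ∎
            where
            open ≤-Reasoning
            open +-*-Solver

          N-differences : ∀ (h : 𝔽 p → ℚ) → ∑ (λ s → ∑ λ x → sq (h x * h (x ⊕ s))) ≡ sq (∑ λ x → sq (h x))
          N-differences h = trans
            (∑-cong λ s → ∑-cong λ x →
              solve 2 (λ a b → a :* b :* (a :* b) := a :* a :* (b :* b)) refl (h x) (h (x ⊕ s)))
            (∑-convolution (λ x → sq (h x)) (λ x → sq (h x)))
            where open +-*-Solver

          X⁴-≤ : sq (sq X) ≤ seven * (P * P * P) * (sq (sq a) * sq (sq F))
          X⁴-≤ = begin
            sq (sq X)
              ≤⟨ pairing⁴-≤ W⁰ Φ ⟩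
            N W⁰ * N (M (M* W⁰)) * sq (N Φ)
              ≤⟨ *-monoʳ-≤-nonNeg (sq (N Φ)) {{nonNegative (sq-nonNeg (N Φ))}}
                   (*-monoˡ-≤-nonNeg (N W⁰) {{nonNegative (N-nonNeg W⁰)}}
                     (N-MM*-mean-zero W⁰ (λ k → ∑-center (W k)))) ⟩
            N W⁰ * (κ * N W⁰) * sq (N Φ)
              ≡⟨ solve 3 (λ n k m → n :* (k :* n) :* m := k :* (n :* n :* m)) refl (N W⁰) κ (sq (N Φ)) ⟩
            κ * (sq (N W⁰) * sq (N Φ))
              ≤⟨ *-monoˡ-≤-nonNeg κ {{nonNegative κ≥0}}
                   (*-monoʳ-≤-nonNeg (sq (N Φ)) {{nonNegative (sq-nonNeg (N Φ))}}
                   (*-mono-≤-nonNeg (N-nonNeg W⁰) (sq-nonNeg a) N-W⁰ N-W⁰)) ⟩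
            κ * (sq (sq a) * sq (N Φ))
              ≡⟨ cong (λ e → κ * (sq (sq a) * sq e)) (N-differences f) ⟩
            κ * (sq (sq a) * sq (sq F)) ∎
            where
            open ≤-Reasoning
            open +-*-Solver
            κ = seven * (P * P * P)
            κ≥0 = *-nonNeg (nonNegative⁻¹ seven) (*-nonNeg (*-nonNeg P-nonNeg P-nonNeg) P-nonNeg)
            N-W⁰ : N W⁰ ≤ sq a
            N-W⁰ = ≤-trans (∑-mono λ s → ∑-sq-center-≤ (W s)) (≤-reflexive (N-differences w))

    -- Norm bounds for the bilinear average, real and complex

    1≤P : 1ℚ ≤ P
    1≤P = fromℕ-mono (ℕ.>-nonZero⁻¹ p)


    P³ : ℚ
    P³ = P * P * P

    1≤P³ : 1ℚ ≤ P³
    1≤P³ = *-mono-≤-nonNeg 0≤1 P-nonNeg (*-mono-≤-nonNeg 0≤1 P-nonNeg 1≤P 1≤P) 1≤P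
      where 0≤1 = nonNegative⁻¹ 1ℚ

    T : (𝔽 p → ℚ) → (𝔽 p → ℚ) → 𝔽 p → ℚ
    T f = Quadratic.T f

    ‖_‖² : (𝔽 p → ℚ) → ℚ
    ‖ f ‖² = ∑ λ x → sq (f x)

    ‖‖²-nonNeg : ∀ f → 0ℚ ≤ ‖ f ‖²
    ‖‖²-nonNeg f = ∑-nonNeg λ x → sq-nonNeg (f x)

    -- In characteristic 2 the difference y² - (y + d)² = -d² does not depend on y, so y cannot be
    -- recovered from it; but then p ≤ 2, and a spare factor `P` in the trivial bound is absorbed by
    -- 64.
    mean-zero-bound : ∀ f g → ∑ g ≡ 0ℚ →
      fourth ‖ T f g ‖² ≤ (+ 64 / 1) * P³ * (fourth ‖ f ‖² * fourth ‖ g ‖²)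
    mean-zero-bound f g ∑g≡0 = by-parity (two ≟ 0#)
      where
      by-parity : Dec (two ≡ 0#) → fourth ‖ T f g ‖² ≤ (+ 64 / 1) * P³ * (fourth ‖ f ‖² * fourth ‖ g ‖²)
      by-parity (yes two≡0) = begin
        fourth ‖ T f g ‖²
          ≤⟨ fourth-mono (‖‖²-nonNeg (T f g)) (Quadratic.∑-sq-T-trivial f g) ⟩
        fourth (P * ‖ f ‖² * ‖ g ‖²)
          ≡⟨ solve 3 (λ q f g → (q :* f :* g :* (q :* f :* g)) :* (q :* f :* g :* (q :* f :* g))
               := q :* (q :* q :* q :* ((f :* f) :* (f :* f) :* ((g :* g) :* (g :* g))))) refl P ‖ f ‖² ‖ g ‖² ⟩
        P * (P³ * FG)
          ≤⟨ *-monoʳ-≤-nonNeg (P³ * FG) {{nonNegative (*-nonNeg P³≥0 FG≥0)}}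
               (≤-trans (fromℕ-mono (two≡0⇒p≤2 two≡0)) 2≤64) ⟩
        (+ 64 / 1) * (P³ * FG)
          ≡⟨ *-assoc (+ 64 / 1) P³ FG ⟨
        (+ 64 / 1) * P³ * FG ∎
        where
        open ≤-Reasoning
        open +-*-Solver
        FG = fourth ‖ f ‖² * fourth ‖ g ‖²
        FG≥0 = *-nonNeg (fourth-nonNeg ‖ f ‖²) (fourth-nonNeg ‖ g ‖²)
        P³≥0 = ≤-trans (nonNegative⁻¹ 1ℚ) 1≤P³
        2≤64 : fromℕ 2 ≤ + 64 / 1
        2≤64 = fromℕ-mono (ℕ.m≤m+n 2 62)
      by-parity (no two≢0) =
        cycle-estimate⇒bound ‖ w ‖² ‖ f ‖² ‖ g ‖² (X f w) P³ (‖‖²-nonNeg f) (‖‖²-nonNeg g) 1≤P³ a²≤ (X⁴-≤ f w)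
        where
        open Quadratic f using (Q; T-Q-adjoint)
        open Odd two≢0 using (X; variance-Q; X⁴-≤)
        open Integral (counting p) using (cauchy-schwarz)
        w = T f g
        -- A mean-zero `g` does not see the mean of `Q w`. Removing it before Cauchy-Schwarz makes
        -- the variance of `Q w` appear instead of its second moment.
        a≡ : ‖ w ‖² ≡ ∑ (λ z → g z * center (Q w) z)
        a≡ = begin
          ∑ (λ x → w x * T f g x)
            ≡⟨ T-Q-adjoint g w ⟩
          ∑ (λ z → g z * Q w z)
            ≡⟨ ∑-cong (λ z → *-comm (g z) (Q w z)) ⟩
          ∑ (λ z → Q w z * g z)
            ≡⟨ solve 3 (λ s r q → s := s :- r :* (q :* con 0ℚ)) refl (∑ λ z → Q w z * g z) r (∑ (Q w)) ⟩
          ∑ (λ z → Q w z * g z) - r * (∑ (Q w) * 0ℚ)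
            ≡⟨ cong (λ e → ∑ (λ z → Q w z * g z) - r * (∑ (Q w) * e)) ∑g≡0 ⟨
          ∑ (λ z → Q w z * g z) - r * (∑ (Q w) * ∑ g)
            ≡⟨ ∑-center-* (Q w) g ⟨
          ∑ (λ z → center (Q w) z * g z)
            ≡⟨ ∑-cong (λ z → *-comm (center (Q w) z) (g z)) ⟩
          ∑ (λ z → g z * center (Q w) z) ∎
          where
          open ≡-Reasoning
          open +-*-Solver
        a²≤ : sq ‖ w ‖² ≤ ‖ g ‖² * (‖ w ‖² * ‖ f ‖² + X f w)
        a²≤ = begin
          sq ‖ w ‖²
            ≡⟨ cong sq a≡ ⟩
          sq (∑ λ z → g z * center (Q w) z)
            ≤⟨ cauchy-schwarz g (center (Q w)) ⟩
          ‖ g ‖² * ‖ center (Q w) ‖²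
            ≤⟨ *-monoˡ-≤-nonNeg ‖ g ‖² {{nonNegative (‖‖²-nonNeg g)}} (variance-Q f w) ⟩
          ‖ g ‖² * (‖ w ‖² * ‖ f ‖² + X f w) ∎
          where open ≤-Reasoning

    T̃ : (𝔽 p → ℚ) → (𝔽 p → ℚ) → 𝔽 p → ℚ
    T̃ f g x = T f g x - r * (∑ f * ∑ g)

    -- Centering `g` alone subtracts the full main term, because the sum of `f (x ⊕ y)` over `y` is
    -- `∑ f` for every `x`.
    T̃-bound : ∀ f g → fourth ‖ T̃ f g ‖² ≤ (+ 64 / 1) * P³ * (fourth ‖ f ‖² * fourth ‖ g ‖²)
    T̃-bound f g = begin
      fourth ‖ T̃ f g ‖²
        ≡⟨ cong fourth (∑-cong λ x → cong sq (centered x)) ⟨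
      fourth ‖ T f (center g) ‖²
        ≤⟨ mean-zero-bound f (center g) (∑-center g) ⟩
      (+ 64 / 1) * P³ * (fourth ‖ f ‖² * fourth ‖ center g ‖²)
        ≤⟨ *-monoˡ-≤-nonNeg ((+ 64 / 1) * P³) {{nonNegative (*-nonNeg (nonNegative⁻¹ (+ 64 / 1)) P³≥0)}}
             (*-monoˡ-≤-nonNeg (fourth ‖ f ‖²) {{nonNegative (fourth-nonNeg ‖ f ‖²)}}
               (fourth-mono (‖‖²-nonNeg (center g)) (∑-sq-center-≤ g))) ⟩
      (+ 64 / 1) * P³ * (fourth ‖ f ‖² * fourth ‖ g ‖²) ∎
      where
      open ≤-Reasoning
      open +-*-Solver
      P³≥0 = ≤-trans (nonNegative⁻¹ 1ℚ) 1≤P³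
      centered : ∀ x → T f (center g) x ≡ T̃ f g x
      centered x = begin-equality
        ∑ (λ y → f (x ⊕ y) * (g (x ⊕ y ⊗ y) - r * ∑ g))
          ≡⟨ ∑-cong (λ y → solve 3 (λ f g m → f :* (g :- m) := f :* g :- f :* m) refl
               (f (x ⊕ y)) (g (x ⊕ y ⊗ y)) (r * ∑ g)) ⟩
        ∑ (λ y → f (x ⊕ y) * g (x ⊕ y ⊗ y) - f (x ⊕ y) * (r * ∑ g))
          ≡⟨ ∑-- (λ y → f (x ⊕ y) * g (x ⊕ y ⊗ y)) (λ y → f (x ⊕ y) * (r * ∑ g)) ⟩
        T f g x - ∑ (λ y → f (x ⊕ y) * (r * ∑ g))
          ≡⟨ cong (λ e → T f g x - e) (trans (∑-*ʳ (λ y → f (x ⊕ y)) (r * ∑ g))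
               (cong (_* (r * ∑ g)) (sym (∑-shiftˡ x f)))) ⟩
        T f g x - ∑ f * (r * ∑ g)
          ≡⟨ solve 4 (λ t f r g → t :- f :* (r :* g) := t :- r :* (f :* g)) refl (T f g x) (∑ f) r (∑ g) ⟩
        T̃ f g x ∎

    -- For complex f₁ = a + bi and f₂ = c + di the deviation has real part
    -- r (T̃ a c − T̃ b d) and imaginary part r (T̃ a d + T̃ b c).

    module _ (a b c d : 𝔽 p → ℚ) where

      deviation² : 𝔽 p → ℚ
      deviation² x = sq (r * (T̃ a c x - T̃ b d x)) + sq (r * (T̃ a d x + T̃ b c x))

      private
        t : ℚ
        t = (‖ T̃ a c ‖² + ‖ T̃ b d ‖²) + (‖ T̃ a d ‖² + ‖ T̃ b c ‖²)

        B₁ B₂ κ : ℚ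
        B₁ = ‖ a ‖² + ‖ b ‖²
        B₂ = ‖ c ‖² + ‖ d ‖²
        κ = (+ 64 / 1) * P³

        κ≥0 : 0ℚ ≤ κ
        κ≥0 = *-nonNeg (nonNegative⁻¹ (+ 64 / 1)) (≤-trans (nonNegative⁻¹ 1ℚ) 1≤P³)

      deviation²-nonNeg : 0ℚ ≤ ∑ deviation²
      deviation²-nonNeg = ∑-nonNeg λ x → +-nonNeg
        (sq-nonNeg (r * (T̃ a c x - T̃ b d x))) (sq-nonNeg (r * (T̃ a d x + T̃ b c x)))

      ∑-deviation²-≤ : ∑ deviation² ≤ (1ℚ + 1ℚ) * (r * r) * t
      ∑-deviation²-≤ = begin
        ∑ deviation²
          ≤⟨ ∑-mono (λ x → ≤-by (sq r * (sq (T̃ a c x + T̃ b d x) + sq (T̃ a d x - T̃ b c x)))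
               (*-nonNeg (sq-nonNeg r)
                 (+-nonNeg (sq-nonNeg (T̃ a c x + T̃ b d x)) (sq-nonNeg (T̃ a d x - T̃ b c x))))
               (solve 5 (λ r α β γ δ → con (1ℚ + 1ℚ) :* (r :* r) :* ((α :* α :+ β :* β) :+ (γ :* γ :+ δ :* δ))
                 := (r :* (α :- β) :* (r :* (α :- β)) :+ r :* (γ :+ δ) :* (r :* (γ :+ δ)))
                   :+ r :* r :* ((α :+ β) :* (α :+ β) :+ (γ :- δ) :* (γ :- δ)))
                 refl r (T̃ a c x) (T̃ b d x) (T̃ a d x) (T̃ b c x))) ⟩
        ∑ (λ x → (1ℚ + 1ℚ) * (r * r) * ((sq (T̃ a c x) + sq (T̃ b d x)) + (sq (T̃ a d x) + sq (T̃ b c x))))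
          ≡⟨ ∑-* ((1ℚ + 1ℚ) * (r * r)) (λ x → (sq (T̃ a c x) + sq (T̃ b d x)) + (sq (T̃ a d x) + sq (T̃ b c x))) ⟩
        (1ℚ + 1ℚ) * (r * r) * ∑ (λ x → (sq (T̃ a c x) + sq (T̃ b d x)) + (sq (T̃ a d x) + sq (T̃ b c x)))
          ≡⟨ cong ((1ℚ + 1ℚ) * (r * r) *_) (trans
               (∑-+ (λ x → sq (T̃ a c x) + sq (T̃ b d x)) (λ x → sq (T̃ a d x) + sq (T̃ b c x)))
               (cong₂ _+_ (∑-+ (λ x → sq (T̃ a c x)) (λ x → sq (T̃ b d x)))
                          (∑-+ (λ x → sq (T̃ a d x)) (λ x → sq (T̃ b c x))))) ⟩
        (1ℚ + 1ℚ) * (r * r) * t ∎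
        where
        open ≤-Reasoning
        open +-*-Solver

      fourth-t-≤ : fourth t ≤ (+ 64 / 1) * κ * (fourth B₁ * fourth B₂)
      fourth-t-≤ = begin
        fourth t
          ≤⟨ fourth-+-≤ (‖ T̃ a c ‖² + ‖ T̃ b d ‖²) (‖ T̃ a d ‖² + ‖ T̃ b c ‖²) ⟩
        8ℚ * (fourth (‖ T̃ a c ‖² + ‖ T̃ b d ‖²) + fourth (‖ T̃ a d ‖² + ‖ T̃ b c ‖²))
          ≤⟨ *-monoˡ-≤-nonNeg 8ℚ (+-mono-≤ (pair a c b d) (pair a d b c)) ⟩
        8ℚ * (8ℚ * (κ * (A * C) + κ * (B * D)) + 8ℚ * (κ * (A * D) + κ * (B * C)))
          -- The four real pairs supply all products of one of `A`, `B` with one of `C`, `D`, so the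
          -- sum factors without loss.
          ≡⟨ solve 5 (λ k a b c d → con 8ℚ :* (con 8ℚ :* (k :* (a :* c) :+ k :* (b :* d))
                                             :+ con 8ℚ :* (k :* (a :* d) :+ k :* (b :* c)))
               := con (+ 64 / 1) :* k :* ((a :+ b) :* (c :+ d))) refl κ A B C D ⟩
        (+ 64 / 1) * κ * ((A + B) * (C + D))
          ≤⟨ *-monoˡ-≤-nonNeg ((+ 64 / 1) * κ) {{nonNegative (*-nonNeg (nonNegative⁻¹ (+ 64 / 1)) κ≥0)}}
               (*-mono-≤-nonNeg (+-nonNeg (fourth-nonNeg ‖ a ‖²) (fourth-nonNeg ‖ b ‖²)) (fourth-nonNeg B₂)
                 (fourth-superadditive (‖‖²-nonNeg a) (‖‖²-nonNeg b))
                 (fourth-superadditive (‖‖²-nonNeg c) (‖‖²-nonNeg d))) ⟩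
        (+ 64 / 1) * κ * (fourth B₁ * fourth B₂) ∎
        where
        open ≤-Reasoning
        open +-*-Solver
        8ℚ = + 8 / 1
        A = fourth ‖ a ‖²
        B = fourth ‖ b ‖²
        C = fourth ‖ c ‖²
        D = fourth ‖ d ‖²
        pair : ∀ f g h k → fourth (‖ T̃ f g ‖² + ‖ T̃ h k ‖²)
          ≤ 8ℚ * (κ * (fourth ‖ f ‖² * fourth ‖ g ‖²) + κ * (fourth ‖ h ‖² * fourth ‖ k ‖²))
        pair f g h k = ≤-trans (fourth-+-≤ ‖ T̃ f g ‖² ‖ T̃ h k ‖²)
          (*-monoˡ-≤-nonNeg 8ℚ (+-mono-≤ (T̃-bound f g) (T̃-bound h k)))

      -- The total of twelve factors `r` splits into eight for the normalization of the two norms,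
      -- three that cancel `P³`, and one that is the saving. The constant is 2⁴ · 64 · 64.
      fourth-deviation-≤ : fourth (r * ∑ deviation²)
        ≤ (+ 65536 / 1) * r * (fourth (r * B₁) * fourth (r * B₂))
      fourth-deviation-≤ = begin
        fourth (r * ∑ deviation²)
          ≤⟨ fourth-mono (*-nonNeg 0≤r deviation²-nonNeg)
               (*-monoˡ-≤-nonNeg r {{nonNegative 0≤r}} ∑-deviation²-≤) ⟩
        fourth (r * ((1ℚ + 1ℚ) * (r * r) * t))
          ≡⟨ trans (cong fourth (sym (*-assoc r ((1ℚ + 1ℚ) * (r * r)) t))) (fourth-* ℓ t) ⟩
        fourth ℓ * fourth t
          ≤⟨ *-monoˡ-≤-nonNeg (fourth ℓ) {{nonNegative (fourth-nonNeg ℓ)}} fourth-t-≤ ⟩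
        fourth ℓ * ((+ 64 / 1) * κ * (fourth B₁ * fourth B₂))
          ≡⟨ solve 4 (λ r q x y → fourth′ (r :* (con (1ℚ + 1ℚ) :* (r :* r)))
                 :* (con (+ 64 / 1) :* (con (+ 64 / 1) :* (q :* q :* q)) :* (x :* y))
               := con (+ 65536 / 1) :* (r :* (fourth′ r :* x :* (fourth′ r :* y)))
                   :* ((q :* r) :* (q :* r) :* (q :* r)))
               refl r P (fourth B₁) (fourth B₂) ⟩
        (+ 65536 / 1) * (r * B) * ((P * r) * (P * r) * (P * r))
          ≡⟨ cong (λ e → (+ 65536 / 1) * (r * B) * (e * e * e)) Pr≡1 ⟩
        (+ 65536 / 1) * (r * B) * (1ℚ * 1ℚ * 1ℚ)
          ≡⟨ trans (*-identityʳ ((+ 65536 / 1) * (r * B))) (sym (*-assoc (+ 65536 / 1) r B)) ⟩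
        (+ 65536 / 1) * r * B
          ≡⟨ cong₂ (λ x y → (+ 65536 / 1) * r * (x * y)) (fourth-* r B₁) (fourth-* r B₂) ⟨
        (+ 65536 / 1) * r * (fourth (r * B₁) * fourth (r * B₂)) ∎
        where
        open ≤-Reasoning
        open +-*-Solver
        B ℓ : ℚ
        B = fourth r * fourth B₁ * (fourth r * fourth B₂)
        ℓ = r * ((1ℚ + 1ℚ) * (r * r))
        fourth′ : ∀ {n} → Polynomial n → Polynomial n
        fourth′ x = (x :* x) :* (x :* x)

-- Roots and limits of sequences of rationals

^-mono-< : ∀ {x y} d → 0ℚ ≤ x → x < y → x ^ suc d < y ^ suc d
^-mono-< {x} {y} d 0≤x x<y = begin-strict
  x * x ^ d ≤⟨ *-monoˡ-≤-nonNeg x {{nonNegative 0≤x}} (^-mono-≤ d 0≤x (<⇒≤ x<y)) ⟩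
  x * y ^ d <⟨ *-monoˡ-<-pos (y ^ d) {{positive (^-pos d (≤-<-trans 0≤x x<y))}} x<y ⟩
  y * y ^ d ∎
  where open ≤-Reasoning

^-cancel-≤ : ∀ {x y} d → 0ℚ ≤ y → x ^ suc d ≤ y ^ suc d → x ≤ y
^-cancel-≤ {x} {y} d 0≤y h with x ≤? y
... | yes x≤y = x≤y
... | no x≰y = contradiction (<-≤-trans (^-mono-< d 0≤y (≰⇒> x≰y)) h) (<-irrefl refl)

sq≡^2 : ∀ x → sq x ≡ x ^ 2
sq≡^2 x = cong (x *_) (sym (*-identityʳ x))

fourth≡^4 : ∀ x → fourth x ≡ x ^ 4
fourth≡^4 = solve 1 (λ x → x :* x :* (x :* x) := x :^ 4) refl
  where open +-*-Solver

-- For squared norms the hypothesis saves r^(1/4), that is p^(-1/8) for norms. Multiplied by a ≤ 16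
-- b, which follows from it by r ≤ 1, it becomes a saving r^(1/5) of squared norms, the one
-- expressed by a tenth root. Here 65536 = 16⁴ and 16 · 65536 = 4¹⁰.
fifth-power-bound : ∀ {a b r} → 0ℚ ≤ a → 0ℚ ≤ b → 0ℚ ≤ r → r ≤ 1ℚ →
  fourth a ≤ (+ 65536 / 1) * r * fourth b →
  a ^ 5 ≤ (+ 4 / 1) ^ 10 * r * b ^ 5
fifth-power-bound {a} {b} {r} 0≤a 0≤b 0≤r r≤1 a⁴≤ = begin
  a * a ^ 4
    ≤⟨ *-mono-≤-nonNeg 0≤a (≤-trans (^-nonNeg 4 0≤a) a^4≤) a≤16b a^4≤ ⟩
  (+ 16 / 1) * b * ((+ 65536 / 1) * r * b ^ 4)
    ≡⟨ solve 3 (λ b r c → con (+ 16 / 1) :* b :* (con (+ 65536 / 1) :* r :* c)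
         := con (+ 1048576 / 1) :* r :* (b :* c)) refl b r (b ^ 4) ⟩
  (+ 4 / 1) ^ 10 * r * b ^ 5 ∎
  where
  open ≤-Reasoning
  open +-*-Solver
  a^4≤ : a ^ 4 ≤ (+ 65536 / 1) * r * b ^ 4
  a^4≤ = subst₂ (λ x y → x ≤ (+ 65536 / 1) * r * y) (fourth≡^4 a) (fourth≡^4 b) a⁴≤
  a≤16b : a ≤ (+ 16 / 1) * b
  a≤16b = ^-cancel-≤ 3 (*-nonNeg (nonNegative⁻¹ (+ 16 / 1)) 0≤b) (begin
    a ^ 4
      ≤⟨ a^4≤ ⟩
    (+ 65536 / 1) * r * b ^ 4
      ≤⟨ *-monoʳ-≤-nonNeg (b ^ 4) {{nonNegative (^-nonNeg 4 0≤b)}} (*-monoˡ-≤-nonNeg (+ 65536 / 1) r≤1) ⟩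
    (+ 16 / 1) ^ 4 * b ^ 4
      ≡⟨ ^-distrib-* (+ 16 / 1) b 4 ⟨
    ((+ 16 / 1) * b) ^ 4 ∎)

≈ʳ-refl : ∀ x → x ≈ʳ x
≈ʳ-refl x ε 0<ε = 0 , λ n _ → subst (_< ε) (sym (cong ∣_∣ (+-inverseʳ (seq x n)))) 0<ε

*ʳ-cong : ∀ x x′ y y′ → x ≈ʳ x′ → y ≈ʳ y′ → x *ʳ y ≈ʳ x′ *ʳ y′
*ʳ-cong x x′ y y′ x≈x′ y≈y′ ε 0<ε =
  let A , 0<A , K , x-bound = eventually-bounded x
      B , 0<B , L , y′-bound = eventually-bounded y′
      α , 0<α , Aα≡ = divide A (half ε) 0<A (half-pos 0<ε)
      β , 0<β , Bβ≡ = divide B (half ε) 0<B (half-pos 0<ε)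
      N , x-close = x≈x′ β 0<β
      M , y-close = y≈y′ α 0<α
      KL = K ℕ.⊔ L
      NM = N ℕ.⊔ M
  in KL ℕ.⊔ NM , λ n n≥ →
    let n≥KL = ℕ.m⊔n≤o⇒m≤o KL NM n≥
        n≥NM = ℕ.m⊔n≤o⇒n≤o KL NM n≥
    in begin-strict
    ∣ seq x n * seq y n - seq x′ n * seq y′ n ∣
      ≡⟨ cong ∣_∣ (solve 4 (λ a b c d → a :* b :- c :* d := a :* (b :- d) :+ d :* (a :- c))
           refl (seq x n) (seq y n) (seq x′ n) (seq y′ n)) ⟩
    ∣ seq x n * (seq y n - seq y′ n) + seq y′ n * (seq x n - seq x′ n) ∣
      ≤⟨ ∣p+q∣≤∣p∣+∣q∣ (seq x n * (seq y n - seq y′ n)) (seq y′ n * (seq x n - seq x′ n)) ⟩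
    ∣ seq x n * (seq y n - seq y′ n) ∣ + ∣ seq y′ n * (seq x n - seq x′ n) ∣
      <⟨ +-mono-<
           (*-small (x-bound n (ℕ.m⊔n≤o⇒m≤o K L n≥KL)) (y-close n (ℕ.m⊔n≤o⇒n≤o N M n≥NM)) 0<A)
           (*-small (y′-bound n (ℕ.m⊔n≤o⇒n≤o K L n≥KL)) (x-close n (ℕ.m⊔n≤o⇒m≤o N M n≥NM)) 0<B) ⟩
    A * α + B * β
      ≡⟨ cong₂ _+_ Aα≡ Bβ≡ ⟩
    half ε + half ε
      ≡⟨ half+half ε ⟩
    ε ∎
  where
  open ≤-Reasoning
  open +-*-Solver

-- Twice the precision 1/(n + 1) of the roots: ‖f‖₂ involves two of them, ∣f x∣ and the norm.

error : ℕ → ℚ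
error n = 1/suc n + 1/suc n

error-pos : ∀ n → 0ℚ < error n
error-pos n = +-mono-< (1/suc-pos n) (1/suc-pos n)

error-null : ∀ ε → 0ℚ < ε → ∃[ N ] ∀ n → N ℕ.≤ n → error n < ε
error-null ε 0<ε =
  let N , small = archimedean (half ε) (half-pos 0<ε)
  in N , λ n n≥ → subst (error n <_) (half+half ε) (+-mono-< (small n n≥) (small n n≥))

∣p-q∣<p+q : ∀ {p q} → 0ℚ < p → 0ℚ < q → ∣ p - q ∣ < p + q
∣p-q∣<p+q {p} {q} 0<p 0<q = ∣p-q∣<ε {p} {q} {p + q}
  (≤-<-trans (≤-reflexive (sym (+-identityʳ p))) (subst (p + 0ℚ <_)
    (solve 2 (λ p q → p :+ (q :+ q) := q :+ (p :+ q)) refl p q) (+-monoʳ-< p (+-mono-< 0<q 0<q))))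
  (≤-<-trans (≤-reflexive (sym (+-identityʳ q))) (subst (q + 0ℚ <_)
    (solve 2 (λ p q → q :+ (p :+ p) := p :+ (p :+ q)) refl p q) (+-monoʳ-< q (+-mono-< 0<p 0<p))))
  where open +-*-Solver

errorʳ : ℝ
errorʳ = mkℝ error λ ε 0<ε →
  let N , small = error-null (half ε) (half-pos 0<ε)
  in N , λ m n m≥ n≥ → <-trans (∣p-q∣<p+q (error-pos m) (error-pos n))
    (subst (error m + error n <_) (half+half ε) (+-mono-< (small m m≥) (small n n≥)))

+-error-≈ : ∀ x → x +ʳ errorʳ ≈ʳ x
+-error-≈ x ε 0<ε =
  let N , small = error-null ε 0<ε
  in N , λ n n≥ → subst (_< ε)
    (sym (trans (cong ∣_∣ (solve 2 (λ a e → a :+ e :- a := e) refl (seq x n) (error n)))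
      (0≤p⇒∣p∣≡p (<⇒≤ (error-pos n)))))
    (small n n≥)
  where open +-*-Solver

≤-≈⇒≤ʳ : ∀ x y z → (∀ n → seq x n ≤ seq y n) → y ≈ʳ z → x ≤ʳ z
≤-≈⇒≤ʳ x y z x≤y y≈z ε 0<ε =
  let N , close = y≈z ε 0<ε
  in N , λ n n≥ → ≤-<-trans (x≤y n) (∣p-q∣<ε⇒p<q+ε {seq y n} {seq z n} (close n n≥))

-- The errors form a real that vanishes in the limit, so they disappear from the product by
-- congruence and the cross terms need no estimate of their own.
product-≤ʳ : ∀ c w x y z →
  (∀ n → seq w n ≤ c * (seq x n + error n) * (seq y n + error n) * (seq z n + error n)) →
  w ≤ʳ fromℚ c *ʳ x *ʳ y *ʳ z
product-≤ʳ c w x y z h =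
  ≤-≈⇒≤ʳ w (cx⁺ *ʳ y⁺ *ʳ z⁺) (cx *ʳ y *ʳ z) h
    (*ʳ-cong (cx⁺ *ʳ y⁺) (cx *ʳ y) z⁺ z
      (*ʳ-cong cx⁺ cx y⁺ y
        (*ʳ-cong (fromℚ c) (fromℚ c) x⁺ x (≈ʳ-refl (fromℚ c)) (+-error-≈ x))
        (+-error-≈ y))
      (+-error-≈ z))
  where
  x⁺ y⁺ z⁺ cx cx⁺ : ℝ
  x⁺ = x +ʳ errorʳ
  y⁺ = y +ʳ errorʳ
  z⁺ = z +ʳ errorʳ
  cx = fromℚ c *ʳ x
  cx⁺ = fromℚ c *ʳ x⁺

seq-Σʳ : ∀ {k} (f : Fin k → ℝ) n → seq (Σʳ f) n ≡ Integral.∫ (counting k) (λ x → seq (f x) n)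
seq-Σʳ {zero}  f n = refl
seq-Σʳ {suc k} f n = cong (λ s → seq (f zero) n + s) (seq-Σʳ (λ x → f (suc x)) n)

seq-re-Σᶜ : ∀ {k} (f : Fin k → ℂ) n → seq (re (Σᶜ f)) n ≡ Integral.∫ (counting k) (λ x → seq (re (f x)) n)
seq-re-Σᶜ {zero}  f n = refl
seq-re-Σᶜ {suc k} f n = cong (λ s → seq (re (f zero)) n + s) (seq-re-Σᶜ (λ x → f (suc x)) n)

seq-im-Σᶜ : ∀ {k} (f : Fin k → ℂ) n → seq (im (Σᶜ f)) n ≡ Integral.∫ (counting k) (λ x → seq (im (f x)) n)
seq-im-Σᶜ {zero}  f n = refl
seq-im-Σᶜ {suc k} f n = cong (λ s → seq (im (f zero)) n + s) (seq-im-Σᶜ (λ x → f (suc x)) n)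

rootApprox-≤ : ∀ d n {q} → 0ℚ ≤ q → rootApprox (suc d) n (0ℚ ⊔ q) ^ suc d ≤ q
rootApprox-≤ d n {q} 0≤q = subst (λ x → rootApprox (suc d) n x ^ suc d ≤ q)
  (sym (p≤q⇒p⊔q≡q 0≤q)) (rootApprox-lower d n q 0≤q)

rootApprox-≥ : ∀ d n q → q ≤ (rootApprox (suc d) n (0ℚ ⊔ q) + 1/suc n) ^ suc d
rootApprox-≥ d n q = <⇒≤ (≤-<-trans (p≤q⊔p 0ℚ q) (rootApprox-upper d n (0ℚ ⊔ q)))

-- The inequality for the n-th terms of the representing sequences

module Norm (p : ℕ) .{{_ : NonZero p}} (n : ℕ) where

  open Modulus p (1ℤ / p) (1/-nonNeg p) (fromℕ-*-1/ p)
  open Integral (counting p) using (cauchy-schwarz)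

  r : ℚ
  r = 1ℤ / p

  0≤r : 0ℚ ≤ r
  0≤r = 1/-nonNeg p

  Pr≡1 : P * r ≡ 1ℚ
  Pr≡1 = fromℕ-*-1/ p

  modulus² : (𝔽 p → ℂ) → 𝔽 p → ℚ
  modulus² f x = sq (seq (re (f x)) n) + sq (seq (im (f x)) n)

  modulus²-nonNeg : ∀ f x → 0ℚ ≤ modulus² f x
  modulus²-nonNeg f x = +-nonNeg (sq-nonNeg (seq (re (f x)) n)) (sq-nonNeg (seq (im (f x)) n))

  modulus : (𝔽 p → ℂ) → 𝔽 p → ℚ
  modulus f x = rootApprox 2 n (0ℚ ⊔ modulus² f x)

  mean-square : (𝔽 p → ℂ) → ℚ
  mean-square f = r * ∑ λ x → sq (modulus f x)

  mean-square-nonNeg : ∀ f → 0ℚ ≤ mean-square f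
  mean-square-nonNeg f = *-nonNeg 0≤r (∑-nonNeg λ x → sq-nonNeg (modulus f x))

  norm : (𝔽 p → ℂ) → ℚ
  norm f = rootApprox 2 n (0ℚ ⊔ mean-square f)

  seq-‖‖₂ : ∀ f → seq ‖ f ‖₂ n ≡ norm f
  seq-‖‖₂ f = cong (λ s → rootApprox 2 n (0ℚ ⊔ r * s)) (seq-Σʳ (λ x → ∣ f x ∣ᶜ *ʳ ∣ f x ∣ᶜ) n)

  -- Approximate roots err downwards only, so the bound from above carries no error term, although
  -- two roots are nested.
  norm-upper : ∀ f → norm f ^ 2 ≤ r * ∑ (modulus² f)
  norm-upper f = ≤-trans (rootApprox-≤ 1 n (mean-square-nonNeg f))
    (*-monoˡ-≤-nonNeg r {{nonNegative 0≤r}} (∑-mono λ x →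
      ≤-trans (≤-reflexive (sq≡^2 (modulus f x))) (rootApprox-≤ 1 n (modulus²-nonNeg f x))))

  -- Cauchy-Schwarz against the constant 1; it controls the cross term when the error of ∣f x∣ is
  -- squared out.
  mean-≤-norm : ∀ f → r * ∑ (modulus f) ≤ norm f + 1/suc n
  mean-≤-norm f = ^-cancel-≤ 1 (+-nonNeg (rootApprox-nonNeg 2 n (0ℚ ⊔ mean-square f)) (<⇒≤ (1/suc-pos n))) (begin
    (r * ∑ (modulus f)) ^ 2
      ≡⟨ sq≡^2 (r * ∑ (modulus f)) ⟨
    sq (r * ∑ (modulus f))
      ≡⟨ solve 2 (λ r s → r :* s :* (r :* s) := r :* r :* (s :* s)) refl r (∑ (modulus f)) ⟩
    r * r * sq (∑ (modulus f))
      ≡⟨ cong (λ s → r * r * sq s) (∑-cong λ x → *-identityʳ (modulus f x)) ⟨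
    r * r * sq (∑ λ x → modulus f x * 1ℚ)
      ≤⟨ *-monoˡ-≤-nonNeg (r * r) {{nonNegative (*-nonNeg 0≤r 0≤r)}} (cauchy-schwarz (modulus f) (λ _ → 1ℚ)) ⟩
    r * r * (∑ (λ x → sq (modulus f x)) * ∑ λ _ → 1ℚ)
      ≡⟨ cong (λ e → r * r * (∑ (λ x → sq (modulus f x)) * e)) (∑-const 1ℚ) ⟩
    r * r * (∑ (λ x → sq (modulus f x)) * (P * 1ℚ))
      ≡⟨ solve 3 (λ r s q → r :* r :* (s :* (q :* con 1ℚ)) := q :* r :* (r :* s))
           refl r (∑ (λ x → sq (modulus f x))) P ⟩
    P * r * mean-square f
      ≡⟨ trans (cong (_* mean-square f) Pr≡1) (*-identityˡ (mean-square f)) ⟩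
    mean-square f
      ≤⟨ rootApprox-≥ 1 n (mean-square f) ⟩
    (norm f + 1/suc n) ^ 2 ∎)
    where
    open ≤-Reasoning
    open +-*-Solver

  -- Minkowski's inequality in L²(𝔽 p), applied to ∣f∣ and the constant 1/(n + 1).

  norm-lower : ∀ f → r * ∑ (modulus² f) ≤ (norm f + error n) ^ 2
  norm-lower f = begin
    r * ∑ (modulus² f)
      ≤⟨ *-monoˡ-≤-nonNeg r {{nonNegative 0≤r}} (∑-mono λ x → rootApprox-≥ 1 n (modulus² f x)) ⟩
    r * ∑ (λ x → (m x + e) ^ 2)
      ≡⟨ cong (r *_) (∑-cong λ x → solve 2 (λ m e → (m :+ e) :* ((m :+ e) :* con 1ℚ)
           := con 1ℚ :* (m :* m) :+ ((e :+ e) :* m :+ e :* e :* con 1ℚ)) refl (m x) e) ⟩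
    r * ∑ (λ x → 1ℚ * sq (m x) + ((e + e) * m x + e * e * 1ℚ))
      ≡⟨ cong (r *_) (Integral.∫-linear₃ (counting p) 1ℚ (e + e) (e * e) (λ x → sq (m x)) m (λ _ → 1ℚ)) ⟩
    r * (1ℚ * ∑ (λ x → sq (m x)) + ((e + e) * ∑ m + e * e * ∑ (λ _ → 1ℚ)))
      ≡⟨ cong (λ c → r * (1ℚ * ∑ (λ x → sq (m x)) + ((e + e) * ∑ m + e * e * c))) (∑-const 1ℚ) ⟩
    r * (1ℚ * ∑ (λ x → sq (m x)) + ((e + e) * ∑ m + e * e * (P * 1ℚ)))
      ≡⟨ solve 5 (λ r s t e q → r :* (con 1ℚ :* s :+ ((e :+ e) :* t :+ e :* e :* (q :* con 1ℚ)))
           := r :* s :+ ((e :+ e) :* (r :* t) :+ e :* e :* (q :* r))) refl r (∑ λ x → sq (m x)) (∑ m) e P ⟩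
    mean-square f + ((e + e) * (r * ∑ m) + e * e * (P * r))
      ≡⟨ cong (λ c → mean-square f + ((e + e) * (r * ∑ m) + e * e * c)) Pr≡1 ⟩
    mean-square f + ((e + e) * (r * ∑ m) + e * e * 1ℚ)
      ≤⟨ +-mono-≤ (rootApprox-≥ 1 n (mean-square f)) (+-monoˡ-≤ (e * e * 1ℚ)
           (*-monoˡ-≤-nonNeg (e + e) {{nonNegative (<⇒≤ (error-pos n))}} (mean-≤-norm f))) ⟩
    (norm f + e) ^ 2 + ((e + e) * (norm f + e) + e * e * 1ℚ)
      ≡⟨ solve 2 (λ b e → (b :+ e) :* ((b :+ e) :* con 1ℚ) :+ ((e :+ e) :* (b :+ e) :+ e :* e :* con 1ℚ)
           := (b :+ (e :+ e)) :* ((b :+ (e :+ e)) :* con 1ℚ)) refl (norm f) e ⟩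
    (norm f + error n) ^ 2 ∎
    where
    open ≤-Reasoning
    open +-*-Solver
    e : ℚ
    e = 1/suc n
    m : 𝔽 p → ℚ
    m = modulus f

  module _ (isPrime : Prime p) (f₁ f₂ D : 𝔽 p → ℂ)
    (D≡ : ∀ x → D x ≡ fromℝ (fromℚ (+ 1 / p)) *ᶜ Σᶜ (λ y → f₁ (x ⊕ y) *ᶜ f₂ (x ⊕ y ⊗ y)) -ᶜ 𝔼 f₁ *ᶜ 𝔼 f₂)
    where

    open Field isPrime

    a b c d : 𝔽 p → ℚ
    a x = seq (re (f₁ x)) n
    b x = seq (im (f₁ x)) n
    c x = seq (re (f₂ x)) n
    d x = seq (im (f₂ x)) n

    private
      S : 𝔽 p → ℂ
      S x = Σᶜ (λ y → f₁ (x ⊕ y) *ᶜ f₂ (x ⊕ y ⊗ y))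

      re-S : ∀ x → seq (re (S x)) n ≡ T a c x - T b d x
      re-S x = trans (seq-re-Σᶜ (λ y → f₁ (x ⊕ y) *ᶜ f₂ (x ⊕ y ⊗ y)) n)
        (∑-- (λ y → a (x ⊕ y) * c (x ⊕ y ⊗ y)) (λ y → b (x ⊕ y) * d (x ⊕ y ⊗ y)))

      im-S : ∀ x → seq (im (S x)) n ≡ T a d x + T b c x
      im-S x = trans (seq-im-Σᶜ (λ y → f₁ (x ⊕ y) *ᶜ f₂ (x ⊕ y ⊗ y)) n)
        (∑-+ (λ y → a (x ⊕ y) * d (x ⊕ y ⊗ y)) (λ y → b (x ⊕ y) * c (x ⊕ y ⊗ y)))

      -- The parts of D in terms of those of S x, Σ f₁ and Σ f₂.

      re-D′ im-D′ : ℚ → ℚ → ℚ → ℚ → ℚ → ℚ → ℚ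
      re-D′ s s′ α β γ δ = (r * s - 0ℚ * s′) +
        - ((r * α - 0ℚ * β) * (r * γ - 0ℚ * δ) - (r * β + 0ℚ * α) * (r * δ + 0ℚ * γ))
      im-D′ s s′ α β γ δ = (r * s′ + 0ℚ * s) +
        - ((r * α - 0ℚ * β) * (r * δ + 0ℚ * γ) + (r * β + 0ℚ * α) * (r * γ - 0ℚ * δ))

      cong₆ : ∀ (h : ℚ → ℚ → ℚ → ℚ → ℚ → ℚ → ℚ) {s s′ α β γ δ t t′ α′ β′ γ′ δ′} →
        s ≡ t → s′ ≡ t′ → α ≡ α′ → β ≡ β′ → γ ≡ γ′ → δ ≡ δ′ → h s s′ α β γ δ ≡ h t t′ α′ β′ γ′ δ′
      cong₆ h refl refl refl refl refl refl = refl

    re-D : ∀ x → seq (re (D x)) n ≡ r * (T̃ a c x - T̃ b d x)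
    re-D x = trans (cong (λ z → seq (re z) n) (D≡ x)) (trans
      (cong₆ re-D′ (re-S x) (im-S x) (seq-re-Σᶜ f₁ n) (seq-im-Σᶜ f₁ n) (seq-re-Σᶜ f₂ n) (seq-im-Σᶜ f₂ n))
      (solve 9 (λ r u v u′ v′ α β γ δ →
        (r :* (u :- v) :- con 0ℚ :* (u′ :+ v′)) :+
          :- ((r :* α :- con 0ℚ :* β) :* (r :* γ :- con 0ℚ :* δ)
            :- (r :* β :+ con 0ℚ :* α) :* (r :* δ :+ con 0ℚ :* γ))
        := r :* ((u :- r :* (α :* γ)) :- (v :- r :* (β :* δ))))
        refl r (T a c x) (T b d x) (T a d x) (T b c x) (∑ a) (∑ b) (∑ c) (∑ d)))
      where open +-*-Solver

    im-D : ∀ x → seq (im (D x)) n ≡ r * (T̃ a d x + T̃ b c x)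
    im-D x = trans (cong (λ z → seq (im z) n) (D≡ x)) (trans
      (cong₆ im-D′ (re-S x) (im-S x) (seq-re-Σᶜ f₁ n) (seq-im-Σᶜ f₁ n) (seq-re-Σᶜ f₂ n) (seq-im-Σᶜ f₂ n))
      (solve 9 (λ r u v u′ v′ α β γ δ →
        (r :* (u′ :+ v′) :+ con 0ℚ :* (u :- v)) :+
          :- ((r :* α :- con 0ℚ :* β) :* (r :* δ :+ con 0ℚ :* γ)
            :+ (r :* β :+ con 0ℚ :* α) :* (r :* γ :- con 0ℚ :* δ))
        := r :* ((u′ :- r :* (α :* δ)) :+ (v′ :- r :* (β :* γ))))
        refl r (T a c x) (T b d x) (T a d x) (T b c x) (∑ a) (∑ b) (∑ c) (∑ d)))
      where open +-*-Solver

    A B₁ B₂ : ℚ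
    A = r * ∑ (modulus² D)
    B₁ = r * ∑ (modulus² f₁)
    B₂ = r * ∑ (modulus² f₂)

    A-nonNeg : 0ℚ ≤ A
    A-nonNeg = *-nonNeg 0≤r (∑-nonNeg (modulus²-nonNeg D))

    B₁B₂-nonNeg : 0ℚ ≤ B₁ * B₂
    B₁B₂-nonNeg = *-nonNeg (*-nonNeg 0≤r (∑-nonNeg (modulus²-nonNeg f₁)))
                           (*-nonNeg 0≤r (∑-nonNeg (modulus²-nonNeg f₂)))

    A⁴-≤ : fourth A ≤ (+ 65536 / 1) * r * fourth (B₁ * B₂)
    A⁴-≤ = subst₂ (λ x y → fourth (r * x) ≤ (+ 65536 / 1) * r * y)
      (∑-cong λ x → sym (cong₂ (λ u v → sq u + sq v) (re-D x) (im-D x)))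
      (trans (cong₂ (λ x y → fourth (r * x) * fourth (r * y))
               (sym (∑-+ (λ x → sq (a x)) (λ x → sq (b x))))
               (sym (∑-+ (λ x → sq (c x)) (λ x → sq (d x)))))
             (sym (fourth-* B₁ B₂)))
      (fourth-deviation-≤ a b c d)

    r≤1 : r ≤ 1ℚ
    r≤1 = begin
      r        ≡⟨ *-identityˡ r ⟨
      1ℚ * r   ≤⟨ *-monoʳ-≤-nonNeg r {{nonNegative 0≤r}} 1≤P ⟩
      P * r    ≡⟨ Pr≡1 ⟩
      1ℚ       ∎
      where open ≤-Reasoning

    ρ : ℚ
    ρ = seq (root 10 (fromℚ r)) n

    0≤ρ+ : 0ℚ ≤ ρ + error n
    0≤ρ+ = +-nonNeg (rootApprox-nonNeg 10 n (0ℚ ⊔ r)) (<⇒≤ (error-pos n))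

    -- Padded by a second `1/suc n`, so that all three factors of the final bound carry the same
    -- `error n`.
    r-≤ : r ≤ (ρ + error n) ^ 10
    r-≤ = ≤-trans (rootApprox-≥ 9 n r)
      (^-mono-≤ 10 (+-nonNeg (rootApprox-nonNeg 10 n (0ℚ ⊔ r)) (<⇒≤ (1/suc-pos n)))
        (+-monoʳ-≤ ρ (p≤p+q (<⇒≤ (1/suc-pos n)))))

    0≤norm+ : ∀ f → 0ℚ ≤ norm f + error n
    0≤norm+ f = +-nonNeg (rootApprox-nonNeg 2 n (0ℚ ⊔ mean-square f)) (<⇒≤ (error-pos n))

    -- The comparison takes place between tenth powers, since `ρ` is controlled only through its
    -- tenth power; for the norms these are fifth powers of squared norms.
    norm-D-≤ : norm D ≤ (+ 4 / 1) * (ρ + error n) * (norm f₁ + error n) * (norm f₂ + error n)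
    norm-D-≤ = ^-cancel-≤ 9 bound-nonNeg (begin
      norm D ^ 10
        ≡⟨ ^-assocʳ (norm D) 2 5 ⟨
      (norm D ^ 2) ^ 5
        ≤⟨ ^-mono-≤ 5 (^-nonNeg 2 (rootApprox-nonNeg 2 n (0ℚ ⊔ mean-square D))) (norm-upper D) ⟩
      A ^ 5
        ≤⟨ fifth-power-bound A-nonNeg B₁B₂-nonNeg 0≤r r≤1 A⁴-≤ ⟩
      c₁₀ * r * (B₁ * B₂) ^ 5
        ≤⟨ *-mono-≤-nonNeg (*-nonNeg (nonNegative⁻¹ c₁₀) 0≤r)
             (^-nonNeg 5 (*-nonNeg (^-nonNeg 2 (0≤norm+ f₁)) (^-nonNeg 2 (0≤norm+ f₂))))
             (*-monoˡ-≤-nonNeg c₁₀ r-≤)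
             (^-mono-≤ 5 B₁B₂-nonNeg (*-mono-≤-nonNeg (*-nonNeg 0≤r (∑-nonNeg (modulus²-nonNeg f₁)))
               (^-nonNeg 2 (0≤norm+ f₂)) (norm-lower f₁) (norm-lower f₂))) ⟩
      c₁₀ * R ^ 10 * (N₁ ^ 2 * N₂ ^ 2) ^ 5
        ≡⟨ cong (c₁₀ * R ^ 10 *_) (trans (^-distrib-* (N₁ ^ 2) (N₂ ^ 2) 5)
             (cong₂ _*_ (^-assocʳ N₁ 2 5) (^-assocʳ N₂ 2 5))) ⟩
      c₁₀ * R ^ 10 * (N₁ ^ 10 * N₂ ^ 10)
        ≡⟨ *-assoc (c₁₀ * R ^ 10) (N₁ ^ 10) (N₂ ^ 10) ⟨
      c₁₀ * R ^ 10 * N₁ ^ 10 * N₂ ^ 10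
        ≡⟨ cong (λ x → x * N₁ ^ 10 * N₂ ^ 10) (^-distrib-* (+ 4 / 1) R 10) ⟨
      ((+ 4 / 1) * R) ^ 10 * N₁ ^ 10 * N₂ ^ 10
        ≡⟨ cong (_* N₂ ^ 10) (^-distrib-* ((+ 4 / 1) * R) N₁ 10) ⟨
      ((+ 4 / 1) * R * N₁) ^ 10 * N₂ ^ 10
        ≡⟨ ^-distrib-* ((+ 4 / 1) * R * N₁) N₂ 10 ⟨
      ((+ 4 / 1) * R * N₁ * N₂) ^ 10 ∎)
      where
      open ≤-Reasoning
      bound-nonNeg =
        *-nonNeg (*-nonNeg (*-nonNeg (nonNegative⁻¹ (+ 4 / 1)) 0≤ρ+) (0≤norm+ f₁)) (0≤norm+ f₂)
      c₁₀ R N₁ N₂ : ℚ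
      c₁₀ = (+ 4 / 1) ^ 10
      R = ρ + error n
      N₁ = norm f₁ + error n
      N₂ = norm f₂ + error n

    seq-bound : seq ‖ D ‖₂ n ≤ (+ 4 / 1) * (seq (root 10 (fromℚ (+ 1 / p))) n + error n)
      * (seq ‖ f₁ ‖₂ n + error n) * (seq ‖ f₂ ‖₂ n + error n)
    seq-bound = subst₂ _≤_ (sym (seq-‖‖₂ D))
      (cong₂ (λ x y → (+ 4 / 1) * (ρ + error n) * (x + error n) * (y + error n))
        (sym (seq-‖‖₂ f₁)) (sym (seq-‖‖₂ f₂)))
      norm-D-≤

-- Supplies D in bound by pattern unification; an explicit D would be compared with the
-- goal by unfolding the arithmetic of ℝ, including its Cauchy proofs.

deviation-refl : (p : ℕ) .{{_ : NonZero p}} (f₁ f₂ : 𝔽 p → ℂ) (x : 𝔽 p) →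
  fromℝ (fromℚ (+ 1 / p)) *ᶜ Σᶜ (λ y → f₁ (x ⊕ y) *ᶜ f₂ (x ⊕ y ⊗ y)) -ᶜ 𝔼 f₁ *ᶜ 𝔼 f₂
  ≡ fromℝ (fromℚ (+ 1 / p)) *ᶜ Σᶜ (λ y → f₁ (x ⊕ y) *ᶜ f₂ (x ⊕ y ⊗ y)) -ᶜ 𝔼 f₁ *ᶜ 𝔼 f₂
deviation-refl p f₁ f₂ x = refl

bound : (p : ℕ) .{{_ : NonZero p}} → Prime p → (f₁ f₂ D : 𝔽 p → ℂ) →
  (∀ x → D x ≡ fromℝ (fromℚ (+ 1 / p)) *ᶜ Σᶜ (λ y → f₁ (x ⊕ y) *ᶜ f₂ (x ⊕ y ⊗ y)) -ᶜ 𝔼 f₁ *ᶜ 𝔼 f₂) →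
  ‖ D ‖₂ ≤ʳ fromℚ (+ 4 / 1) *ʳ root 10 (fromℚ (+ 1 / p)) *ʳ ‖ f₁ ‖₂ *ʳ ‖ f₂ ‖₂
bound p isPrime f₁ f₂ D D≡ =
  product-≤ʳ (+ 4 / 1) ‖ D ‖₂ (root 10 (fromℚ (+ 1 / p))) ‖ f₁ ‖₂ ‖ f₂ ‖₂
    (λ n → Norm.seq-bound p n isPrime f₁ f₂ D D≡)

theorem1p1 : ∃[ c ] (0ʳ <ʳ c) × ((p : ℕ) .{{_ : NonZero p}} → Prime p →
    (f₁ f₂ : 𝔽 p → ℂ) →
    let F : 𝔽 p → ℂ
        F x = fromℝ (fromℚ (+ 1 / p)) *ᶜ Σᶜ (λ y → f₁ (x ⊕ y) *ᶜ f₂ (x ⊕ y ⊗ y))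
    in ‖ (λ x → F x -ᶜ 𝔼 f₁ *ᶜ 𝔼 f₂) ‖₂
         ≤ʳ c *ʳ root 10 (fromℚ (+ 1 / p)) *ʳ ‖ f₁ ‖₂ *ʳ ‖ f₂ ‖₂)
theorem1p1 =
  fromℚ (+ 4 / 1) ,
  (1ℚ , positive⁻¹ 1ℚ , 0 , λ _ _ → *<* (ℤ.+<+ (ℕ.s≤s (ℕ.s≤s ℕ.z≤n)))) ,
  λ p isPrime f₁ f₂ → let h = bound p isPrime f₁ f₂ _ (deviation-refl p f₁ f₂) in h
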